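{- Let $k\ge1$, $n\ge2k+2$ and let $\mathbb{K}$ be a field. The Pfaffians of degree $k+1$ (one for each $U\subset[n]$ with $|U|=2k+2$) are a Gröbner basis for $I_k(n)$ with respect to any fp-positive vector $v\in\mathrm{FP}_n$. If the fp-positive vector $v$ is sufficiently generic, then $\mathrm{in}_v(I_k(n))$ is the monomial ideal generated by all $(k+1)$-crossings, i.e. by the monomials $\prod_{\{i,j\}\in C}x_{i,j}$ for all $(k+1)$-crossings $C\subset\binom{[n]}{2}$.
   Context: Edges $\{i,j\},\{i',j'\}\in\binom{[n]}{2}$ with $i<j$, $i'<j'$ cross if $i<i'<j<j'$ or $i'<i<j'<j$. A $(k+1)$-crossing is a set of $k+1$ mutually crossing edges. The Pfaffian of degree $k+1$ of $U$ is $\sum_E(-1)^{\mathrm{cr}(E)}\prod_{\{i,j\}\in E}x_{i,j}$ over perfect matchings $E$ of $U$, where $\mathrm{cr}(E)$ is the number of crossing pairs of edges in $E$. $I_k(n)\subset\mathbb{K}[x_{i,j}:\{i,j\}\in\binom{[n]}{2}]$ is the ideal generated by these Pfaffians. $\mathrm{FP}_n$ is the set of (fp-positive) vectors $v\in\mathbb{R}^{\binom{[n]}{2}}$ with $v_{a,b}+v_{a',b'}\ge\max\{v_{a,a'}+v_{b,b'},\,v_{a,b'}+v_{a',b}\}$ for all $1\le a<a'<b<b'\le n$. For a weight vector $v$, $\mathrm{in}_v(f)$ is the sum of terms of $f$ of maximum $v$-weight, $\mathrm{in}_v(I)$ is the ideal generated by $\mathrm{in}_v(f)$ for $f\in I$,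 and $B\subset I$ is a Gröbner basis of $I$ with respect to $v$ if $\{\mathrm{in}_v(f):f\in B\}$ generates $\mathrm{in}_v(I)$. "Sufficiently generic" means outside some finite union of proper linear hyperplanes. -}

module Defs where

open import Level using (_⊔_; suc)
open import Algebra.Bundles using (CommutativeRing)
open import Algebra.Apartness.Bundles using (HeytingField; HeytingCommutativeRing)
import Algebra.Construct.NaturalChoice.Max as Max
import Algebra.Properties.Semiring.Exp as Exp
open import Data.Fin.Base using (Fin; _<_)
open import Data.Fin.Properties using (_≟_; _<?_; <-trans; <-irrelevant; all?)
open import Data.Fin.Subset using (Subset; ∣_∣) renaming (_∈_ to _∈ˢ_)
open import Data.Fin.Subset.Properties using () renaming (_∈?_ to _∈ˢ?_)
open import Data.List.Base
  using (List; []; _∷_; [_]; _++_; map; foldr; filter; length; allFin; mapMaybe; cartesianProduct;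
         cartesianProductWith)
open import Data.List.Membership.Propositional.Properties using (∈-∃++)
open import Data.List.Relation.Binary.Permutation.Propositional
  using (_↭_; ↭-refl; ↭-sym; ↭-trans; prep)
open import Data.List.Relation.Binary.Permutation.Propositional.Properties
  using (∈-resp-↭; shift; drop-∷; ¬x∷xs↭[])
open import Data.List.Relation.Unary.All as All using (All)
open import Data.List.Relation.Unary.AllPairs using (AllPairs)
open import Data.List.Relation.Unary.Any using (here)
import Data.List.Membership.DecPropositional as DecMembership
open import Data.Maybe.Base using (Maybe; just; nothing)
open import Data.Nat.Base as ℕ using (ℕ)
import Data.Nat.Properties as ℕ
open import Data.Product.Base using (_×_; _,_; ∃; proj₁; proj₂)
open import Data.Sum.Base using (_⊎_)
open import Relation.Binary.Bundles using (TotalOrder)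
open import Relation.Binary.Core using (Rel)
open import Relation.Binary.Definitions using (Decidable; DecidableEquality)
open import Relation.Binary.PropositionalEquality using (_≡_; refl)
open import Relation.Binary.Structures using (IsTotalOrder)
open import Relation.Nullary.Decidable using (Dec; yes; no; map′; _×-dec_; _⊎-dec_; _→-dec_)
open import Relation.Nullary.Negation using (¬_)
open import Relation.Unary using (Pred; Satisfiable; _⊆_; _≐_)

-- Under excluded middle, a Heyting field is exactly a field: by tightness,
-- x # y is then equivalent to ¬ (x ≈ y).
fieldRing : ∀ {c ℓ₁ ℓ₂} → HeytingField c ℓ₁ ℓ₂ → CommutativeRing c ℓ₁
fieldRing K = HeytingCommutativeRing.commutativeRing (HeytingField.heytingCommutativeRing K)

-- The real numbers, characterised (up to unique isomorphism) as a
-- Dedekind-complete ordered field.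
record RealNumbers r ℓ₁ ℓ₂ ℓ₃ : Set (suc (r ⊔ ℓ₁ ⊔ ℓ₂ ⊔ ℓ₃)) where
  infix 4 _≤_
  field
    heytingField : HeytingField r ℓ₁ ℓ₂

  open HeytingField heytingField public

  field
    _≤_          : Rel Carrier ℓ₃
    isTotalOrder : IsTotalOrder _≈_ _≤_
    +-monoˡ-≤    : ∀ {x y} z → x ≤ y → (x + z) ≤ (y + z)
    *-nonNeg     : ∀ {x y} → 0# ≤ x → 0# ≤ y → 0# ≤ (x * y)

  totalOrder : TotalOrder r ℓ₁ ℓ₃
  totalOrder = record { isTotalOrder = isTotalOrder }

  UpperBound : Pred Carrier r → Pred Carrier (r ⊔ ℓ₃)
  UpperBound P b = ∀ x → P x → x ≤ b

  field
    complete : ∀ (P : Pred Carrier r) → Satisfiable P → Satisfiable (UpperBound P) →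
               ∃ λ s → UpperBound P s × (∀ b → UpperBound P b → s ≤ b)

  open Max totalOrder using () renaming (_⊔_ to max) public

record Edge (n : ℕ) : Set where
  constructor edge
  field
    {lo} {hi} : Fin n
    lo<hi     : lo < hi

open Edge public

module _ {n : ℕ} where

  _≟ₑ_ : DecidableEquality (Edge n)
  edge {i} {j} p ≟ₑ edge {i′} {j′} p′ with i ≟ i′ | j ≟ j′
  ... | no i≢i′  | _        = no λ { refl → i≢i′ refl }
  ... | yes _    | no j≢j′  = no λ { refl → j≢j′ refl }
  ... | yes refl | yes refl with refl ← <-irrelevant p p′ = yes refl

  open DecMembership _≟ₑ_ public using () renaming (_∈?_ to _∈ₑ?_)

  Crosses : Rel (Edge n) _
  Crosses e f = (lo e < lo f × lo f < hi e × hi e < hi f)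
              ⊎ (lo f < lo e × lo e < hi f × hi f < hi e)

  crosses? : Decidable Crosses
  crosses? e f = (lo e <? lo f ×-dec lo f <? hi e ×-dec hi e <? hi f)
           ⊎-dec (lo f <? lo e ×-dec lo e <? hi f ×-dec hi f <? hi e)

  cr : List (Edge n) → ℕ
  cr []       = 0
  cr (e ∷ es) = length (filter (crosses? e) es) ℕ.+ cr es

  -- Since no edge crosses itself, the members of C are automatically
  -- distinct, so C represents a set of m edges.
  IsCrossing : ℕ → Pred (List (Edge n)) _
  IsCrossing m C = length C ≡ m × AllPairs Crosses C

  Incident : Fin n → Pred (Edge n) _
  Incident i e = i ≡ lo e ⊎ i ≡ hi e

  incident? : ∀ i e → Dec (Incident i e)
  incident? i e = i ≟ lo e ⊎-dec i ≟ hi e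

  degree : Fin n → List (Edge n) → ℕ
  degree i E = length (filter (incident? i) E)

  IsPerfectMatching : Subset n → Pred (List (Edge n)) _
  IsPerfectMatching U E =
    All (λ e → lo e ∈ˢ U × hi e ∈ˢ U) E × (∀ i → i ∈ˢ U → degree i E ≡ 1)

  isPerfectMatching? : ∀ U E → Dec (IsPerfectMatching U E)
  isPerfectMatching? U E =
    All.all? (λ e → lo e ∈ˢ? U ×-dec hi e ∈ˢ? U) E
      ×-dec all? (λ i → i ∈ˢ? U →-dec degree i E ℕ.≟ 1)

edges : ∀ n → List (Edge n)
edges n = mapMaybe toEdge (cartesianProduct (allFin n) (allFin n))
  where
  toEdge : Fin n × Fin n → Maybe (Edge n)
  toEdge (i , j) with i <? j
  ... | yes i<j = just (edge i<j)
  ... | no  _   = nothing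

sublists : ∀ {a} {A : Set a} → List A → List (List A)
sublists []       = [ [] ]
sublists (x ∷ xs) = map (x ∷_) (sublists xs) ++ sublists xs

-- Sets of edges are enumerated, each exactly once, as sublists of `edges n`.
perfectMatchings : ∀ {n} → Subset n → List (List (Edge n))
perfectMatchings {n} U = filter (isPerfectMatching? U) (sublists (edges n))

-- A list of edges, up to permutation, stands for the product of the
-- corresponding variables (with multiplicity).
Monomial : ℕ → Set
Monomial n = List (Edge n)

_≟ₘ_ : ∀ {n} (s t : Monomial n) → Dec (s ↭ t)
[] ≟ₘ []      = yes ↭-refl
[] ≟ₘ (e ∷ t) = no λ p → ¬x∷xs↭[] (↭-sym p)
(e ∷ s) ≟ₘ t with e ∈ₑ? t
... | no  e∉t = no λ p → e∉t (∈-resp-↭ p (here refl))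
... | yes e∈t with ∈-∃++ e∈t
...   | t₁ , t₂ , refl =
        map′ (λ p → ↭-trans (prep e p) (↭-sym (shift e t₁ t₂)))
             (λ p → drop-∷ (↭-trans p (shift e t₁ t₂)))
             (s ≟ₘ (t₁ ++ t₂))

module _ {c ℓ} (R : CommutativeRing c ℓ) (n : ℕ) where

  open CommutativeRing R

  -- A formal sum of terms; repeated monomials and zero coefficients are
  -- allowed, and equality is equality of all coefficients.
  Poly : Set c
  Poly = List (Carrier × Monomial n)

module _ {c ℓ} (R : CommutativeRing c ℓ) {n : ℕ} where

  open CommutativeRing R hiding (zero)

  coeff : Poly R n → Monomial n → Carrier
  coeff f m = foldr (λ t s → proj₁ t + s) 0# (filter (λ t → proj₂ t ≟ₘ m) f)

  infix 4 _≈ₚ_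
  _≈ₚ_ : Rel (Poly R n) ℓ
  f ≈ₚ g = ∀ m → coeff f m ≈ coeff g m

  monomial : Monomial n → Poly R n
  monomial m = [ 1# , m ]

  infixl 6 _+ₚ_
  _+ₚ_ : Poly R n → Poly R n → Poly R n
  _+ₚ_ = _++_

  infixl 7 _*ₚ_
  _*ₚ_ : Poly R n → Poly R n → Poly R n
  _*ₚ_ = cartesianProductWith λ (a , s) (b , t) → a * b , s ++ t

  data Ideal⟨_⟩ {s} (S : Pred (Poly R n) s) : Pred (Poly R n) (c ⊔ ℓ ⊔ s) where
    gen   : ∀ {f} → S f → Ideal⟨ S ⟩ f
    zero  : Ideal⟨ S ⟩ []
    add   : ∀ {f g} → Ideal⟨ S ⟩ f → Ideal⟨ S ⟩ g → Ideal⟨ S ⟩ (f +ₚ g)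
    mult  : ∀ {f} g → Ideal⟨ S ⟩ f → Ideal⟨ S ⟩ (g *ₚ f)
    resp  : ∀ {f g} → f ≈ₚ g → Ideal⟨ S ⟩ f → Ideal⟨ S ⟩ g

  pfaffian : Subset n → Poly R n
  pfaffian U = map (λ E → (- 1#) ^ cr E , E) (perfectMatchings U)
    where open Exp semiring using (_^_)

  Pfaffians : ℕ → Pred (Poly R n) ℓ
  Pfaffians d f = ∃ λ (U : Subset n) → ∣ U ∣ ≡ 2 ℕ.* d × f ≈ₚ pfaffian U

  PfaffianIdeal : ℕ → Pred (Poly R n) (c ⊔ ℓ)
  PfaffianIdeal k = Ideal⟨ Pfaffians (k ℕ.+ 1) ⟩

  CrossingMonomials : ℕ → Pred (Poly R n) ℓ
  CrossingMonomials m f = ∃ λ C → IsCrossing m C × f ≈ₚ monomial C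

module _ {r ℓ₁ ℓ₂ ℓ₃} (ℝ : RealNumbers r ℓ₁ ℓ₂ ℓ₃) where

  private module ℝ = RealNumbers ℝ

  Weight : ℕ → Set r
  Weight n = Edge n → ℝ.Carrier

  module _ {n : ℕ} where

    FPPositive : Pred (Weight n) ℓ₃
    FPPositive v =
      ∀ {a a′ b b′ : Fin n} (p : a < a′) (q : a′ < b) (r : b < b′) →
      ℝ.max (v (edge p) ℝ.+ v (edge r))
            (v (edge (<-trans p (<-trans q r))) ℝ.+ v (edge q))
        ℝ.≤ v (edge (<-trans p q)) ℝ.+ v (edge (<-trans q r))

    -- The hyperplane { v | Σₑ h e * v e ≈ 0 } with normal vector h, which is
    -- proper when h is nonzero.
    Nonzero : Pred (Weight n) ℓ₁
    Nonzero h = ∃ λ e → ¬ (h e ℝ.≈ ℝ.0#)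

    OnHyperplane : Weight n → Pred (Weight n) ℓ₁
    OnHyperplane h v = foldr (λ e s → h e ℝ.* v e ℝ.+ s) ℝ.0# (edges n) ℝ.≈ ℝ.0#

    ForSufficientlyGeneric : ∀ {p q} → Pred (Weight n) p → Pred (Weight n) q →
                             Set (r ⊔ ℓ₁ ⊔ p ⊔ q)
    ForSufficientlyGeneric P Q =
      ∃ λ (H : List (Weight n)) → All Nonzero H ×
        (∀ v → P v → All (λ h → ¬ OnHyperplane h v) H → Q v)

    weight : Weight n → Monomial n → ℝ.Carrier
    weight v = foldr (λ e s → v e ℝ.+ s) ℝ.0#

    module _ {c ℓ} (R : CommutativeRing c ℓ) where

      open CommutativeRing R

      InSupport : Poly R n → Pred (Monomial n) ℓ
      InSupport f m = ¬ (coeff R f m ≈ 0#)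

      IsLeading : Weight n → Poly R n → Pred (Monomial n) (ℓ ⊔ ℓ₃)
      IsLeading v f m =
        InSupport f m × (∀ m′ → InSupport f m′ → weight v m′ ℝ.≤ weight v m)

      -- g = in_v(f).  Constructively in_v is not a computable function of f,
      -- so its graph is given; in particular in_v(0) = 0.
      IsInitialForm : Weight n → Poly R n → Pred (Poly R n) (ℓ ⊔ ℓ₃)
      IsInitialForm v f g =
        ∀ m → (IsLeading v f m → coeff R g m ≈ coeff R f m)
            × (¬ IsLeading v f m → coeff R g m ≈ 0#)

      InitialForms : ∀ {s} → Weight n → Pred (Poly R n) s →
                     Pred (Poly R n) (c ⊔ ℓ ⊔ ℓ₃ ⊔ s)
      InitialForms v S g = ∃ λ f → S f × IsInitialForm v f g

      InitialIdeal : ∀ {s} → Weight n → Pred (Poly R n) s →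
                     Pred (Poly R n) (c ⊔ ℓ ⊔ ℓ₃ ⊔ s)
      InitialIdeal v I = Ideal⟨_⟩ R (InitialForms v I)

      IsGröbnerBasis : ∀ {s t} → Weight n → Pred (Poly R n) s → Pred (Poly R n) t →
                       Set (c ⊔ ℓ ⊔ ℓ₃ ⊔ s ⊔ t)
      IsGröbnerBasis v B I =
        B ⊆ I × Ideal⟨_⟩ R (InitialForms v B) ≐ InitialIdeal v I

{-# OPTIONS --safe #-}

-- Call a monomial standard if no (k + 1)-crossing divides it.  Exchanging noncrossing pairs of edges
-- for crossing ones shows that, for every fp-positive v, the all-crossing matching of a set U has the
-- largest v-weight among all perfect matchings of U.  Hence every polynomial reduces modulo the
-- Pfaffians to a combination of standard monomials without any increase of v-weights, and both claims
-- follow once the standard monomials are linearly independent modulo I_k(n).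
--
-- Since the standard monomials of bounded degree span the quotient, it suffices to find equally many
-- monomials that are independent; the monomials without (k + 1)-nestings will do.  The substitution
-- x_ab = Σ_{l<k} (y_la z_lb − y_lb z_la) kills the Pfaffians of degree k + 1, because the exponential
-- of a sum of k decomposable 2-forms has degree at most 2k.  A (k + 1)-nesting-free monomial can be
-- coloured with k lanes so that edges in the same lane are not nested.  By the rearrangement inequality
-- the product of all y_la z_lb over its edges {a < b} with lane l occurs in the image of no other
-- monomial whose weight Σ ab is at least as large, and it occurs there with coefficient 1.
--
-- Finally, standard monomials inject into nesting-free ones of the same degree: growth diagrams on the
-- staircase of pairs a < b identify the former, by the RSK rule, and the latter, by Burge's rule, with
-- sequences of partitions with at most k rows.
module Submission where

open import Defs

-- Why nesting-free monomials: to detect a monomial in the image of the substitution, its edges must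
-- be spread over `k` lanes so that the endpoints in each lane single out the pairing. Enclosure is
-- a strict partial order, so a monomial without (k + 1)-nestings splits into `k` lanes without
-- nestings, and rearrangement singles out the monotone pairing of a lane. Crossing is not
-- transitive: the 5-cycle is the crossing graph of five chords, no three of them mutually crossing,
-- and it has no colouring with two colours. So standard monomials cannot in general be spread over
-- `k` lanes without crossings, and their independence is obtained by counting.
--
-- The exponential that kills the Pfaffians is expanded as a product of factors 1 + t over pairs of
-- odd variables. No factorial is inverted, so the argument holds in every characteristic.
--
-- The injection keeps degrees because the sum over a row of a filling is the difference of the
-- sizes of two boundary partitions, and this holds for both local rules.

module GrowthDiagrams where
  open import Data.Empty using (⊥-elim)
  open import Data.Fin.Base as Fin using (Fin; toℕ; fromℕ<)
  import Data.Fin.Properties as Fin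
  open import Data.List.Base using (List; []; _∷_; length; _++_; filter; replicate)
  open import Data.List.Membership.Propositional using (_∈_)
  open import Data.List.Membership.Propositional.Properties using (∈-∃++)
  open import Data.List.Properties
    using (filter-accept; filter-reject; filter-++; length-++; length-replicate)
  open import Data.List.Relation.Binary.Permutation.Propositional
    using (_↭_; ↭-sym; ↭-trans; ↭-refl; prep)
  open import Data.List.Relation.Binary.Permutation.Propositional.Properties
    using (filter-↭; ↭-length; shift)
  open import Data.List.Relation.Binary.Pointwise.Base using (Pointwise; []; _∷_)
  open import Data.List.Relation.Unary.All as All using (All; []; _∷_)
  open import Data.List.Relation.Unary.AllPairs using (AllPairs; []; _∷_)
  open import Data.List.Relation.Unary.Any using (here; there)
  open import Data.Nat.Base
  open import Data.Nat.Properties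
  open import Data.Product.Base using (_×_; _,_; ∃; ∃₂; proj₁; proj₂)
  open import Data.Sum.Base using (inj₁; inj₂)
  open import Function.Base using (_∘_; _$_)
  open import Relation.Binary.Definitions using (DecidableEquality)
  open import Relation.Binary.PropositionalEquality
  open import Relation.Nullary.Decidable using (yes; no)
  open import Relation.Nullary.Negation using (¬_; contradiction)
  open import Data.Nat.Tactic.RingSolver using (solve-∀)

  -- Partitions, horizontal strips and the local rule of RSK.

  Shape : Set
  Shape = ℕ → ℕ

  Filling : Set
  Filling = ℕ → ℕ → ℕ

  -- The two inequalities together force both sequences to be weakly decreasing, so a `Shape`
  -- carries no proof of being a partition.
  record HStrip (ν μ : Shape) : Set where
    constructor hstrip
    field
      ⊆ₛ        : ∀ l → ν l ≤ μ l
      interlace : ∀ l → μ (suc l) ≤ ν l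

  open HStrip

  hstrip-zero : ∀ {ν μ} → (∀ l → ν l ≡ 0) → (∀ l → μ l ≡ 0) → HStrip ν μ
  hstrip-zero ν≡0 μ≡0 .⊆ₛ l rewrite ν≡0 l = z≤n
  hstrip-zero ν≡0 μ≡0 .interlace l rewrite μ≡0 (suc l) = z≤n

  hstrip-cong : ∀ {ν ν′ μ μ′} → (∀ l → ν l ≡ ν′ l) → (∀ l → μ l ≡ μ′ l) → HStrip ν μ → HStrip ν′ μ′
  hstrip-cong ν≗ μ≗ s .⊆ₛ l = subst₂ _≤_ (ν≗ l) (μ≗ l) (⊆ₛ s l)
  hstrip-cong ν≗ μ≗ s .interlace l = subst₂ _≤_ (μ≗ (suc l)) (ν≗ l) (interlace s l)

  size : ℕ → Shape → ℕ
  size zero    λ′ = 0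
  size (suc k) λ′ = size k λ′ + λ′ k

  size-zero : ∀ k {μ} → (∀ l → μ l ≡ 0) → size k μ ≡ 0
  size-zero zero    _  = refl
  size-zero (suc k) eq = cong₂ _+_ (size-zero k eq) (eq k)

  m⊔n+m⊓n≡m+n : ∀ m n → (m ⊔ n) + (m ⊓ n) ≡ m + n
  m⊔n+m⊓n≡m+n m n with ≤-total m n
  ... | inj₁ m≤n rewrite m≤n⇒m⊔n≡n m≤n | m≤n⇒m⊓n≡m m≤n = +-comm n m
  ... | inj₂ n≤m rewrite m≥n⇒m⊔n≡m n≤m | m≥n⇒m⊓n≡n n≤m = refl

  -- The corners of a cell in a growth diagram are ν ⊆ μ , ρ ⊆ λ; the corner λ is written κ below
  -- when it is a variable.
  module RSKRule (ν μ ρ : Shape) (x : ℕ) where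

    -- The entry is inserted into row 0; what both neighbours gained over `ν` in row `l` is bumped
    -- into row `l + 1`.
    inflow : Shape
    inflow zero    = x
    inflow (suc l) = μ l ⊓ ρ l ∸ ν l

    shape : Shape
    shape l = (μ l ⊔ ρ l) + inflow l

  module _ {ν μ ρ : Shape} {x : ℕ} (νμ : HStrip ν μ) (νρ : HStrip ν ρ) where
    open RSKRule ν μ ρ x

    private
      ν≤min : ∀ l → ν l ≤ μ l ⊓ ρ l
      ν≤min l = ⊓-glb (⊆ₛ νμ l) (⊆ₛ νρ l)

      max≤ν : ∀ l → μ (suc l) ⊔ ρ (suc l) ≤ ν l
      max≤ν l = ⊔-lub (interlace νμ l) (interlace νρ l)

    -- The entry `x` has dropped out: this toggle relation recovers `ν` from the other three
    -- corners. It also yields the interlacing of the new shape.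
    rsk-exchange : ∀ l → shape (suc l) + ν l ≡ (μ (suc l) ⊔ ρ (suc l)) + (μ l ⊓ ρ l)
    rsk-exchange l = begin-equality
      (μ (suc l) ⊔ ρ (suc l)) + (μ l ⊓ ρ l ∸ ν l) + ν l ≡⟨ +-assoc (μ (suc l) ⊔ ρ (suc l)) _ _ ⟩
      (μ (suc l) ⊔ ρ (suc l)) + (μ l ⊓ ρ l ∸ ν l + ν l)
        ≡⟨ cong (μ (suc l) ⊔ ρ (suc l) +_) (m∸n+n≡m (ν≤min l)) ⟩
      (μ (suc l) ⊔ ρ (suc l)) + (μ l ⊓ ρ l)             ∎
      where open ≤-Reasoning

    private
      shape≤min : ∀ l → shape (suc l) ≤ μ l ⊓ ρ l
      shape≤min l = +-cancelʳ-≤ (ν l) _ _ (begin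
        shape (suc l) + ν l                        ≡⟨ rsk-exchange l ⟩
        (μ (suc l) ⊔ ρ (suc l)) + (μ l ⊓ ρ l)      ≤⟨ +-monoˡ-≤ _ (max≤ν l) ⟩
        ν l + (μ l ⊓ ρ l)                          ≡⟨ +-comm (ν l) _ ⟩
        (μ l ⊓ ρ l) + ν l                          ∎)
        where open ≤-Reasoning

    rsk-hstripˡ : HStrip μ shape
    rsk-hstripˡ .⊆ₛ l = ≤-trans (m≤m⊔n (μ l) (ρ l)) (m≤m+n _ _)
    rsk-hstripˡ .interlace l = ≤-trans (shape≤min l) (m⊓n≤m _ _)

    rsk-hstripʳ : HStrip ρ shape
    rsk-hstripʳ .⊆ₛ l = ≤-trans (m≤n⊔m (μ l) (ρ l)) (m≤m+n _ _)
    rsk-hstripʳ .interlace l = ≤-trans (shape≤min l) (m⊓n≤n _ _)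

    -- Cutting all shapes off after `k` rows loses exactly what flows into row `k`, hence the
    -- correction `inflow k`; for `k = 0` it is the entry itself.
    rsk-size : ∀ k → size k shape + size k ν + inflow k ≡ size k μ + size k ρ + x
    rsk-size zero    = refl
    rsk-size (suc k) = begin-equality
      size k shape + (M + I) + (size k ν + ν k) + (m ∸ ν k)
        ≡⟨ rearrange₁ (size k shape) M I (size k ν) (ν k) (m ∸ ν k) ⟩
      (size k shape + size k ν + I) + (M + (m ∸ ν k + ν k))
        ≡⟨ cong₂ _+_ (rsk-size k) (cong (M +_) (m∸n+n≡m (ν≤min k))) ⟩
      (size k μ + size k ρ + x) + (M + m)
        ≡⟨ cong (size k μ + size k ρ + x +_) (m⊔n+m⊓n≡m+n (μ k) (ρ k)) ⟩
      (size k μ + size k ρ + x) + (μ k + ρ k)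
        ≡⟨ rearrange₂ (size k μ) (size k ρ) x (μ k) (ρ k) ⟩
      size k μ + μ k + (size k ρ + ρ k) + x                     ∎
      where
      open ≤-Reasoning
      M = μ k ⊔ ρ k
      m = μ k ⊓ ρ k
      I = inflow k
      rearrange₁ : ∀ s M I n v d → s + (M + I) + (n + v) + d ≡ (s + n + I) + (M + (d + v))
      rearrange₁ = solve-∀
      rearrange₂ : ∀ a b x c d → (a + b + x) + (c + d) ≡ a + c + (b + d) + x
      rearrange₂ = solve-∀

  -- G i t is the shape of the rectangle formed by the first i rows and the last t columns.
  module RSK (X : Filling) where

    G : ℕ → ℕ → Shape
    G zero    t       = λ _ → 0
    G (suc i) zero    = λ _ → 0
    G (suc i) (suc t) = RSKRule.shape (G i t) (G i (suc t)) (G (suc i) t) (X i t)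

    inflow : ℕ → ℕ → Shape
    inflow i t = RSKRule.inflow (G i t) (G i (suc t)) (G (suc i) t) (X i t)

    G-zeroʳ : ∀ i l → G i 0 l ≡ 0
    G-zeroʳ zero    l = refl
    G-zeroʳ (suc i) l = refl

    mutual
      hstrip-col : ∀ i t → HStrip (G i t) (G i (suc t))
      hstrip-col zero    t = hstrip-zero (λ _ → refl) (λ _ → refl)
      hstrip-col (suc i) t = rsk-hstripʳ (hstrip-col i t) (hstrip-row i t)

      hstrip-row : ∀ i t → HStrip (G i t) (G (suc i) t)
      hstrip-row i zero    = hstrip-zero (G-zeroʳ i) (G-zeroʳ (suc i))
      hstrip-row i (suc t) = rsk-hstripˡ (hstrip-col i t) (hstrip-row i t)

    decreasing : ∀ i t l → G i t (suc l) ≤ G i t l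
    decreasing i zero    l = ≤-reflexive (trans (G-zeroʳ i (suc l)) (sym (G-zeroʳ i l)))
    decreasing i (suc t) l = ≤-trans (interlace (hstrip-col i t) l) (⊆ₛ (hstrip-col i t) l)

    mono-row : ∀ i p t l → G i t l ≤ G (i + p) t l
    mono-row i zero    t l rewrite +-identityʳ i = ≤-refl
    mono-row i (suc p) t l rewrite +-suc i p =
      ≤-trans (mono-row i p t l) (⊆ₛ (hstrip-row (i + p) t) l)

    mono-col : ∀ i t q l → G i t l ≤ G i (t + q) l
    mono-col i t zero    l rewrite +-identityʳ t = ≤-refl
    mono-col i t (suc q) l rewrite +-suc t q =
      ≤-trans (mono-col i t q l) (⊆ₛ (hstrip-col i (t + q)) l)

    mono-row′ : ∀ {i i′} t l → i ≤ i′ → G i t l ≤ G i′ t l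
    mono-row′ {i} t l i≤i′ with m≤n⇒∃[o]m+o≡n i≤i′
    ... | p , refl = mono-row i p t l

    mono-col′ : ∀ i {t t′} l → t ≤ t′ → G i t l ≤ G i t′ l
    mono-col′ i {t} l t≤t′ with m≤n⇒∃[o]m+o≡n t≤t′
    ... | q , refl = mono-col i t q l

    -- Without inflow the value at the far corner of a rectangle would be the maximum of its
    -- values at the two neighbouring corners.
    find-inflow : ∀ l i t p q → G i (t + q) l < G (i + p) (t + q) l →
      G (i + p) t l < G (i + p) (t + q) l →
                  ∃₂ λ a b → i ≤ a × a < i + p × t ≤ b × b < t + q × 0 < inflow a b l
    find-inflow l i t zero    q lt₁ lt₂ rewrite +-identityʳ i = contradiction lt₁ (<-irrefl refl)
    find-inflow l i t (suc p) zero lt₁ lt₂ rewrite +-identityʳ t = contradiction lt₂ (<-irrefl refl)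
    find-inflow l i t (suc p) (suc q) lt₁ lt₂ rewrite +-suc i p | +-suc t q
      with inflow (i + p) (t + q) l in eq
    ... | suc x =
      i + p , t + q , m≤m+n i p , ≤-refl , m≤m+n t q , ≤-refl , subst (0 <_) (sym eq) z<s
    ... | zero with ⊔-sel (G (i + p) (suc (t + q)) l) (G (suc (i + p)) (t + q) l)
    ...   | inj₁ sel =
            let (a , b , i≤a , a< , t≤b , b< , pos) = find-inflow l i t p (suc q)
                  (subst₂ _<_ (cong (λ z → G i z l) (sym (+-suc t q)))
                    (trans up (cong (λ z → G (i + p) z l) (sym (+-suc t q)))) lt₁)
                  (≤-<-trans (⊆ₛ (hstrip-row (i + p) t) l)
                    (subst (_ <_) (trans up (cong (λ z → G (i + p) z l) (sym (+-suc t q)))) lt₂))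
            in a , b , i≤a , m<n⇒m<1+n a< , t≤b , subst (b <_) (+-suc t q) b< , pos
      where
      up : (G (i + p) (suc (t + q)) l ⊔ G (suc (i + p)) (t + q) l) + 0 ≡ G (i + p) (suc (t + q)) l
      up = trans (+-identityʳ _) sel
    ...   | inj₂ sel =
            let (a , b , i≤a , a< , t≤b , b< , pos) = find-inflow l i t (suc p) q
                  (≤-<-trans (⊆ₛ (hstrip-col i (t + q)) l)
                    (subst (_ <_) (trans up (cong (λ z → G z (t + q) l) (sym (+-suc i p)))) lt₁))
                  (subst₂ _<_ (cong (λ z → G z t l) (sym (+-suc i p)))
                    (trans up (cong (λ z → G z (t + q) l) (sym (+-suc i p)))) lt₂)
            in a , b , i≤a , subst (a <_) (+-suc i p) a< , t≤b , m<n⇒m<1+n b< , pos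
      where
      up : (G (i + p) (suc (t + q)) l ⊔ G (suc (i + p)) (t + q) l) + 0 ≡ G (suc (i + p)) (t + q) l
      up = trans (+-identityʳ _) sel

    find-inflow′ : ∀ l {i i′ t t′} → i ≤ i′ → t ≤ t′ → G i t′ l < G i′ t′ l → G i′ t l < G i′ t′ l →
                   ∃₂ λ a b → i ≤ a × a < i′ × t ≤ b × b < t′ × 0 < inflow a b l
    find-inflow′ l {i} {t = t} i≤i′ t≤t′ with m≤n⇒∃[o]m+o≡n i≤i′ | m≤n⇒∃[o]m+o≡n t≤t′
    ... | p , refl | q , refl = find-inflow l i t p q

    Cell : Set
    Cell = ℕ × ℕ

    -- Columns are counted from the right, so along a chain both endpoints of the associated edges
    -- increase.
    _⋖_ : Cell → Cell → Set
    (a , t) ⋖ (a′ , t′) = a < a′ × t′ < t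

    -- The bounds `α` and `τ` confine the chain to a rectangle. When the rectangle fits into the
    -- staircase, every lower endpoint precedes every upper one, so the edges of the chain cross
    -- pairwise.
    Chain : (l : ℕ) (α τ : ℕ) (r : ℕ) → Set
    Chain l α τ r = ∃ λ (zs : List Cell) → length zs ≡ r × AllPairs _⋖_ zs ×
                    All (λ (a , t) → 0 < inflow a t l × a ≤ α × t ≤ τ) zs

    private
      growth : ∀ l a t → 0 < inflow a t (suc l) →
               G a t l < G a (suc t) l × G a t l < G (suc a) t l
      growth l a t pos = m<n⊓o⇒m<n _ _ lt , m<n⊓o⇒m<o _ _ lt
        where
        lt : G a t l < G a (suc t) l ⊓ G (suc a) t l
        lt = m∸n≢0⇒n<m (λ eq → <-irrefl (sym eq) pos)

      -- Consecutive cells of a chain with inflow into row l + 1 are separated by inflow into row l.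
      refine : ∀ l {α τ} a t zs → AllPairs _⋖_ ((a , t) ∷ zs) →
               All (λ (a , t) → 0 < inflow a t (suc l) × a ≤ α × t ≤ τ) ((a , t) ∷ zs) →
               ∃ λ ws → length ws ≡ suc (length zs) × AllPairs _⋖_ ws ×
                        All (λ (a , t) → 0 < inflow a t l × a ≤ α × t ≤ τ) ws × All
                          (λ (a′ , t′) → a ≤ a′ × t′ < t) ws
      refine l a t [] _ ((pos , a≤α , t≤τ) ∷ []) with growth l a t pos
      ... | _ , gr with find-inflow′ l (n≤1+n a) z≤n gr
        (subst (_< G (suc a) t l) (sym (G-zeroʳ (suc a) l)) (≤-<-trans z≤n gr))
      ...   | a′ , t′ , a≤a′ , a′<1+a , _ , t′<t , pos′ =
              ((a′ , t′) ∷ []) , refl , ([] ∷ []) ,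
              ((pos′ , ≤-trans (≤-pred a′<1+a) a≤α , ≤-trans (<⇒≤ t′<t) t≤τ) ∷ []) ,
                ((a≤a′ , t′<t) ∷ [])
      refine l {α} {τ} a t ((b , s) ∷ zs) (((a<b , s<t) ∷ _) ∷ rest)
        ((pos , a≤α , t≤τ) ∷ ps@((posb , b≤α , s≤τ) ∷ _))
        with growth l a t pos | growth l b s posb
      ... | _ , gr | grb , _
        with find-inflow′ l (<⇒≤ a<b) (<⇒≤ s<t) (<-≤-trans gr (mono-row′ t l a<b))
          (<-≤-trans grb (mono-col′ b l s<t))
           | refine l b s zs rest ps
      ... | a′ , t′ , a≤a′ , a′<b , s≤t′ , t′<t , pos′ | ws , len , pairs , good , bounds =
            (a′ , t′) ∷ ws , cong suc len ,
            All.map (λ (b≤ , <s) → <-≤-trans a′<b b≤ , <-≤-trans <s s≤t′) bounds ∷ pairs ,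
            (pos′ , ≤-trans (<⇒≤ a′<b) b≤α , ≤-trans (<⇒≤ t′<t) t≤τ) ∷ good ,
            (a≤a′ , t′<t) ∷ All.map (λ (b≤ , <s) → ≤-trans (<⇒≤ a<b) b≤ , <-trans <s s<t) bounds

    -- Besides the cells that separate consecutive members there is one before the first member and
    -- one after the last, so the chain gains a cell with every row it climbs. Continued up to row
    -- 0, where the inflow is the filling itself, this is the half of Schensted's theorem that
    -- bounds the number of rows.
    chain-up : ∀ l {α τ r} → Chain (suc l) α τ (suc r) → Chain l α τ (suc (suc r))
    chain-up l (((a , t) ∷ zs) , refl , pairs , good@((pos , a≤α , t≤τ) ∷ _)) with growth l a t pos
    ... | gr , _ with find-inflow′ l z≤n (n≤1+n t) (≤-<-trans z≤n gr) gr | refine l a t zs pairs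
      good
    ...   | a′ , t′ , _ , a′<a , t≤t′ , t′<1+t , pos′ | ws , len , pairs′ , good′ , bounds =
            (a′ , t′) ∷ ws , cong suc len ,
            All.map (λ (a≤ , <t) → <-≤-trans a′<a a≤ , <-≤-trans <t t≤t′) bounds ∷ pairs′ ,
            (pos′ , ≤-trans (<⇒≤ a′<a) a≤α , ≤-trans (≤-pred t′<1+t) t≤τ) ∷ good′

    inflow⇒chain : ∀ l {α τ r} → Chain l α τ (suc r) → Chain 0 α τ (suc (l + r))
    inflow⇒chain zero    c = c
    inflow⇒chain (suc l) {α} {τ} {r} c =
      subst (Chain 0 α τ ∘ suc) (+-suc l r) (inflow⇒chain l (chain-up l c))

    module _ {k n : ℕ} (no-chain : ∀ {α τ} → suc (suc (α + τ)) ≤ n → ¬ Chain 0 α τ (suc k)) where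

      inflow-k : ∀ i t → suc (suc (i + t)) ≤ n → inflow i t k ≡ 0
      inflow-k i t le with inflow i t k in eq
      ... | zero  = refl
      ... | suc x =
        -- A single cell with inflow into row `k` already produces `k + 1` cells for row 0.
        ⊥-elim $ no-chain le $ subst (Chain 0 i t ∘ suc) (+-identityʳ k) $ inflow⇒chain k
                      (((i , t) ∷ []) , refl , ([] ∷ []) ,
                        ((subst (0 <_) (sym eq) z<s , ≤-refl , ≤-refl) ∷ []))

      row-k : ∀ i t → i + t ≤ n → G i t k ≡ 0
      row-k zero    t       le = refl
      row-k (suc i) zero    le = refl
      row-k (suc i) (suc t) le
        rewrite row-k i (suc t) (≤-trans (n≤1+n _) le)
              | row-k (suc i) t (≤-trans (≤-reflexive (sym (+-suc i t))) (≤-trans (n≤1+n _) le))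
              = inflow-k i t (subst (_≤ n) (cong suc (+-suc i t)) le)

      rows-k : ∀ l i t → i + t ≤ n → k ≤ l → G i t l ≡ 0
      rows-k l i t le k≤l with m≤n⇒∃[o]m+o≡n k≤l
      ... | p , refl = go p
        where
        go : ∀ p → G i t (k + p) ≡ 0
        go zero    rewrite +-identityʳ k = row-k i t le
        go (suc p) rewrite +-suc k p =
          n≤0⇒n≡0 (≤-trans (decreasing i t (k + p)) (≤-reflexive (go p)))

  -- Burge's local rule, read from the corner λ towards the corner ν.
  module BurgeRule (μ ρ κ : Shape) where

    low high gain : Shape
    low  l = μ l ⊓ ρ l
    high l = μ l ⊔ ρ l
    gain l = κ l ∸ high l

    mutual
      -- The carry travels down the rows and collects the gains; each row `l` absorbs as much of it
      -- as the interlacing with row `l + 1` of `κ` permits. What is left over after `k` rows is the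
      -- entry of the cell.
      carry : Shape
      carry zero    = gain 0
      carry (suc l) = carry l ∸ loss l + gain (suc l)

      loss : Shape
      loss l = carry l ⊓ (low l ∸ κ (suc l))

    shape : Shape
    shape l = low l ∸ loss l

  module _ {μ ρ κ : Shape} (μκ : HStrip μ κ) (ρκ : HStrip ρ κ) where
    open BurgeRule μ ρ κ

    private
      high≤κ : ∀ l → high l ≤ κ l
      high≤κ l = ⊔-lub (⊆ₛ μκ l) (⊆ₛ ρκ l)

      κ≤low : ∀ l → κ (suc l) ≤ low l
      κ≤low l = ⊓-glb (interlace μκ l) (interlace ρκ l)

      loss≤carry : ∀ l → loss l ≤ carry l
      loss≤carry l = m⊓n≤m _ _

      loss≤gap : ∀ l → loss l ≤ low l ∸ κ (suc l)
      loss≤gap l = m⊓n≤n (carry l) _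

      loss≤low : ∀ l → loss l ≤ low l
      loss≤low l = ≤-trans (loss≤gap l) (m∸n≤m (low l) (κ (suc l)))

      high+gain : ∀ l → high l + gain l ≡ κ l
      high+gain l = m+[n∸m]≡n (high≤κ l)

      shape+loss : ∀ l → shape l + loss l ≡ low l
      shape+loss l = m∸n+n≡m (loss≤low l)

      κ≤shape : ∀ l → κ (suc l) ≤ shape l
      κ≤shape l = begin
        κ (suc l)                       ≡⟨ m∸[m∸n]≡n (κ≤low l) ⟨
        low l ∸ (low l ∸ κ (suc l))     ≤⟨ ∸-monoʳ-≤ (low l) (loss≤gap l) ⟩
        low l ∸ loss l                  ∎
        where open ≤-Reasoning

    burge-hstripˡ : HStrip shape μ
    burge-hstripˡ .⊆ₛ l = ≤-trans (m∸n≤m (low l) (loss l)) (m⊓n≤m (μ l) (ρ l))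
    burge-hstripˡ .interlace l = ≤-trans (⊆ₛ μκ (suc l)) (κ≤shape l)

    burge-hstripʳ : HStrip shape ρ
    burge-hstripʳ .⊆ₛ l = ≤-trans (m∸n≤m (low l) (loss l)) (m⊓n≤n (μ l) (ρ l))
    burge-hstripʳ .interlace l = ≤-trans (⊆ₛ ρκ (suc l)) (κ≤shape l)

    carry-balance : ∀ l → carry (suc l) + loss l ≡ carry l + gain (suc l)
    carry-balance l = begin-equality
      carry l ∸ loss l + gain (suc l) + loss l   ≡⟨ +-assoc (carry l ∸ loss l) _ _ ⟩
      carry l ∸ loss l + (gain (suc l) + loss l)
        ≡⟨ cong (carry l ∸ loss l +_) (+-comm (gain (suc l)) _) ⟩
      carry l ∸ loss l + (loss l + gain (suc l)) ≡⟨ +-assoc (carry l ∸ loss l) _ _ ⟨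
      carry l ∸ loss l + loss l + gain (suc l)
        ≡⟨ cong (_+ gain (suc l)) (m∸n+n≡m (loss≤carry l)) ⟩
      carry l + gain (suc l)                     ∎
      where open ≤-Reasoning

    -- The mirror image of `loss`, which inverts the rule: read upwards, row `l + 1` takes as much
    -- of the carry as fits below row `l` of the shape. If row `l` used up its carry, all of
    -- `carry (suc l)` is gain; otherwise row `l` of the shape was cut down to `κ (suc l)`, and the
    -- gain fills the gap.
    gain-formula : ∀ l → gain (suc l) ≡ carry (suc l) ⊓ (shape l ∸ high (suc l))
    gain-formula l with ≤-total (carry l) (low l ∸ κ (suc l))
    ... | inj₁ c≤ =
      sym (trans (cong (_⊓ (shape l ∸ high (suc l))) carry≡)
        (m≤n⇒m⊓n≡m (∸-monoˡ-≤ (high (suc l)) (κ≤shape l))))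
      where
      carry≡ : carry (suc l) ≡ gain (suc l)
      carry≡ = cong (_+ gain (suc l)) (m≤n⇒m∸n≡0 (≤-reflexive (sym (m≤n⇒m⊓n≡m c≤))))
    ... | inj₂ ≤c =
      sym (trans (cong (λ z → carry (suc l) ⊓ (z ∸ high (suc l))) shape≡)
        (m≥n⇒m⊓n≡n (m≤n+m (gain (suc l)) _)))
      where
      shape≡ : shape l ≡ κ (suc l)
      shape≡ = trans (cong (low l ∸_) (m≥n⇒m⊓n≡n ≤c)) (m∸[m∸n]≡n (κ≤low l))

    -- Row `k` of `κ` is counted although row `k` of the shape is still undetermined, which leaves
    -- `high k` on the right. For at most `k` rows both extra terms vanish and the carry remains as
    -- the entry.
    burge-size : ∀ k → size (suc k) κ + size k shape ≡ size k μ + size k ρ + high k + carry k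
    burge-size zero    = begin-equality
      κ 0 + 0             ≡⟨ +-identityʳ _ ⟩
      κ 0                 ≡⟨ high+gain 0 ⟨
      high 0 + gain 0     ∎
      where open ≤-Reasoning
    burge-size (suc k) = +-cancelʳ-≡ (loss k) _ _ (begin-equality
      size (suc k) κ + κ (suc k) + (size k shape + shape k) + loss k
        ≡⟨ rearrange₁ (size (suc k) κ) (κ (suc k)) (size k shape) (shape k) (loss k) ⟩
      (size (suc k) κ + size k shape) + (κ (suc k) + (shape k + loss k))
        ≡⟨ cong₂ _+_ (burge-size k) (cong₂ _+_ (sym (high+gain (suc k))) (shape+loss k)) ⟩
      (size k μ + size k ρ + high k + carry k) + ((high (suc k) + gain (suc k)) + low k)
        ≡⟨ rearrange₂ (size k μ) (size k ρ) (high k) (carry k) (high (suc k)) (gain (suc k)) (low k)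
          ⟩
      size k μ + size k ρ + (high k + low k) + high (suc k) + (carry k + gain (suc k))
        ≡⟨ cong₂ (λ x y → size k μ + size k ρ + x + high (suc k) + y) (m⊔n+m⊓n≡m+n (μ k) (ρ k))
          (sym (carry-balance k)) ⟩
      size k μ + size k ρ + (μ k + ρ k) + high (suc k) + (carry (suc k) + loss k)
        ≡⟨ rearrange₃ (size k μ) (size k ρ) (μ k) (ρ k) (high (suc k)) (carry (suc k)) (loss k) ⟩
      size k μ + μ k + (size k ρ + ρ k) + high (suc k) + carry (suc k) + loss k ∎)
      where
      open ≤-Reasoning
      rearrange₁ : ∀ a b c d e → a + b + (c + d) + e ≡ (a + c) + (b + (d + e))
      rearrange₁ = solve-∀
      rearrange₂ : ∀ a b c d e f g → (a + b + c + d) + ((e + f) + g) ≡ a + b + (c + g) + e + (d + f)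
      rearrange₂ = solve-∀
      rearrange₃ : ∀ a b c d e f g → a + b + (c + d) + e + (f + g) ≡ a + c + (b + d) + e + f + g
      rearrange₃ = solve-∀

    module _ {k} (rows≤k : ∀ l → k ≤ l → κ l ≡ 0) where

      private
        high-k : ∀ l → k ≤ l → high l ≡ 0
        high-k l k≤l = n≤0⇒n≡0 (subst (high l ≤_) (rows≤k l k≤l) (high≤κ l))

      burge-size′ : size k κ + size k shape ≡ size k μ + size k ρ + carry k
      burge-size′ = begin-equality
        size k κ + size k shape
          ≡⟨ cong (_+ size k shape) (sym (trans (cong (size k κ +_) (rows≤k k ≤-refl))
            (+-identityʳ _))) ⟩
        size k κ + κ k + size k shape                  ≡⟨ burge-size k ⟩
        size k μ + size k ρ + high k + carry k
          ≡⟨ cong (λ z → size k μ + size k ρ + z + carry k) (high-k k ≤-refl) ⟩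
        size k μ + size k ρ + 0 + carry k              ≡⟨ cong (_+ carry k) (+-identityʳ _) ⟩
        size k μ + size k ρ + carry k                  ∎
        where open ≤-Reasoning

      carry-const : ∀ r p → κ (suc r) ≡ 0 → (∀ l → suc r ≤ l → κ l ≡ 0) → carry (suc r + p) ≡
        carry (suc r)
      carry-const r zero    _ _ = cong carry (+-identityʳ (suc r))
      carry-const r (suc p) z zs = begin-equality
        carry (suc r + suc p)                             ≡⟨ cong carry (+-suc (suc r) p) ⟩
        carry (suc r + p) ∸ loss (suc r + p) + gain (suc (suc r + p))
          ≡⟨ cong₂ (λ x y → carry (suc r + p) ∸ x + (y ∸ high (suc (suc r + p)))) loss≡0
            (zs (suc (suc r + p)) (m≤n⇒m≤1+n (m≤m+n (suc r) p))) ⟩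
        carry (suc r + p) + (0 ∸ high (suc (suc r + p)))
          ≡⟨ cong (carry (suc r + p) +_) (0∸n≡0 (high (suc (suc r + p)))) ⟩
        carry (suc r + p) + 0                             ≡⟨ +-identityʳ _ ⟩
        carry (suc r + p)                                 ≡⟨ carry-const r p z zs ⟩
        carry (suc r)                                     ∎
        where
        open ≤-Reasoning
        low≡0 : low (suc r + p) ≡ 0
        low≡0 = n≤0⇒n≡0 (≤-trans (m⊓n≤m⊔n (μ (suc r + p)) (ρ (suc r + p)))
                  (subst (high (suc r + p) ≤_) (zs (suc r + p) (m≤m+n (suc r) p))
                    (high≤κ (suc r + p))))
        loss≡0 : loss (suc r + p) ≡ 0
        loss≡0 = n≤0⇒n≡0 (subst (loss (suc r + p) ≤_) low≡0 (loss≤low (suc r + p)))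

      -- If `κ (suc r)` were zero, only `low r` would limit the loss in row `r`, and a carry that
      -- survives to the end would have erased this row of the shape. Together with `carry-top`: a
      -- positive entry makes `κ` longer than the shape by at least one row.
      carry-row : 0 < carry k → ∀ r → 0 < shape r → 0 < κ (suc r)
      carry-row pos r νr = n≢0⇒n>0 absurd
        where
        absurd : κ (suc r) ≢ 0
        absurd eq = <-irrefl (sym shape≡0) νr
          where
          decr : ∀ l → κ (suc l) ≤ κ l
          decr l = ≤-trans (interlace μκ l) (⊆ₛ μκ l)
          zeros : ∀ p → κ (suc r + p) ≡ 0
          zeros zero    = trans (cong κ (+-identityʳ (suc r))) eq
          zeros (suc p) =
            trans (cong κ (+-suc (suc r) p))
              (n≤0⇒n≡0 (≤-trans (decr (suc r + p)) (≤-reflexive (zeros p))))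
          zeros′ : ∀ l → suc r ≤ l → κ l ≡ 0
          zeros′ l r<l with m≤n⇒∃[o]m+o≡n r<l
          ... | p , refl = zeros p
          r<k : suc r ≤ k
          r<k = ≰⇒> λ k≤r → <-irrefl refl (<-≤-trans νr (begin
            shape r          ≤⟨ m∸n≤m (low r) (loss r) ⟩
            low r            ≤⟨ m⊓n≤m⊔n (μ r) (ρ r) ⟩
            high r           ≡⟨ high-k r k≤r ⟩
            0                ∎))
            where open ≤-Reasoning
          carry-pos : 0 < carry r ∸ loss r
          carry-pos with m≤n⇒∃[o]m+o≡n r<k
          ... | p , refl = subst (0 <_) (begin-equality
            carry (suc r + p)                         ≡⟨ carry-const r p eq zeros′ ⟩
            carry r ∸ loss r + (κ (suc r) ∸ high (suc r))
              ≡⟨ cong (λ z → carry r ∸ loss r + (z ∸ high (suc r))) eq ⟩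
            carry r ∸ loss r + (0 ∸ high (suc r))
              ≡⟨ cong (carry r ∸ loss r +_) (0∸n≡0 (high (suc r))) ⟩
            carry r ∸ loss r + 0                      ≡⟨ +-identityʳ _ ⟩
            carry r ∸ loss r                          ∎) pos
            where open ≤-Reasoning
          shape≡0 : shape r ≡ 0
          shape≡0 with ⊓-sel (carry r) (low r ∸ κ (suc r))
          ... | inj₁ sel =
            ⊥-elim (<-irrefl (sym (trans (cong (carry r ∸_) sel) (n∸n≡0 (carry r)))) carry-pos)
          ... | inj₂ sel = trans (cong (low r ∸_) (trans sel (cong (low r ∸_) eq))) (n∸n≡0 (low r))

      carry-top : 0 < carry k → 0 < κ 0
      carry-top pos = n≢0⇒n>0 absurd
        where
        absurd : κ 0 ≢ 0
        absurd eq = <-irrefl (sym (carry≡0 k)) pos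
          where
          zeros : ∀ p → κ p ≡ 0
          zeros zero    = eq
          zeros (suc p) =
            n≤0⇒n≡0 (≤-trans (≤-trans (interlace μκ p) (⊆ₛ μκ p)) (≤-reflexive (zeros p)))
          gain≡0 : ∀ l → gain l ≡ 0
          gain≡0 l = trans (cong (_∸ high l) (zeros l)) (0∸n≡0 (high l))
          carry≡0 : ∀ p → carry p ≡ 0
          carry≡0 zero    = gain≡0 0
          carry≡0 (suc p) =
            cong₂ _+_ (trans (cong (_∸ loss p) (carry≡0 p)) (0∸n≡0 (loss p))) (gain≡0 (suc p))

  module _ {μ ρ κ κ′ : Shape} (μκ : HStrip μ κ) (ρκ : HStrip ρ κ) (μκ′ : HStrip μ κ′)
    (ρκ′ : HStrip ρ κ′)
           {k} (rows≤k : ∀ l → k ≤ l → κ l ≡ 0) (rows≤k′ : ∀ l → k ≤ l → κ′ l ≡ 0) where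

    private
      module B  = BurgeRule μ ρ κ
      module B′ = BurgeRule μ ρ κ′

      high+gain : ∀ l → B.high l + B.gain l ≡ κ l
      high+gain l = m+[n∸m]≡n (⊔-lub (⊆ₛ μκ l) (⊆ₛ ρκ l))
      high+gain′ : ∀ l → B′.high l + B′.gain l ≡ κ′ l
      high+gain′ l = m+[n∸m]≡n (⊔-lub (⊆ₛ μκ′ l) (⊆ₛ ρκ′ l))

      loss≡ : ∀ l → B.low l ∸ B.shape l ≡ B.loss l
      loss≡ l = m∸[m∸n]≡n (≤-trans (m⊓n≤n (B.carry l) _) (m∸n≤m (B.low l) (κ (suc l))))
      loss≡′ : ∀ l → B′.low l ∸ B′.shape l ≡ B′.loss l
      loss≡′ l = m∸[m∸n]≡n (≤-trans (m⊓n≤n (B′.carry l) _) (m∸n≤m (B′.low l) (κ′ (suc l))))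

    module _ (shape≡ : ∀ l → B.shape l ≡ B′.shape l) where

      private
        gain≡ : ∀ j → B.carry (suc j) ≡ B′.carry (suc j) → B.gain (suc j) ≡ B′.gain (suc j)
        gain≡ j c≡ =
          trans (gain-formula μκ ρκ j) (trans
            (cong₂ (λ c s → c ⊓ (s ∸ B.high (suc j))) c≡ (shape≡ j))
                      (sym (gain-formula μκ′ ρκ′ j)))

        loss-eq : ∀ j → B.loss j ≡ B′.loss j
        loss-eq j = trans (sym (loss≡ j)) (trans (cong (B.low j ∸_) (shape≡ j)) (loss≡′ j))

      -- Works upwards: the carry at `j + 1` and the common shape determine the gain there, and the
      -- balance of carries then determines the carry at `j`.
      burge-injective : ∀ j → B.carry j ≡ B′.carry j → ∀ l → l ≤ j → κ l ≡ κ′ l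
      burge-injective zero    c≡ .zero z≤n =
        trans (sym (high+gain 0)) (trans (cong (B.high 0 +_) c≡) (high+gain′ 0))
      burge-injective (suc j) c≡ l l≤1+j with m≤n⇒m<n∨m≡n l≤1+j
      ... | inj₂ refl =
        trans (sym (high+gain l)) (trans (cong (B.high l +_) (gain≡ j c≡)) (high+gain′ l))
      ... | inj₁ l<1+j = burge-injective j c≡′ l (≤-pred l<1+j)
        where
        c≡′ : B.carry j ≡ B′.carry j
        c≡′ = +-cancelʳ-≡ (B.gain (suc j)) _ _ (begin-equality
          B.carry j + B.gain (suc j)        ≡⟨ carry-balance μκ ρκ j ⟨
          B.carry (suc j) + B.loss j        ≡⟨ cong₂ _+_ c≡ (loss-eq j) ⟩
          B′.carry (suc j) + B′.loss j      ≡⟨ carry-balance μκ′ ρκ′ j ⟩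
          B′.carry j + B′.gain (suc j)      ≡⟨ cong (B′.carry j +_) (gain≡ j c≡) ⟨
          B′.carry j + B.gain (suc j)       ∎)
          where open ≤-Reasoning

      burge-injective′ : B.carry k ≡ B′.carry k → ∀ l → κ l ≡ κ′ l
      burge-injective′ c≡ l with ≤-total l k
      ... | inj₁ l≤k = burge-injective k c≡ l l≤k
      ... | inj₂ k≤l = trans (rows≤k l k≤l) (sym (rows≤k′ l k≤l))

  -- Row sums, boundaries and injectivity of the two growth diagrams.

  ∑< : ℕ → (ℕ → ℕ) → ℕ
  ∑< zero    f = 0
  ∑< (suc m) f = ∑< m f + f m

  ∑<-cong : ∀ m {f g : ℕ → ℕ} → (∀ {i} → i < m → f i ≡ g i) → ∑< m f ≡ ∑< m g
  ∑<-cong zero    eq = refl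
  ∑<-cong (suc m) eq = cong₂ _+_ (∑<-cong m (eq ∘ m<n⇒m<1+n)) (eq ≤-refl)

  ∑<-suc : ∀ m f → ∑< (suc m) f ≡ f 0 + ∑< m (f ∘ suc)
  ∑<-suc zero    f = +-comm 0 (f 0)
  ∑<-suc (suc m) f = trans (cong (_+ f (suc m)) (∑<-suc m f)) (+-assoc (f 0) _ _)

  ∑<-reverse : ∀ m f → ∑< m (λ i → f (m ∸ suc i)) ≡ ∑< m f
  ∑<-reverse zero    f = refl
  ∑<-reverse (suc m) f = begin-equality
    ∑< (suc m) (λ i → f (m ∸ i))     ≡⟨ ∑<-suc m (λ i → f (m ∸ i)) ⟩
    f m + ∑< m (λ i → f (m ∸ suc i)) ≡⟨ cong (f m +_) (∑<-reverse m f) ⟩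
    f m + ∑< m f                     ≡⟨ +-comm (f m) _ ⟩
    ∑< m f + f m                     ∎
    where open ≤-Reasoning

  module _ (X : Filling) {k n : ℕ} (no-chain : ∀ {α τ} → suc (suc (α + τ)) ≤ n → ¬ RSK.Chain X 0 α τ (suc k)) where
    open RSK X

    rsk-row-sum : ∀ i t → suc (i + t) ≤ n → size k (G (suc i) t) ≡ size k (G i t) + ∑< t (X i)
    rsk-row-sum i zero    le =
      trans (size-zero k (λ _ → refl)) (sym (cong (_+ 0) (size-zero k (G-zeroʳ i))))
    rsk-row-sum i (suc t) le = +-cancelʳ-≡ (size k (G i t)) _ _ (begin-equality
      S + size k (G i t)                                    ≡⟨ +-identityʳ _ ⟨
      S + size k (G i t) + 0
        ≡⟨ cong (S + size k (G i t) +_) (inflow-k no-chain i t le′) ⟨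
      S + size k (G i t) + inflow i t k
        ≡⟨ rsk-size (hstrip-col i t) (hstrip-row i t) k ⟩
      size k (G i (suc t)) + size k (G (suc i) t) + X i t
        ≡⟨ cong (λ z → size k (G i (suc t)) + z + X i t) (rsk-row-sum i t (≤-trans (n≤1+n _) le′)) ⟩
      size k (G i (suc t)) + (size k (G i t) + ∑< t (X i)) + X i t
        ≡⟨ rearrange (size k (G i (suc t))) (size k (G i t)) (∑< t (X i)) (X i t) ⟩
      size k (G i (suc t)) + (∑< t (X i) + X i t) + size k (G i t) ∎)
      where
      open ≤-Reasoning
      S = size k (G (suc i) (suc t))
      le′ : suc (suc (i + t)) ≤ n
      le′ = subst (_≤ n) (cong suc (+-suc i t)) le
      rearrange : ∀ a b c d → a + (b + c) + d ≡ a + (c + d) + b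
      rearrange = solve-∀

  module _ (X X′ : Filling) (n : ℕ) where
    private
      module R  = RSK X
      module R′ = RSK X′

      Agree : ℕ → Set
      Agree d = ∀ i t → d + (i + t) ≡ n → ∀ l → R.G i t l ≡ R′.G i t l

      agree-step : ∀ d → Agree d → Agree (suc d) → Agree (suc (suc d))
      agree-step d agree agree₁ i t eq l =
        +-cancelˡ-≡ (R.G (suc i) (suc t) (suc l)) _ _ (begin-equality
        R.G (suc i) (suc t) (suc l) + R.G i t l
          ≡⟨ rsk-exchange {x = X i t} (R.hstrip-col i t) (R.hstrip-row i t) l ⟩
        (R.G i (suc t) (suc l) ⊔ R.G (suc i) t (suc l)) + (R.G i (suc t) l ⊓ R.G (suc i) t l)
          ≡⟨ cong₂ _+_ (cong₂ _⊔_ (μ≡ (suc l)) (ρ≡ (suc l))) (cong₂ _⊓_ (μ≡ l) (ρ≡ l)) ⟩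
        (R′.G i (suc t) (suc l) ⊔ R′.G (suc i) t (suc l)) + (R′.G i (suc t) l ⊓ R′.G (suc i) t l)
          ≡⟨ rsk-exchange {x = X′ i t} (R′.hstrip-col i t) (R′.hstrip-row i t) l ⟨
        R′.G (suc i) (suc t) (suc l) + R′.G i t l
          ≡⟨ cong (_+ R′.G i t l) (agree (suc i) (suc t)
            (trans (trans (cong (λ z → d + suc z) (+-suc i t))
              (trans (+-suc d _) (cong suc (+-suc d _)))) eq) (suc l)) ⟨
        R.G (suc i) (suc t) (suc l) + R′.G i t l ∎)
        where
        open ≤-Reasoning
        μ≡ : ∀ l → R.G i (suc t) l ≡ R′.G i (suc t) l
        μ≡ = agree₁ i (suc t) (trans (cong (λ z → suc d + z) (+-suc i t))
          (trans (cong suc (+-suc d _)) eq))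
        ρ≡ : ∀ l → R.G (suc i) t l ≡ R′.G (suc i) t l
        ρ≡ = agree₁ (suc i) t (trans (cong suc (+-suc d _)) eq)

    -- The exchange relation carries agreement from two neighbouring antidiagonals to the next one
    -- towards the empty corner. Once all shapes agree, the entries are read off row 0, where the
    -- inflow is the entry.
    rsk-injective : (∀ i t → i + t ≡ n → ∀ l → R.G i t l ≡ R′.G i t l) →
                    (∀ i t → suc (i + t) ≡ n → ∀ l → R.G i t l ≡ R′.G i t l) →
                    ∀ i t → suc (suc (i + t)) ≤ n → X i t ≡ X′ i t
    rsk-injective agree₀ agree₁ i t le = +-cancelˡ-≡ (R.G i (suc t) 0 ⊔ R.G (suc i) t 0) _ _
        (trans (agree′ (suc i) (suc t) (subst (_≤ n) (cong suc (sym (+-suc i t))) le) 0)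
               (cong (_+ X′ i t) (sym (cong₂ _⊔_
                 (agree′ i (suc t) (≤-trans (≤-reflexive (+-suc i t)) (≤-trans (n≤1+n _) le)) 0)
                 (agree′ (suc i) t (≤-trans (n≤1+n _) le) 0)))))
      where
      agree : ∀ d → Agree d × Agree (suc d)
      agree zero    = agree₀ , agree₁
      agree (suc d) = let (a , b) = agree d in b , agree-step d a b
      agree′ : ∀ i t → i + t ≤ n → ∀ l → R.G i t l ≡ R′.G i t l
      agree′ i t le = proj₁ (agree (n ∸ (i + t))) i t (m∸n+n≡m le)

  -- The shapes on the two outermost antidiagonals of the staircase: `bnd₀ i` belongs to row `i` and
  -- `i + t = n`, `bnd₁ i` to row `i` and `i + t = n - 1`. Positions outside the staircase are
  -- filled with empty shapes, so that no range conditions have to be carried along.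
  record Boundary (k n : ℕ) : Set where
    field
      bnd₀ bnd₁ : ℕ → Shape
      strip₀ : ∀ i → HStrip (bnd₁ i) (bnd₀ i)
      strip₁ : ∀ i → HStrip (bnd₁ i) (bnd₀ (suc i))
      first  : ∀ l → bnd₀ 0 l ≡ 0
      last₀  : ∀ i l → n ≤ i → bnd₀ i l ≡ 0
      last₁  : ∀ i l → n ≤ suc i → bnd₁ i l ≡ 0
      rows   : ∀ i l → k ≤ l → bnd₀ i l ≡ 0

  module Burge {k n} (B : Boundary k n) where
    open Boundary B

    -- `D d i` stands in row `i` on the antidiagonal `i + t = n - d`. The cell with entry
    -- `entry i d` has the corner `κ = D d (suc i)` and the corner `ν = D (suc (suc d)) i`.
    D : ℕ → ℕ → Shape
    D zero          i = bnd₀ i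
    D (suc zero)    i = bnd₁ i
    D (suc (suc d)) i = BurgeRule.shape (D (suc d) i) (D (suc d) (suc i)) (D d (suc i))

    entry : ℕ → ℕ → ℕ
    entry i d = BurgeRule.carry (D (suc d) i) (D (suc d) (suc i)) (D d (suc i)) k

    strips : ∀ d i → HStrip (D (suc d) i) (D d i) × HStrip (D (suc d) i) (D d (suc i))
    strips zero    i = strip₀ i , strip₁ i
    strips (suc d) i = burge-hstripˡ (proj₂ (strips d i)) (proj₁ (strips d (suc i))) ,
                       burge-hstripʳ (proj₂ (strips d i)) (proj₁ (strips d (suc i)))

    rows≤k : ∀ d i l → k ≤ l → D d i l ≡ 0
    rows≤k zero    i l k≤l = rows i l k≤l
    rows≤k (suc d) i l k≤l =
      n≤0⇒n≡0 (≤-trans (⊆ₛ (proj₁ (strips d i)) l) (≤-reflexive (rows≤k d i l k≤l)))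

    D-zeroˡ : ∀ d l → D d 0 l ≡ 0
    D-zeroˡ zero    l = first l
    D-zeroˡ (suc d) l = n≤0⇒n≡0 (≤-trans (⊆ₛ (proj₁ (strips d 0)) l) (≤-reflexive (D-zeroˡ d l)))

    D-zeroʳ : ∀ d i l → n ≤ d + i → D d i l ≡ 0
    D-zeroʳ zero          i l le = last₀ i l le
    D-zeroʳ (suc zero)    i l le = last₁ i l le
    D-zeroʳ (suc (suc d)) i l le = n≤0⇒n≡0 (≤-trans (⊆ₛ (proj₂ (strips (suc d) i)) l)
                                     (≤-reflexive
                                       (D-zeroʳ (suc d) (suc i) l
                                         (subst (n ≤_) (sym (+-suc (suc d) i)) le))))

    D-mono : ∀ p q d i l → D (p + q + d) i l ≤ D d (i + p) l
    D-mono zero    zero    d i l rewrite +-identityʳ i = ≤-refl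
    D-mono zero    (suc q) d i l = ≤-trans (⊆ₛ (proj₁ (strips (q + d) i)) l) (D-mono zero q d i l)
    D-mono (suc p) q       d i l rewrite +-suc i p =
      ≤-trans (⊆ₛ (proj₂ (strips (p + q + d) i)) l) (D-mono p q d (suc i) l)

    D-mono′ : ∀ {d d′ i i′} l → i ≤ i′ → d′ + i′ ≤ d + i → D d i l ≤ D d′ i′ l
    D-mono′ {d} {d′} {i} l i≤i′ le with m≤n⇒∃[o]m+o≡n i≤i′
    ... | p , refl with m≤n⇒∃[o]m+o≡n le
    ...   | q , eq =
      subst (λ z → D z i l ≤ D d′ (i + p) l) (+-cancelʳ-≡ i _ _ (trans (rearrange p q d′ i) eq))
        (D-mono p q d′ i l)
      where
      rearrange : ∀ p q d i → p + q + d + i ≡ d + (i + p) + q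
      rearrange = solve-∀

    _⊐_ : ℕ × ℕ → ℕ × ℕ → Set
    (i , d) ⊐ (i′ , d′) = i < i′ × d′ + i′ < d + i

    private
      -- Invariant: the corner `ν` of every remaining cell has at least `r` rows. The outermost cell
      -- has a positive entry, so its corner `κ` has at least `r + 1` rows, and this corner is
      -- contained in the corner `ν` of each cell nested inside. Hence nested positive entries use
      -- up rows, of which there are at most `k`.
      nesting-bound′ : ∀ r zs → r ≤ k → AllPairs _⊐_ zs → All (λ (i , d) → 0 < entry i d) zs →
                       (∀ {r′} → suc r′ ≡ r → All (λ (i , d) → 0 < D (suc (suc d)) i r′) zs) →
                         r + length zs ≤ k
      nesting-bound′ r [] r≤k _ _ _ = subst (_≤ k) (sym (+-identityʳ r)) r≤k
      nesting-bound′ r ((i , d) ∷ zs) r≤k (outer ∷ pairs) (pos ∷ poss) occupied =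
        subst (_≤ k) (sym (+-suc r (length zs)))
          (nesting-bound′ (suc r) zs r<k pairs poss λ { refl → All.map (λ {(i′ , d′)} (i<i′ , lt) →
            <-≤-trans κ>0 (D-mono′ {d} {suc (suc d′)} r i<i′
              (subst (suc (suc (d′ + i′)) ≤_) (sym (+-suc d i)) (s≤s lt)))) outer })
        where
        μκ = proj₂ (strips d i)
        ρκ = proj₁ (strips d (suc i))
        κ-pos : ∀ r → (∀ {r′} → suc r′ ≡ r →
          All (λ (i , d) → 0 < D (suc (suc d)) i r′) ((i , d) ∷ zs)) → 0 < D d (suc i) r
        κ-pos zero    _   = carry-top μκ ρκ {k} (rows≤k d (suc i)) pos
        κ-pos (suc r) occ = carry-row μκ ρκ {k} (rows≤k d (suc i)) pos r (All.head (occ refl))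
        κ>0 : 0 < D d (suc i) r
        κ>0 = κ-pos r occupied
        r<k : r < k
        r<k = ≰⇒> λ k≤r → <-irrefl (sym (rows≤k d (suc i) r k≤r)) κ>0

    nesting-bound : ∀ zs → AllPairs _⊐_ zs → All (λ (i , d) → 0 < entry i d) zs → length zs ≤ k
    nesting-bound zs pairs pos = nesting-bound′ 0 zs z≤n pairs pos λ ()

    burge-cell : ∀ d i → size k (D d (suc i)) + size k (D (suc (suc d)) i) ≡
                         size k (D (suc d) i) + size k (D (suc d) (suc i)) + entry i d
    burge-cell d i = burge-size′ (proj₂ (strips d i)) (proj₁ (strips d (suc i))) (rows≤k d (suc i))

    burge-row-sum : ∀ i T d → n ≤ T + (d + suc i) → size k (D d (suc i)) ≡
      size k (D (suc d) i) + ∑< T (λ s → entry i (d + s))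
    burge-row-sum i zero d le = trans (size-zero k (λ l → D-zeroʳ d (suc i) l le))
      (sym (trans (+-identityʳ _) (size-zero k
        (λ l → D-zeroʳ (suc d) i l (subst (n ≤_) (+-suc d i) le)))))
    burge-row-sum i (suc T) d le = +-cancelʳ-≡ (size k (D (suc (suc d)) i)) _ _ (begin-equality
      size k (D d (suc i)) + size k (D (suc (suc d)) i)                   ≡⟨ burge-cell d i ⟩
      a + size k (D (suc d) (suc i)) + entry i d
        ≡⟨ cong (λ z → a + z + entry i d)
          (burge-row-sum i T (suc d) (subst (n ≤_) (sym (+-suc T _)) le)) ⟩
      a + (b + ∑< T (λ s → entry i (suc d + s))) + entry i d              ≡⟨ rearrange a b _ _ ⟩
      a + (entry i d + ∑< T (λ s → entry i (suc d + s))) + b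
        ≡⟨ cong (λ z → a + z + b) (cong₂ _+_ (cong (entry i) (sym (+-identityʳ d)))
          (∑<-cong T (λ {s} _ → cong (entry i) (sym (+-suc d s))))) ⟩
      a + (entry i (d + 0) + ∑< T (λ s → entry i (d + suc s))) + b
        ≡⟨ cong (λ z → a + z + b) (∑<-suc T (λ s → entry i (d + s))) ⟨
      a + ∑< (suc T) (λ s → entry i (d + s)) + b                          ∎)
      where
      open ≤-Reasoning
      a = size k (D (suc d) i)
      b = size k (D (suc (suc d)) i)
      rearrange : ∀ a b c e → a + (b + c) + e ≡ a + (e + c) + b
      rearrange = solve-∀

  module _ {k n} (B B′ : Boundary k n) where
    private
      module P  = Burge B
      module P′ = Burge B′

    -- The entries rebuild the grid from empty shapes: row 0 is empty, and in row `i + 1` the corner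
    -- `κ` is recovered by injectivity of the rule for decreasing `d`, starting where
    -- `n ≤ d + suc i` forces it to be empty.
    burge-grid-injective : (∀ i d → suc (suc (d + i)) ≤ n → P.entry i d ≡ P′.entry i d) →
                           ∀ i d l → P.D d i l ≡ P′.D d i l
    burge-grid-injective same zero    d l = trans (P.D-zeroˡ d l) (sym (P′.D-zeroˡ d l))
    burge-grid-injective same (suc i) d = go (n ∸ (d + suc i)) d (m≤n+m∸n n (d + suc i))
      where
      -- Shapes agree only pointwise, so the rule has to be transported along pointwise equality.
      shape-cong : ∀ {μ μ′ ρ ρ′ : Shape} κ → (∀ l → μ l ≡ μ′ l) → (∀ l → ρ l ≡ ρ′ l) → ∀ l →
                   BurgeRule.carry μ ρ κ l ≡ BurgeRule.carry μ′ ρ′ κ l × BurgeRule.shape μ ρ κ l ≡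
                     BurgeRule.shape μ′ ρ′ κ l
      shape-cong {μ} {μ′} {ρ} {ρ′} κ μ≗ ρ≗ l =
        carry≡ l , cong₂ _∸_ (cong₂ _⊓_ (μ≗ l) (ρ≗ l)) (loss≡ l)
        where
        gain≡ : ∀ l → BurgeRule.gain μ ρ κ l ≡ BurgeRule.gain μ′ ρ′ κ l
        gain≡ l = cong (κ l ∸_) (cong₂ _⊔_ (μ≗ l) (ρ≗ l))
        mutual
          carry≡ : ∀ l → BurgeRule.carry μ ρ κ l ≡ BurgeRule.carry μ′ ρ′ κ l
          carry≡ zero    = gain≡ 0
          carry≡ (suc l) = cong₂ _+_ (cong₂ _∸_ (carry≡ l) (loss≡ l)) (gain≡ (suc l))
          loss≡ : ∀ l → BurgeRule.loss μ ρ κ l ≡ BurgeRule.loss μ′ ρ′ κ l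
          loss≡ l = cong₂ _⊓_ (carry≡ l) (cong (_∸ κ (suc l)) (cong₂ _⊓_ (μ≗ l) (ρ≗ l)))
      go : ∀ r d → n ≤ d + suc i + r → ∀ l → P.D d (suc i) l ≡ P′.D d (suc i) l
      go r d le l with n ≤? d + suc i
      ... | yes n≤ = trans (P.D-zeroʳ d (suc i) l n≤) (sym (P′.D-zeroʳ d (suc i) l n≤))
      go zero    d le l | no n≰ = contradiction (subst (n ≤_) (+-identityʳ _) le) n≰
      go (suc r) d le l | no n≰ =
        burge-injective′ (proj₂ (P.strips d i)) (proj₁ (P.strips d (suc i)))
          (hstrip-cong (sym ∘ μ≗) (λ _ → refl) (proj₂ (P′.strips d i)))
            (hstrip-cong (sym ∘ ρ≗) (λ _ → refl) (proj₁ (P′.strips d (suc i))))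
          (P.rows≤k d (suc i)) (P′.rows≤k d (suc i))
          (λ l → trans (burge-grid-injective same i (suc (suc d)) l)
            (sym (proj₂ (shape-cong (P′.D d (suc i)) μ≗ ρ≗ l))))
          (trans (same i d (subst (_≤ n) (cong suc (+-suc d i)) (≰⇒> n≰)))
            (sym (proj₁ (shape-cong (P′.D d (suc i)) μ≗ ρ≗ k)))) l
        where
        μ≗ : ∀ l → P.D (suc d) i l ≡ P′.D (suc d) i l
        μ≗ = burge-grid-injective same i (suc d)
        ρ≗ : ∀ l → P.D (suc d) (suc i) l ≡ P′.D (suc d) (suc i) l
        ρ≗ = go r (suc d) (subst (n ≤_) (+-suc (d + suc i) r) le)

  -- The entry F i d is attached to the edge {i , i + d + 1}, which lies in row i and
  -- in column n ∸ (i + d + 2) counted from the right.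
  module Transfer (k n : ℕ) where

    columns : Filling → Filling
    columns F i t = F i (n ∸ suc (suc (i + t)))

    NoChain : Filling → Set
    NoChain F = ∀ {α τ} → suc (suc (α + τ)) ≤ n → ¬ RSK.Chain (columns F) 0 α τ (suc k)

    module _ (F : Filling) (no-chain : NoChain F) where
      open RSK (columns F)

      boundary : Boundary k n
      boundary = record
        { bnd₀   = λ i → G i (n ∸ i)
        ; bnd₁   = λ i → G i (n ∸ suc i)
        ; strip₀ = strip₀
        ; strip₁ = λ i → hstrip-row i (n ∸ suc i)
        ; first  = λ l → refl
        ; last₀  = λ i l le → trans (cong (λ z → G i z l) (m≤n⇒m∸n≡0 le)) (G-zeroʳ i l)
        ; last₁  = λ i l le → trans (cong (λ z → G i z l) (m≤n⇒m∸n≡0 le)) (G-zeroʳ i l)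
        ; rows   = rows
        }
        where
        strip₀ : ∀ i → HStrip (G i (n ∸ suc i)) (G i (n ∸ i))
        strip₀ i with suc i ≤? n
        ... | yes i<n =
          subst (λ z → HStrip (G i (n ∸ suc i)) (G i z)) (sym (+-∸-assoc 1 i<n))
            (hstrip-col i (n ∸ suc i))
        ... | no  i≮n rewrite m≤n⇒m∸n≡0 (≮⇒≥ i≮n) | m≤n⇒m∸n≡0 (m≤n⇒m≤1+n (≮⇒≥ i≮n)) =
          hstrip-zero (G-zeroʳ i) (G-zeroʳ i)
        rows : ∀ i l → k ≤ l → G i (n ∸ i) l ≡ 0
        rows i l k≤l with i ≤? n
        ... | yes i≤n = rows-k no-chain l i (n ∸ i) (≤-reflexive (m+[n∸m]≡n i≤n)) k≤l
        ... | no  i≰n rewrite m≤n⇒m∸n≡0 (≰⇒≥ i≰n) = G-zeroʳ i l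

      transfer : Filling
      transfer = Burge.entry boundary

      -- Both rules give the sum over row `i` as the size of `bnd₀ (suc i)` minus the size of
      -- `bnd₁ i`.
      transfer-row-sum : ∀ i → i < n → ∑< (n ∸ suc i) (transfer i) ≡ ∑< (n ∸ suc i) (F i)
      transfer-row-sum i i<n = +-cancelˡ-≡ (size k (G i T)) _ _ (begin-equality
        size k (G i T) + ∑< T (transfer i)
          ≡⟨ Burge.burge-row-sum boundary i T 0 (≤-reflexive (sym (m∸n+n≡m i<n))) ⟨
        size k (G (suc i) T)
          ≡⟨ rsk-row-sum (columns F) no-chain i T (≤-reflexive (m+[n∸m]≡n i<n)) ⟩
        size k (G i T) + ∑< T (columns F i)
          ≡⟨ cong (size k (G i T) +_) (trans (∑<-cong T (λ {t} _ → cong (F i) (index t)))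
            (∑<-reverse T (F i))) ⟩
        size k (G i T) + ∑< T (F i)                  ∎)
        where
        open ≤-Reasoning
        T = n ∸ suc i
        index : ∀ t → n ∸ suc (suc (i + t)) ≡ T ∸ suc t
        index t = trans (cong (n ∸_) (sym (+-suc (suc i) t))) (sym (∸-+-assoc n (suc i) (suc t)))

    -- Equal results give equal Burge grids, in particular equal boundaries, and inverse RSK
    -- recovers the original filling from its boundary.
    transfer-injective : ∀ F F′ (h : NoChain F) (h′ : NoChain F′) →
                         (∀ i d → suc (suc (d + i)) ≤ n → transfer F h i d ≡ transfer F′ h′ i d) →
                         ∀ i d → suc (suc (i + d)) ≤ n → F i d ≡ F′ i d
    transfer-injective F F′ h h′ same i d le =
      subst (λ z → F i z ≡ F′ i z) index
        (rsk-injective (columns F) (columns F′) n agree₀ agree₁ i (n ∸ suc (suc (i + d))) le′)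
      where
      e = n ∸ suc (suc (i + d))
      total : suc (suc (i + e)) + d ≡ n
      total = trans (rearrange i e d) (m+[n∸m]≡n le)
        where
        rearrange : ∀ i e d → suc (suc (i + e)) + d ≡ suc (suc (i + d)) + e
        rearrange = solve-∀
      le′ : suc (suc (i + e)) ≤ n
      le′ = subst (suc (suc (i + e)) ≤_) total (m≤m+n _ d)
      index : n ∸ suc (suc (i + e)) ≡ d
      index = trans (cong (_∸ suc (suc (i + e))) (sym total)) (m+n∸m≡n (suc (suc (i + e))) d)
      grids : ∀ i d l → Burge.D (boundary F h) d i l ≡ Burge.D (boundary F′ h′) d i l
      grids = burge-grid-injective (boundary F h) (boundary F′ h′) same
      agree₀ : ∀ i t → i + t ≡ n → ∀ l → RSK.G (columns F) i t l ≡ RSK.G (columns F′) i t l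
      agree₀ i t refl l =
        subst (λ z → RSK.G (columns F) i z l ≡ RSK.G (columns F′) i z l) (m+n∸m≡n i t) (grids i 0 l)
      agree₁ : ∀ i t → suc (i + t) ≡ n → ∀ l → RSK.G (columns F) i t l ≡ RSK.G (columns F′) i t l
      agree₁ i t refl l =
        subst (λ z → RSK.G (columns F) i z l ≡ RSK.G (columns F′) i z l) (m+n∸m≡n (suc i) t)
          (grids i 1 l)

  -- Multisets of edges as fillings of the staircase.

  ∈⇒↭∷ : ∀ {a} {A : Set a} {x : A} {xs} → x ∈ xs → ∃ λ ys → xs ↭ x ∷ ys
  ∈⇒↭∷ {x = x} x∈ with ∈-∃++ x∈
  ... | ys , zs , refl = ys ++ zs , shift x ys zs

  module Multiplicity {a} {A : Set a} (_≟_ : DecidableEquality A) where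

    count : A → List A → ℕ
    count x xs = length (filter (x ≟_) xs)

    count-≡ : ∀ {x y} xs → x ≡ y → count x (y ∷ xs) ≡ suc (count x xs)
    count-≡ {x} xs eq = cong length (filter-accept (x ≟_) eq)

    count-≢ : ∀ {x y} xs → x ≢ y → count x (y ∷ xs) ≡ count x xs
    count-≢ {x} xs neq = cong length (filter-reject (x ≟_) neq)

    count-++ : ∀ x xs ys → count x (xs ++ ys) ≡ count x xs + count x ys
    count-++ x xs ys = trans (cong length (filter-++ (x ≟_) xs ys)) (length-++ (filter (x ≟_) xs))

    count-↭ : ∀ {xs ys} x → xs ↭ ys → count x xs ≡ count x ys
    count-↭ x = ↭-length ∘ filter-↭ (x ≟_)

    count-replicate : ∀ x r → count x (replicate r x) ≡ r
    count-replicate x zero    = refl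
    count-replicate x (suc r) =
      trans (count-≡ (replicate r x) refl) (cong suc (count-replicate x r))

    count-replicate-≢ : ∀ {x y} r → x ≢ y → count x (replicate r y) ≡ 0
    count-replicate-≢ zero    x≢y = refl
    count-replicate-≢ (suc r) x≢y = trans (count-≢ (replicate r _) x≢y) (count-replicate-≢ r x≢y)

    count>0⇒∈ : ∀ {x} xs → 0 < count x xs → x ∈ xs
    count>0⇒∈ {x} (y ∷ xs) pos with x ≟ y
    ... | yes x≡y = here x≡y
    ... | no  x≢y = there (count>0⇒∈ xs pos)

    ∈⇒count>0 : ∀ {x xs} → x ∈ xs → 0 < count x xs
    ∈⇒count>0 {x} {y ∷ xs} x∈ with x ≟ y
    ... | yes x≡y = z<s
    ∈⇒count>0 (here x≡y)  | no x≢y = contradiction x≡y x≢y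
    ∈⇒count>0 (there x∈)  | no x≢y = ∈⇒count>0 x∈

    count⇒↭ : ∀ xs ys → (∀ x → count x xs ≡ count x ys) → xs ↭ ys
    count⇒↭ []       []       eq = ↭-refl
    count⇒↭ []       (y ∷ ys) eq = contradiction (trans (eq y) (count-≡ ys refl)) λ ()
    count⇒↭ (x ∷ xs) ys       eq with ∈⇒↭∷ {x = x} {xs = ys}
      (count>0⇒∈ ys (subst (0 <_) (trans (sym (count-≡ xs refl)) (eq x)) z<s))
    ... | zs , ys↭ = ↭-trans (prep x (count⇒↭ xs zs eq′)) (↭-sym ys↭)
      where
      eq′ : ∀ y → count y xs ≡ count y zs
      eq′ y with y ≟ x
      ... | yes refl =
        suc-injective (trans (sym (count-≡ xs refl))
          (trans (eq y) (trans (count-↭ y ys↭) (count-≡ zs refl))))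
      ... | no  y≢x  =
        trans (sym (count-≢ xs y≢x)) (trans (eq y) (trans (count-↭ y ys↭) (count-≢ zs y≢x)))

  edge-≡ : ∀ {n} {e f : Edge n} → lo e ≡ lo f → hi e ≡ hi f → e ≡ f
  edge-≡ {e = edge p} {edge q} refl refl = cong edge (Fin.<-irrelevant p q)

  Standard : ∀ {n} → ℕ → Monomial n → Set
  Standard k m = ∀ C → IsCrossing (suc k) C → ¬ All (_∈ m) C

  Encloses : ∀ {n} → Edge n → Edge n → Set
  Encloses e f = lo e Fin.< lo f × hi f Fin.< hi e

  NestingFree : ∀ {n} → ℕ → Monomial n → Set
  NestingFree k m = ∀ C → length C ≡ suc k → AllPairs Encloses C → ¬ All (_∈ m) C

  module _ {n : ℕ} where
    open Multiplicity (_≟ₑ_ {n}) public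

    mk : ∀ i d → suc (suc (d + i)) ≤ n → Edge n
    mk i d le =
      edge {lo = fromℕ< (m+n≤o⇒n≤o (suc d) (subst (_≤ n) (cong suc (sym (+-suc d i))) le))}
        {hi = fromℕ< le}
      (subst₂ _<_ (sym (Fin.toℕ-fromℕ< _)) (sym (Fin.toℕ-fromℕ< le)) (s≤s (m≤n+m i d)))

    lo-mk : ∀ i d le → toℕ (lo (mk i d le)) ≡ i
    lo-mk i d le = Fin.toℕ-fromℕ< _

    hi-mk : ∀ i d le → toℕ (hi (mk i d le)) ≡ suc (d + i)
    hi-mk i d le = Fin.toℕ-fromℕ< le

    mk-injective : ∀ i d le i′ d′ le′ → mk i d le ≡ mk i′ d′ le′ → i ≡ i′ × d ≡ d′
    mk-injective i d le i′ d′ le′ eq = i≡ , +-cancelʳ-≡ i d d′ (suc-injective (begin-equality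
        suc (d + i)            ≡⟨ hi-mk i d le ⟨
        toℕ (hi (mk i d le))   ≡⟨ cong (toℕ ∘ hi) eq ⟩
        toℕ (hi (mk i′ d′ le′)) ≡⟨ hi-mk i′ d′ le′ ⟩
        suc (d′ + i′)          ≡⟨ cong (λ z → suc (d′ + z)) i≡ ⟨
        suc (d′ + i)           ∎))
      where
      open ≤-Reasoning
      i≡ = trans (sym (lo-mk i d le)) (trans (cong (toℕ ∘ lo) eq) (lo-mk i′ d′ le′))

    mk-surjective : ∀ e → ∃₂ λ i d → ∃ λ le → e ≡ mk i d le
    mk-surjective e = i , d , le , edge-≡
      (Fin.toℕ-injective (sym (lo-mk i d le)))
        (Fin.toℕ-injective (trans (sym eq) (sym (hi-mk i d le))))
      where
      i = toℕ (lo e)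
      d = toℕ (hi e) ∸ suc i
      eq : suc (d + i) ≡ toℕ (hi e)
      eq = trans (sym (+-suc d i)) (m∸n+n≡m (lo<hi e))
      le : suc (suc (d + i)) ≤ n
      le = subst (_< n) (sym eq) (Fin.toℕ<n (hi e))

    filling : Monomial n → Filling
    filling m i d with suc (suc (d + i)) ≤? n
    ... | yes le = count (mk i d le) m
    ... | no  _  = 0

    filling-mk : ∀ m i d le → filling m i d ≡ count (mk i d le) m
    filling-mk m i d le with suc (suc (d + i)) ≤? n
    ... | yes le′ = cong (λ z → count (mk i d z) m) (≤-irrelevant le′ le)
    ... | no  ≰   = contradiction le ≰

    filling>0 : ∀ m i d → 0 < filling m i d → ∃ λ le → mk i d le ∈ m
    filling>0 m i d pos with suc (suc (d + i)) ≤? n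
    ... | yes le = le , count>0⇒∈ m pos

    filling-⇒↭ : ∀ m m′ → (∀ i d → suc (suc (d + i)) ≤ n → filling m i d ≡ filling m′ i d) → m ↭ m′
    filling-⇒↭ m m′ eq = count⇒↭ m m′ λ e → case e (mk-surjective e)
      where
      case : ∀ e → (∃₂ λ i d → ∃ λ le → e ≡ mk i d le) → count e m ≡ count e m′
      case _ (i , d , le , refl) =
        trans (sym (filling-mk m i d le)) (trans (eq i d le) (filling-mk m′ i d le))

    module _ (F : Filling) where

      row-≤ : ∀ {j} → suc j ≤ n → suc (n ∸ suc j + j) ≤ n
      row-≤ {j} le = subst (_≤ n) (+-suc (n ∸ suc j) j) (≤-reflexive (m∸n+n≡m le))

      row : ∀ i r → suc (r + i) ≤ n → Monomial n
      row i zero    _  = []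
      row i (suc r) le = row i r (≤-trans (n≤1+n _) le) ++ replicate (F i r) (mk i r le)

      rows : ∀ j → j ≤ n → Monomial n
      rows zero    _  = []
      rows (suc j) le = rows j (≤-trans (n≤1+n j) le) ++ row j (n ∸ suc j) (row-≤ le)

      realise : Monomial n
      realise = rows n ≤-refl

      length-row : ∀ i r le → length (row i r le) ≡ ∑< r (F i)
      length-row i zero    le = refl
      length-row i (suc r) le =
        trans (length-++ (row i r _)) (cong₂ _+_ (length-row i r _) (length-replicate (F i r)))

      length-rows : ∀ j le → length (rows j le) ≡ ∑< j (λ i → ∑< (n ∸ suc i) (F i))
      length-rows zero    le = refl
      length-rows (suc j) le =
        trans (length-++ (rows j _)) (cong₂ _+_ (length-rows j _)
          (length-row j (n ∸ suc j) (row-≤ le)))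

      count-row-≢ : ∀ i r le {i′ d′} le′ → i′ ≢ i → count (mk i′ d′ le′) (row i r le) ≡ 0
      count-row-≢ i zero    le le′ i′≢i = refl
      count-row-≢ i (suc r) le {i′} {d′} le′ i′≢i = trans (count-++ _ (row i r _) _)
        (cong₂ _+_ (count-row-≢ i r _ le′ i′≢i)
          (count-replicate-≢ (F i r) (i′≢i ∘ proj₁ ∘ mk-injective i′ d′ le′ i r le)))

      count-row-≥ : ∀ i r le {d′} le′ → r ≤ d′ → count (mk i d′ le′) (row i r le) ≡ 0
      count-row-≥ i zero    le le′ _   = refl
      count-row-≥ i (suc r) le {d′} le′ r<d = trans (count-++ _ (row i r _) _)
        (cong₂ _+_ (count-row-≥ i r _ le′ (<⇒≤ r<d))
          (count-replicate-≢ (F i r) (λ eq →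
            <-irrefl (sym (proj₂ (mk-injective i d′ le′ i r le eq))) r<d)))

      count-row-< : ∀ i r le {d′} le′ → d′ < r → count (mk i d′ le′) (row i r le) ≡ F i d′
      count-row-< i (suc r) le {d′} le′ d′<1+r with m≤n⇒m<n∨m≡n (≤-pred d′<1+r)
      ... | inj₁ d′<r = trans (count-++ _ (row i r _) _) (trans
        (cong₂ _+_ (count-row-< i r _ le′ d′<r)
          (count-replicate-≢ (F i r) (λ eq →
            <-irrefl (proj₂ (mk-injective i d′ le′ i r le eq)) d′<r)))
        (+-identityʳ _))
      ... | inj₂ refl = trans (count-++ _ (row i r _) _) (cong₂ _+_ (count-row-≥ i r _ le′ ≤-refl)
        (trans (cong (λ z → count (mk i r le′) (replicate (F i r) (mk i r z)))
          (≤-irrelevant le le′)) (count-replicate (mk i r le′) (F i r))))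

      count-rows-≥ : ∀ j le {i d} le′ → j ≤ i → count (mk i d le′) (rows j le) ≡ 0
      count-rows-≥ zero    le le′ _   = refl
      count-rows-≥ (suc j) le le′ j<i = trans (count-++ _ (rows j _) _)
        (cong₂ _+_ (count-rows-≥ j _ le′ (<⇒≤ j<i))
          (count-row-≢ j (n ∸ suc j) (row-≤ le) le′ (λ eq → <-irrefl (sym eq) j<i)))

      count-rows-< : ∀ j le {i d} le′ → i < j → count (mk i d le′) (rows j le) ≡ F i d
      count-rows-< (suc j) le {i} {d} le′ i<1+j with m≤n⇒m<n∨m≡n (≤-pred i<1+j)
      ... | inj₁ i<j = trans (count-++ _ (rows j _) _) (trans
        (cong₂ _+_ (count-rows-< j _ le′ i<j)
          (count-row-≢ j (n ∸ suc j) (row-≤ le) le′ (λ eq → <-irrefl eq i<j))) (+-identityʳ _))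
      ... | inj₂ refl = trans (count-++ _ (rows j _) _) (cong₂ _+_ (count-rows-≥ j _ le′ ≤-refl)
        (count-row-< i (n ∸ suc i) (row-≤ le) le′
          (m+n≤o⇒m≤o∸n (suc d) (subst (_≤ n) (cong suc (sym (+-suc d i))) le′))))

      filling-realise : ∀ i d → suc (suc (d + i)) ≤ n → filling realise i d ≡ F i d
      filling-realise i d le = trans (filling-mk realise i d le)
        (count-rows-< n ≤-refl le (m+n≤o⇒n≤o (suc d)
          (subst (_≤ n) (cong suc (sym (+-suc d i))) le)))

    length-filling : ∀ m → length m ≡ ∑< n (λ i → ∑< (n ∸ suc i) (filling m i))
    length-filling m =
      trans (↭-length (filling-⇒↭ m (realise (filling m)) λ i d le →
        sym (filling-realise (filling m) i d le)))
                             (length-rows (filling m) n ≤-refl)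

    module _ {k : ℕ} where
      open Transfer k n

      standard⇒noChain : ∀ {m} → Standard k m → NoChain (filling m)
      standard⇒noChain {m} std {α} {τ} α+τ<n (zs , len , pairs , good) =
        std (proj₁ found) (trans (sym (pw-length (proj₂ found))) len , pw-pairs (proj₂ found) pairs)
          (pw-∈ (proj₂ found))
        where
        -- The cell in row `a` and column `t` from the right carries the edge from `a` to
        -- `n - t - 1`; the equation states this without truncated subtraction.
        EdgeOf : ℕ × ℕ → Edge n → Set
        EdgeOf (a , t) e = toℕ (lo e) ≡ a × toℕ (hi e) + suc t ≡ n × e ∈ m × a ≤ α × t ≤ τ
        edges-of : ∀ zs → All (λ (a , t) → 0 < columns (filling m) a t × a ≤ α × t ≤ τ) zs →
          ∃ (Pointwise EdgeOf zs)
        edges-of []             []                       = [] , []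
        edges-of ((a , t) ∷ zs) ((pos , a≤α , t≤τ) ∷ ps) with filling>0 m a (n ∸ suc (suc (a + t)))
          pos | edges-of zs ps
        ... | le , e∈m | es , rs = mk a d le ∷ es , (lo-mk a d le , eq , e∈m , a≤α , t≤τ) ∷ rs
          where
          d = n ∸ suc (suc (a + t))
          rearrange : ∀ d a t → suc (d + a) + suc t ≡ suc (suc (a + t)) + d
          rearrange = solve-∀
          eq : toℕ (hi (mk a d le)) + suc t ≡ n
          eq = trans (cong (_+ suc t) (hi-mk a d le)) (trans (rearrange d a t)
                 (m+[n∸m]≡n (≤-trans (s≤s (s≤s (+-mono-≤ a≤α t≤τ))) α+τ<n)))
        found = edges-of zs good
        crosses : ∀ {z z′ e e′} → EdgeOf z e → EdgeOf z′ e′ →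
          proj₁ z < proj₁ z′ × proj₂ z′ < proj₂ z → Crosses e e′
        crosses {_ , t} {_ , t′} {e} {e′} (refl , eq , _ , a≤α , t≤τ) (refl , eq′ , _ , a′≤α , t′≤τ)
          (a<a′ , t′<t) =
          inj₁ (a<a′ , +-cancelʳ-≤ (suc t) _ _ (begin
            suc (toℕ (lo e′)) + suc t      ≤⟨ +-mono-≤ (s≤s a′≤α) (s≤s t≤τ) ⟩
            suc α + suc τ                  ≡⟨ cong suc (+-suc α τ) ⟩
            suc (suc (α + τ))              ≤⟨ α+τ<n ⟩
            n                              ≡⟨ eq ⟨
            toℕ (hi e) + suc t             ∎) ,
          +-cancelʳ-≤ (suc t′) _ _ (begin
            suc (toℕ (hi e)) + suc t′      ≡⟨ +-suc (toℕ (hi e)) (suc t′) ⟨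
            toℕ (hi e) + suc (suc t′)      ≤⟨ +-monoʳ-≤ (toℕ (hi e)) (s≤s t′<t) ⟩
            toℕ (hi e) + suc t             ≡⟨ trans eq (sym eq′) ⟩
            toℕ (hi e′) + suc t′           ∎))
          where open ≤-Reasoning
        pw-length : ∀ {zs es} → Pointwise EdgeOf zs es → length zs ≡ length es
        pw-length []       = refl
        pw-length (_ ∷ rs) = cong suc (pw-length rs)
        pw-∈ : ∀ {zs es} → Pointwise EdgeOf zs es → All (_∈ m) es
        pw-∈ []                       = []
        pw-∈ ((_ , _ , e∈ , _) ∷ rs) = e∈ ∷ pw-∈ rs
        pw-all : ∀ {z e zs es} → EdgeOf z e → Pointwise EdgeOf zs es →
                 All (λ z′ → proj₁ z < proj₁ z′ × proj₂ z′ < proj₂ z) zs → All (Crosses e) es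
        pw-all r []        []       = []
        pw-all r (r′ ∷ rs) (p ∷ ps) = crosses r r′ p ∷ pw-all r rs ps
        pw-pairs : ∀ {zs es} → Pointwise EdgeOf zs es →
          AllPairs (λ z z′ → proj₁ z < proj₁ z′ × proj₂ z′ < proj₂ z) zs →
                   AllPairs Crosses es
        pw-pairs []       []       = []
        pw-pairs (r ∷ rs) (p ∷ ps) = pw-all r rs p ∷ pw-pairs rs ps

      uncross : ∀ m → Standard k m → Monomial n
      uncross m std = realise (transfer (filling m) (standard⇒noChain std))

      uncross-length : ∀ m std → length (uncross m std) ≡ length m
      uncross-length m std = begin-equality
        length (uncross m std)                                   ≡⟨ length-rows _ n ≤-refl ⟩
        ∑< n (λ i → ∑< (n ∸ suc i) (transfer (filling m) _ i))
          ≡⟨ ∑<-cong n (λ {i} → transfer-row-sum (filling m) _ i) ⟩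
        ∑< n (λ i → ∑< (n ∸ suc i) (filling m i))                ≡⟨ length-filling m ⟨
        length m                                                 ∎
        where open ≤-Reasoning

      uncross-injective : ∀ {m m′} std std′ → uncross m std ↭ uncross m′ std′ → m ↭ m′
      uncross-injective {m} {m′} std std′ p = filling-⇒↭ m m′ λ i d le →
        transfer-injective (filling m) (filling m′) (standard⇒noChain std) (standard⇒noChain std′)
          same i d
          (subst (λ z → suc (suc z) ≤ n) (+-comm d i) le)
        where
        same : ∀ i d → suc (suc (d + i)) ≤ n → transfer (filling m) (standard⇒noChain std) i d ≡
          transfer (filling m′) (standard⇒noChain std′) i d
        same i d le = begin-equality
          transfer (filling m) _ i d       ≡⟨ filling-realise _ i d le ⟨
          filling (uncross m std) i d      ≡⟨ filling-mk (uncross m std) i d le ⟩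
          count (mk i d le) (uncross m std) ≡⟨ count-↭ (mk i d le) p ⟩
          count (mk i d le) (uncross m′ std′) ≡⟨ filling-mk (uncross m′ std′) i d le ⟨
          filling (uncross m′ std′) i d    ≡⟨ filling-realise _ i d le ⟩
          transfer (filling m′) _ i d      ∎
          where open ≤-Reasoning

      uncross-nestingFree : ∀ m std → NestingFree k (uncross m std)
      uncross-nestingFree m std C len pairs C∈ =
        <-irrefl refl (subst (_≤ k) (trans (length-cells C) len)
          (Burge.nesting-bound bd (cells C) (cells-pairs pairs) (cells-pos C∈)))
        where
        bd = boundary (filling m) (standard⇒noChain std)
        cell : Edge n → ℕ × ℕ
        cell e = let (i , d , _) = mk-surjective e in i , d
        cell-mk : ∀ e → ∃ λ le → e ≡ mk (proj₁ (cell e)) (proj₂ (cell e)) le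
        cell-mk e = proj₂ (proj₂ (mk-surjective e))
        cells : List (Edge n) → List (ℕ × ℕ)
        cells []      = []
        cells (e ∷ C) = cell e ∷ cells C
        length-cells : ∀ C → length (cells C) ≡ length C
        length-cells []      = refl
        length-cells (e ∷ C) = cong suc (length-cells C)
        cell-pos : ∀ {e} → e ∈ uncross m std → 0 < Burge.entry bd (proj₁ (cell e)) (proj₂ (cell e))
        cell-pos {e} e∈ = let (le , eq) = cell-mk e in
          subst (0 <_) (trans (sym (filling-mk (uncross m std) (proj₁ (cell e)) (proj₂ (cell e))
            le)) (filling-realise _ (proj₁ (cell e)) (proj₂ (cell e)) le))
            (∈⇒count>0 (subst (_∈ uncross m std) eq e∈))
        cells-pos : ∀ {C} → All (_∈ uncross m std) C →
          All (λ (i , d) → 0 < Burge.entry bd i d) (cells C)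
        cells-pos []       = []
        cells-pos (p ∷ ps) = cell-pos p ∷ cells-pos ps
        cell-⊐ : ∀ {e f} → Encloses e f → Burge._⊐_ bd (cell e) (cell f)
        cell-⊐ {e} {f} (l , h) = let (le , eq) = cell-mk e ; (le′ , eq′) = cell-mk f in
          l , ≤-pred (subst₂ _<_ (trans (cong (toℕ ∘ hi) eq′)
            (hi-mk (proj₁ (cell f)) (proj₂ (cell f)) le′))
              (trans (cong (toℕ ∘ hi) eq) (hi-mk (proj₁ (cell e)) (proj₂ (cell e)) le)) h)
        cells-all : ∀ {e C} → All (Encloses e) C → All (Burge._⊐_ bd (cell e)) (cells C)
        cells-all []       = []
        cells-all {e} {f ∷ C} (p ∷ ps) = cell-⊐ {e} {f} p ∷ cells-all {e} {C} ps
        cells-pairs : ∀ {C} → AllPairs Encloses C → AllPairs (Burge._⊐_ bd) (cells C)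
        cells-pairs []       = []
        cells-pairs {e ∷ C} (p ∷ ps) = cells-all {e} {C} p ∷ cells-pairs ps

-- Perfect matchings, their words of endpoints and their signs.

module Matchings where
  open import Data.Bool.Base using (true; false)
  open import Data.Fin.Base as Fin using (Fin; toℕ)
  import Data.Fin.Properties as Fin
  open import Data.Fin.Subset using (Subset; ∣_∣) renaming (_∈_ to _∈ˢ_)
  open import Data.Fin.Subset.Properties using (drop-there) renaming (_∈?_ to _∈ˢ?_)
  open import Data.List.Base
    using (List; []; _∷_; length; _++_; filter; map; mapMaybe; cartesianProduct; allFin; foldr;
           tabulate)
  open import Data.List.Membership.Propositional using (_∈_)
  open import Data.List.Membership.Propositional.Properties
    using (∈-filter⁺; ∈-filter⁻; ∈-allFin; ∈-cartesianProduct⁺; ∈-++⁺ˡ; ∈-++⁺ʳ)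
  open import Data.List.Properties using (filter-accept; filter-reject; map-tabulate)
  open import Data.List.Relation.Binary.Permutation.Propositional as ↭
    using (_↭_; ↭-sym; ↭-trans; ↭-refl; prep)
  open import Data.List.Relation.Binary.Permutation.Propositional.Properties
    using (∈-resp-↭; All-resp-↭; shift)
  open import Data.List.Relation.Unary.All as All using (All; []; _∷_)
  import Data.List.Relation.Unary.All.Properties as All
  open import Data.List.Relation.Unary.AllPairs as AllPairs using (AllPairs; []; _∷_)
  open import Data.List.Relation.Unary.Any using (here; there)
  open import Data.List.Relation.Unary.Unique.Propositional using (Unique)
  open import Data.List.Relation.Unary.Unique.Propositional.Properties
    using (cartesianProduct⁺; allFin⁺; filter⁺)
  open import Data.Maybe.Base using (Maybe; just; nothing)
  open import Data.Nat.Base as ℕ using (ℕ)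
  import Data.Nat.Properties as ℕ
  open import Data.Product.Base using (_×_; _,_; ∃; proj₁; proj₂)
  open import Data.Sign.Base as Sign using (Sign; opposite) renaming (_*_ to _⋆_)
  import Data.Sign.Properties as Sign
  open import Data.Sum.Base using (inj₁; inj₂)
  open import Data.Vec.Base using ([]; _∷_; here; there)
  open import Function.Base using (_∘_; id)
  open import Level using (Level)
  open import Relation.Binary.Core using (Rel)
  open import Relation.Binary.Definitions using (Symmetric; Transitive; Total; tri<; tri≈; tri>)
  open import Relation.Binary.PropositionalEquality
  open import Relation.Nullary.Decidable using (Dec; yes; no)
  open import Relation.Nullary.Negation using (¬_; contradiction)
  open import Relation.Unary using (Pred; Decidable)
  open GrowthDiagrams using (edge-≡; module Multiplicity)

  private variable
    a b p q : Level
    A : Set a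
    B : Set b

  allPairs-resp-↭ : ∀ {r} {R : Rel A r} → Symmetric R → ∀ {xs ys} → xs ↭ ys → AllPairs R xs →
    AllPairs R ys
  allPairs-resp-↭ R-sym ↭.refl u = u
  allPairs-resp-↭ R-sym (prep x p) (rx ∷ u) = All-resp-↭ p rx ∷ allPairs-resp-↭ R-sym p u
  allPairs-resp-↭ R-sym (↭.swap x y p) ((rxy ∷ rx) ∷ ry ∷ u) =
    (R-sym rxy ∷ All-resp-↭ p ry) ∷ All-resp-↭ p rx ∷ allPairs-resp-↭ R-sym p u
  allPairs-resp-↭ R-sym (↭.trans p q) = allPairs-resp-↭ R-sym q ∘ allPairs-resp-↭ R-sym p

  unique-resp-↭ : ∀ {xs ys : List A} → xs ↭ ys → Unique xs → Unique ys
  unique-resp-↭ = allPairs-resp-↭ ≢-sym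

  module InsertionSort {r} {R : Rel A r} (R-total : Total R) (R-trans : Transitive R) where

    insert : ∀ x {ys} → AllPairs R ys → ∃ λ zs → x ∷ ys ↭ zs × AllPairs R zs
    insert x []                  = x ∷ [] , ↭-refl , [] ∷ []
    insert x {y ∷ ys} (ry ∷ rys) with R-total x y
    ... | inj₁ rxy = x ∷ y ∷ ys , ↭-refl , (rxy ∷ All.map (R-trans rxy) ry) ∷ ry ∷ rys
    ... | inj₂ ryx = let (zs , p , rzs) = insert x rys in
                     y ∷ zs , ↭-trans (↭.swap x y ↭-refl) (prep y p) , All-resp-↭ p (ryx ∷ ry) ∷ rzs

    sort : ∀ xs → ∃ λ ys → xs ↭ ys × AllPairs R ys
    sort []       = [] , ↭-refl , []
    sort (x ∷ xs) = let (ys , p , rys) = sort xs ; (zs , q , rzs) = insert x rys in zs , ↭-trans (prep x p) q , rzs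

  unique-⊆⇒++ : ∀ {xs ys : List A} → Unique xs → (∀ {x} → x ∈ xs → x ∈ ys) → ∃ λ zs → ys ↭ xs ++ zs
  unique-⊆⇒++ {xs = []}     {ys} u ⊆ = ys , ↭-refl
  unique-⊆⇒++ {xs = x ∷ xs} {ys} (x∉ ∷ u) ⊆ with ∈-∃++ (⊆ (here refl))
    where open import Data.List.Membership.Propositional.Properties using (∈-∃++)
  ... | ys₁ , ys₂ , refl with unique-⊆⇒++ {xs = xs} {ys₁ ++ ys₂} u tail⊆
    where
    tail⊆ : ∀ {y} → y ∈ xs → y ∈ ys₁ ++ ys₂
    tail⊆ y∈ with ∈-resp-↭ (shift x ys₁ ys₂) (⊆ (there y∈))
    ... | here refl = contradiction refl (All.lookup x∉ y∈)
    ... | there y∈′ = y∈′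
  ... | zs , ↭zs = zs , ↭-trans (shift x ys₁ ys₂) (prep x ↭zs)

  unique-same⇒↭ : ∀ {xs ys : List A} → Unique xs → Unique ys →
                  (∀ {x} → x ∈ xs → x ∈ ys) → (∀ {x} → x ∈ ys → x ∈ xs) → xs ↭ ys
  unique-same⇒↭ {xs = xs} {ys} u v xs⊆ys ys⊆xs with unique-⊆⇒++ u xs⊆ys
  ... | [] , ys↭ = ↭-sym (subst (ys ↭_) (++-identityʳ xs) ys↭)
    where open import Data.List.Properties using (++-identityʳ)
  ... | z ∷ zs , ys↭ with unique-resp-↭ (↭-trans ys↭ (shift z xs zs)) v
  ...   | z∉ ∷ _ =
    contradiction refl (All.lookup z∉ (∈-++⁺ˡ
      (ys⊆xs (∈-resp-↭ (↭-sym ys↭) (∈-++⁺ʳ xs (here refl))))))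

  -- The helper in `edges` is local to that definition; unification against `refl` gives it a name,
  -- so that membership in `edges n` can be analysed.
  toEdge-spec : ∀ n → ∃ λ (f : Fin n × Fin n → Maybe (Edge n)) → edges n ≡
    mapMaybe f (cartesianProduct (allFin n) (allFin n))
  toEdge-spec n = _ , refl

  module _ {n : ℕ} where

    toEdge : Fin n × Fin n → Maybe (Edge n)
    toEdge = proj₁ (toEdge-spec n)

    toEdge-just : ∀ i j {e} → toEdge (i , j) ≡ just e → i ≡ lo e × j ≡ hi e
    toEdge-just i j eq with i Fin.<? j
    toEdge-just i j refl | yes _ = refl , refl

    toEdge-edge : ∀ e → toEdge (lo e , hi e) ≡ just e
    toEdge-edge e with lo e Fin.<? hi e
    ... | yes _ = cong just (edge-≡ refl refl)
    ... | no ¬p = contradiction (lo<hi e) ¬p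

    private
      ∈-mapMaybe⁺ : ∀ {f : A → Maybe B} {x y xs} → x ∈ xs → f x ≡ just y → y ∈ mapMaybe f xs
      ∈-mapMaybe⁺ {f = f} {xs = x ∷ xs} (here refl) eq with just y ← f x =
        here (sym (just-injective eq))
        where open import Data.Maybe.Properties using (just-injective)
      ∈-mapMaybe⁺ {f = f} {xs = x ∷ xs} (there x∈) eq with f x
      ... | just _  = there (∈-mapMaybe⁺ x∈ eq)
      ... | nothing = ∈-mapMaybe⁺ x∈ eq

      ∈-mapMaybe⁻ : ∀ (f : A → Maybe B) {y} xs → y ∈ mapMaybe f xs → ∃ λ x → x ∈ xs × f x ≡ just y
      ∈-mapMaybe⁻ f (x ∷ xs) y∈ with f x in eq
      ... | nothing = let (z , z∈ , fz) = ∈-mapMaybe⁻ f xs y∈ in z , there z∈ , fz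
      ∈-mapMaybe⁻ f (x ∷ xs) (here refl) | just _ = x , here refl , eq
      ∈-mapMaybe⁻ f (x ∷ xs) (there y∈)  | just _ = let (z , z∈ , fz) = ∈-mapMaybe⁻ f xs y∈ in z , there z∈ , fz

      mapMaybe-unique : ∀ (f : A → Maybe B) xs → (∀ {x y z} → f x ≡ just z → f y ≡ just z → x ≡ y) →
                        Unique xs → Unique (mapMaybe f xs)
      mapMaybe-unique f []       inj u = []
      mapMaybe-unique f (x ∷ xs) inj (x∉ ∷ u) with f x in eq
      ... | nothing = mapMaybe-unique f xs inj u
      ... | just y  = All.tabulate (λ {z} z∈ y≡z → let (w , w∈ , fw) = ∈-mapMaybe⁻ f xs z∈ in
                        All.lookup x∉ w∈ (inj eq (trans fw (cong just (sym y≡z))))) ∷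
                          mapMaybe-unique f xs inj u

    ∈-edges : ∀ (e : Edge n) → e ∈ edges n
    ∈-edges e =
      ∈-mapMaybe⁺ {f = toEdge} (∈-cartesianProduct⁺ (∈-allFin (lo e)) (∈-allFin (hi e)))
        (toEdge-edge e)

    edges-unique : Unique (edges n)
    edges-unique = mapMaybe-unique toEdge _ inj (cartesianProduct⁺ (allFin⁺ n) (allFin⁺ n))
      where
      inj : ∀ {x y z} → toEdge x ≡ just z → toEdge y ≡ just z → x ≡ y
      inj {i , j} {i′ , j′} eq eq′ with toEdge-just i j eq | toEdge-just i′ j′ eq′
      ... | refl , refl | refl , refl = refl

    -- Matchings are handled through this list: `E` is a perfect matching of `U` precisely if its
    -- word is a permutation of `elements U`.
    word : Monomial n → List (Fin n)
    word []      = []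
    word (e ∷ E) = lo e ∷ hi e ∷ word E

    length-word : ∀ E → length (word E) ≡ 2 ℕ.* length E
    length-word []      = refl
    length-word (e ∷ E) = trans (cong (ℕ.suc ∘ ℕ.suc) (length-word E)) (sym (ℕ.*-suc 2 (length E)))

    word-↭ : ∀ {E E′} → E ↭ E′ → word E ↭ word E′
    word-↭ ↭.refl = ↭-refl
    word-↭ (prep e p) = prep (lo e) (prep (hi e) (word-↭ p))
    word-↭ (↭.swap e f p) =
      ↭-trans (swap₂ (lo e) (hi e) (lo f) (hi f)) (prep _ (prep _ (prep _ (prep _ (word-↭ p)))))
      where
      swap₂ : ∀ a b c d {w : List (Fin n)} → a ∷ b ∷ c ∷ d ∷ w ↭ c ∷ d ∷ a ∷ b ∷ w
      swap₂ a b c d = ↭-trans (prep a (↭.swap b c ↭-refl)) (↭-trans (↭.swap a c ↭-refl)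
        (prep c (↭-trans (prep a (↭.swap b d ↭-refl)) (↭.swap a d ↭-refl))))
    word-↭ (↭.trans p q) = ↭-trans (word-↭ p) (word-↭ q)

    ∈-word : ∀ {e E} → e ∈ E → lo e ∈ word E × hi e ∈ word E
    ∈-word (here refl) = here refl , there (here refl)
    ∈-word (there e∈)  = let (l , h) = ∈-word e∈ in there (there l) , there (there h)

    ∈-word⁻ : ∀ {i} E → i ∈ word E → ∃ λ e → e ∈ E × Incident i e
    ∈-word⁻ (e ∷ E) (here eq)          = e , here refl , inj₁ eq
    ∈-word⁻ (e ∷ E) (there (here eq))  = e , here refl , inj₂ eq
    ∈-word⁻ (e ∷ E) (there (there i∈)) = let (f , f∈ , inc) = ∈-word⁻ E i∈ in f , there f∈ , inc

    open Multiplicity (Fin._≟_ {n})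

    count-word : ∀ i E → count i (word E) ≡ degree i E
    count-word i []      = refl
    count-word i (e ∷ E) with i Fin.≟ lo e
    ... | yes eq with i Fin.≟ hi e
    ...   | yes eq′ = contradiction (cong toℕ (trans (sym eq) eq′)) (ℕ.<⇒≢ (lo<hi e))
    ...   | no _    = cong ℕ.suc (count-word i E)
    count-word i (e ∷ E) | no _ with i Fin.≟ hi e
    ...   | yes _ = cong ℕ.suc (count-word i E)
    ...   | no _  = count-word i E

    elements : Subset n → List (Fin n)
    elements U = filter (_∈ˢ? U) (allFin n)

    elements-unique : ∀ U → Unique (elements U)
    elements-unique U = filter⁺ (_∈ˢ? U) (allFin⁺ n)

    ∈-elements⁺ : ∀ {U i} → i ∈ˢ U → i ∈ elements U
    ∈-elements⁺ {U} {i} = ∈-filter⁺ (_∈ˢ? U) (∈-allFin i)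

    ∈-elements⁻ : ∀ {U i} → i ∈ elements U → i ∈ˢ U
    ∈-elements⁻ {U} i∈ = proj₂ (∈-filter⁻ (_∈ˢ? U) {xs = allFin n} i∈)

    count-unique : ∀ {i xs} → Unique xs → i ∈ xs → count i xs ≡ 1
    count-unique {i} {x ∷ xs} (x∉ ∷ u) (here refl) = trans (count-≡ xs refl)
      (cong ℕ.suc (ℕ.n≤0⇒n≡0 (ℕ.≮⇒≥ λ pos → All.lookup x∉ (count>0⇒∈ xs pos) refl)))
    count-unique {i} {x ∷ xs} (x∉ ∷ u) (there i∈) =
      trans (count-≢ xs (λ eq → All.lookup x∉ i∈ (sym eq))) (count-unique u i∈)

    count-∉ : ∀ {i} xs → ¬ (i ∈ xs) → count i xs ≡ 0
    count-∉ xs i∉ = ℕ.n≤0⇒n≡0 (ℕ.≮⇒≥ λ pos → i∉ (count>0⇒∈ xs pos))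

    matching⇒↭ : ∀ U E → IsPerfectMatching U E → word E ↭ elements U
    matching⇒↭ U E (inU , deg) = count⇒↭ (word E) (elements U) λ i → go i
      where
      go : ∀ i → count i (word E) ≡ count i (elements U)
      go i with i ∈ˢ? U
      ... | yes i∈ =
        trans (trans (count-word i E) (deg i i∈))
          (sym (count-unique (elements-unique U) (∈-elements⁺ i∈)))
      ... | no  i∉ = trans (count-∉ (word E) i∉word) (sym (count-∉ (elements U) (i∉ ∘ ∈-elements⁻)))
        where
        i∉word : ¬ (i ∈ word E)
        i∉word i∈ with ∈-word⁻ E i∈
        ... | e , e∈ , inj₁ refl = i∉ (proj₁ (All.lookup inU e∈))
        ... | e , e∈ , inj₂ refl = i∉ (proj₂ (All.lookup inU e∈))

    ↭⇒matching : ∀ U E → word E ↭ elements U → IsPerfectMatching U E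
    ↭⇒matching U E p = All.tabulate (λ e∈ → let (l , h) = ∈-word e∈ in ∈-elements⁻ (∈-resp-↭ p l) , ∈-elements⁻ (∈-resp-↭ p h)) ,
      λ i i∈ → trans (sym (count-word i E))
        (trans (count-↭ i p) (count-unique (elements-unique U) (∈-elements⁺ i∈)))

  length-filter-map : ∀ {P : Pred A p} {Q : Pred B q} (P? : Decidable P) (Q? : Decidable Q)
    (f : A → B) →
                      (∀ {x} → P x → Q (f x)) → (∀ {x} → Q (f x) → P x) → ∀ xs →
                      length (filter Q? (map f xs)) ≡ length (filter P? xs)
  length-filter-map P? Q? f to from []       = refl
  length-filter-map P? Q? f to from (x ∷ xs) with P? x | Q? (f x)
  ... | yes _  | yes _  = cong ℕ.suc (length-filter-map P? Q? f to from xs)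
  ... | no  _  | no  _  = length-filter-map P? Q? f to from xs
  ... | yes px | no ¬q  = contradiction (to px) ¬q
  ... | no ¬p  | yes qx = contradiction (from qx) ¬p

  length-elements : ∀ {n} (U : Subset n) → length (elements U) ≡ ∣ U ∣
  length-elements []      = refl
  length-elements {ℕ.suc n} (s ∷ U) = go s
    where
    tail : ∀ s → length (filter (_∈ˢ? (s ∷ U)) (tabulate Fin.suc)) ≡ ∣ U ∣
    tail s = trans (cong (length ∘ filter (_∈ˢ? (s ∷ U))) (sym (map-tabulate id Fin.suc)))
      (trans (length-filter-map (_∈ˢ? U) (_∈ˢ? (s ∷ U)) Fin.suc there drop-there (allFin n))
        (length-elements U))
    go : ∀ s → length (elements (s ∷ U)) ≡ ∣ s ∷ U ∣
    go true  = trans (cong length (filter-accept (_∈ˢ? (true ∷ U)) {x = Fin.zero}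
      {xs = tabulate Fin.suc} here)) (cong ℕ.suc (tail true))
    go false = trans (cong length (filter-reject (_∈ˢ? (false ∷ U)) {x = Fin.zero}
      {xs = tabulate Fin.suc} λ ())) (tail false)

  -- Crossing numbers as signs of words.

  parity : ℕ → Sign
  parity ℕ.zero    = Sign.+
  parity (ℕ.suc m) = opposite (parity m)

  opposite-⋆ˡ : ∀ s t → opposite s ⋆ t ≡ opposite (s ⋆ t)
  opposite-⋆ˡ Sign.+ t = refl
  opposite-⋆ˡ Sign.- t = sym (Sign.opposite-involutive t)

  opposite-⋆ʳ : ∀ s t → s ⋆ opposite t ≡ opposite (s ⋆ t)
  opposite-⋆ʳ Sign.+ t = refl
  opposite-⋆ʳ Sign.- t = refl

  module _ {n : ℕ} where

    descent : Fin n → Fin n → Sign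
    descent a x with x Fin.<? a
    ... | yes _ = Sign.-
    ... | no  _ = Sign.+

    descent-> : ∀ {a x} → x Fin.< a → descent a x ≡ Sign.-
    descent-> {a} {x} x<a with x Fin.<? a
    ... | yes _  = refl
    ... | no x≮a = contradiction x<a x≮a

    descent-< : ∀ {a x} → a Fin.< x → descent a x ≡ Sign.+
    descent-< {a} {x} a<x with x Fin.<? a
    ... | yes x<a = contradiction x<a (ℕ.<-asym a<x)
    ... | no _    = refl

    inversions : Fin n → List (Fin n) → Sign
    inversions a = foldr (λ x s → descent a x ⋆ s) Sign.+

    sgn : List (Fin n) → Sign
    sgn []      = Sign.+
    sgn (a ∷ w) = inversions a w ⋆ sgn w

    private
      ⋆-exchange : ∀ s t u → s ⋆ (t ⋆ u) ≡ t ⋆ (s ⋆ u)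
      ⋆-exchange s t u =
        trans (sym (Sign.*-assoc s t u)) (trans (cong (_⋆ u) (Sign.*-comm s t))
          (Sign.*-assoc t s u))

    inversions-↭ : ∀ a {u v} → u ↭ v → inversions a u ≡ inversions a v
    inversions-↭ a ↭.refl         = refl
    inversions-↭ a (prep x p)     = cong (descent a x ⋆_) (inversions-↭ a p)
    inversions-↭ a (↭.swap x y p) = trans (⋆-exchange (descent a x) (descent a y) _)
      (cong (λ z → descent a y ⋆ (descent a x ⋆ z)) (inversions-↭ a p))
    inversions-↭ a (↭.trans p q)  = trans (inversions-↭ a p) (inversions-↭ a q)

    descent-anti : ∀ {a b} → a ≢ b → descent a b ≡ opposite (descent b a)
    descent-anti {a} {b} a≢b with Fin.<-cmp a b
    ... | tri< a<b _ _ = trans (descent-< a<b) (cong opposite (sym (descent-> a<b)))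
    ... | tri≈ _ a≡b _ = contradiction a≡b a≢b
    ... | tri> _ _ b<a = trans (descent-> b<a) (cong opposite (sym (descent-< b<a)))

    sgn-swap : ∀ p {a b} w → a ≢ b → sgn (p ++ a ∷ b ∷ w) ≡ opposite (sgn (p ++ b ∷ a ∷ w))
    sgn-swap []      {a} {b} w a≢b = begin
      (descent a b ⋆ inversions a w) ⋆ (inversions b w ⋆ sgn w)
        ≡⟨ cong (λ z → (z ⋆ inversions a w) ⋆ (inversions b w ⋆ sgn w)) (descent-anti a≢b) ⟩
      (opposite (descent b a) ⋆ inversions a w) ⋆ (inversions b w ⋆ sgn w)
        ≡⟨ cong (_⋆ (inversions b w ⋆ sgn w)) (opposite-⋆ˡ (descent b a) _) ⟩
      opposite (descent b a ⋆ inversions a w) ⋆ (inversions b w ⋆ sgn w)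
        ≡⟨ opposite-⋆ˡ (descent b a ⋆ inversions a w) _ ⟩
      opposite ((descent b a ⋆ inversions a w) ⋆ (inversions b w ⋆ sgn w))
        ≡⟨ cong opposite (interchange (descent b a) (inversions a w) (inversions b w) (sgn w)) ⟩
      opposite ((descent b a ⋆ inversions b w) ⋆ (inversions a w ⋆ sgn w))   ∎
      where
      open ≡-Reasoning
      open import Algebra.Properties.CommutativeSemigroup Sign.*-commutativeSemigroup using (interchange)
    sgn-swap (x ∷ p) {a} {b} w a≢b = trans
      (cong₂ _⋆_ (inversions-↭ x (++⁺ˡ p (↭.swap a b ↭-refl))) (sgn-swap p w a≢b))
      (opposite-⋆ʳ (inversions x (p ++ b ∷ a ∷ w)) _)
      where open import Data.List.Relation.Binary.Permutation.Propositional.Properties using (++⁺ˡ)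

    crossing-sign : Edge n → Edge n → Sign
    crossing-sign e f with crosses? e f
    ... | yes _ = Sign.-
    ... | no  _ = Sign.+

    crossing-yes : ∀ {e f} → Crosses e f → crossing-sign e f ≡ Sign.-
    crossing-yes {e} {f} c with crosses? e f
    ... | yes _ = refl
    ... | no ¬c = contradiction c ¬c

    crossing-no : ∀ {e f} → ¬ Crosses e f → crossing-sign e f ≡ Sign.+
    crossing-no {e} {f} ¬c with crosses? e f
    ... | yes c = contradiction c ¬c
    ... | no _  = refl

    -- The number of descents among the four comparisons is 0 or 4 for separated edges, 2 for nested
    -- ones, and 1 or 3 for crossing ones.
    pair-sign : ∀ e f → lo e ≢ lo f → lo e ≢ hi f → hi e ≢ lo f → hi e ≢ hi f →
                (descent (lo e) (lo f) ⋆ descent (lo e) (hi f)) ⋆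
                  (descent (hi e) (lo f) ⋆ descent (hi e) (hi f)) ≡ crossing-sign e f
    pair-sign e f ll lh hl hh with Fin.<-cmp (lo e) (lo f) | Fin.<-cmp (hi e) (hi f)
    ... | tri≈ _ eq _ | _ = contradiction eq ll
    ... | _ | tri≈ _ eq _ = contradiction eq hh
    ... | tri< a<c _ _ | tri> _ _ d<b
      rewrite descent-< a<c | descent-< (ℕ.<-trans a<c (lo<hi f)) | descent->
        (ℕ.<-trans (lo<hi f) d<b) | descent-> d<b
            = sym (crossing-no {e} {f} λ { (inj₁ (_ , _ , b<d)) →
              ℕ.<-asym b<d d<b ; (inj₂ (c<a , _)) → ℕ.<-asym c<a a<c })
    ... | tri> _ _ c<a | tri< b<d _ _
      rewrite descent-> c<a | descent-< (ℕ.<-trans (lo<hi e) b<d) | descent->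
        (ℕ.<-trans c<a (lo<hi e)) | descent-< b<d
            = sym (crossing-no {e} {f} λ { (inj₁ (a<c , _)) →
              ℕ.<-asym a<c c<a ; (inj₂ (_ , _ , d<b)) → ℕ.<-asym b<d d<b })
    ... | tri< a<c _ _ | tri< b<d _ _ with Fin.<-cmp (hi e) (lo f)
    ...   | tri≈ _ eq _ = contradiction eq hl
    ...   | tri< b<c _ _
      rewrite descent-< a<c | descent-< (ℕ.<-trans a<c (lo<hi f)) | descent-< b<c | descent-< b<d
            = sym (crossing-no {e} {f} λ { (inj₁ (_ , c<b , _)) →
              ℕ.<-asym c<b b<c ; (inj₂ (c<a , _)) → ℕ.<-asym c<a a<c })
    ...   | tri> _ _ c<b
      rewrite descent-< a<c | descent-< (ℕ.<-trans a<c (lo<hi f)) | descent-> c<b | descent-< b<d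
            = sym (crossing-yes {e} {f} (inj₁ (a<c , c<b , b<d)))
    pair-sign e f ll lh hl hh | tri> _ _ c<a | tri> _ _ d<b with Fin.<-cmp (lo e) (hi f)
    ...   | tri≈ _ eq _ = contradiction eq lh
    ...   | tri> _ _ d<a
      rewrite descent-> c<a | descent-> d<a | descent-> (ℕ.<-trans c<a (lo<hi e)) | descent-> d<b
            = sym (crossing-no {e} {f} λ { (inj₁ (a<c , _)) →
              ℕ.<-asym a<c c<a ; (inj₂ (_ , a<d , _)) → ℕ.<-asym a<d d<a })
    ...   | tri< a<d _ _
      rewrite descent-> c<a | descent-< a<d | descent-> (ℕ.<-trans c<a (lo<hi e)) | descent-> d<b
            = sym (crossing-yes {e} {f} (inj₂ (c<a , a<d , d<b)))

    private
      edge-sign : ∀ e E → All (lo e ≢_) (word E) → All (hi e ≢_) (word E) →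
                  inversions (lo e) (word E) ⋆ inversions (hi e) (word E) ≡
                    parity (length (filter (crosses? e) E))
      edge-sign e []      _ _ = refl
      edge-sign e (f ∷ E) (ll ∷ lh ∷ l) (hl ∷ hh ∷ h) = begin
        (D₁ ⋆ (D₂ ⋆ I)) ⋆ (D₃ ⋆ (D₄ ⋆ I′))
          ≡⟨ cong₂ _⋆_ (sym (Sign.*-assoc D₁ D₂ I)) (sym (Sign.*-assoc D₃ D₄ I′)) ⟩
        ((D₁ ⋆ D₂) ⋆ I) ⋆ ((D₃ ⋆ D₄) ⋆ I′)     ≡⟨ interchange (D₁ ⋆ D₂) I (D₃ ⋆ D₄) I′ ⟩
        ((D₁ ⋆ D₂) ⋆ (D₃ ⋆ D₄)) ⋆ (I ⋆ I′)
          ≡⟨ cong₂ _⋆_ (pair-sign e f ll lh hl hh) (edge-sign e E l h) ⟩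
        crossing-sign e f ⋆ parity (length (filter (crosses? e) E)) ≡⟨ step ⟩
        parity (length (filter (crosses? e) (f ∷ E))) ∎
        where
        open ≡-Reasoning
        open import Algebra.Properties.CommutativeSemigroup Sign.*-commutativeSemigroup using (interchange)
        D₁ = descent (lo e) (lo f)
        D₂ = descent (lo e) (hi f)
        D₃ = descent (hi e) (lo f)
        D₄ = descent (hi e) (hi f)
        I = inversions (lo e) (word E)
        I′ = inversions (hi e) (word E)
        step : crossing-sign e f ⋆ parity (length (filter (crosses? e) E)) ≡
          parity (length (filter (crosses? e) (f ∷ E)))
        step = case (crosses? e f)
          where
          case : Dec (Crosses e f) → crossing-sign e f ⋆ parity (length (filter (crosses? e) E)) ≡
            parity (length (filter (crosses? e) (f ∷ E)))
          case (yes c) = trans (cong (_⋆ parity (length (filter (crosses? e) E))) (crossing-yes c))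
                               (cong (parity ∘ length) (sym (filter-accept (crosses? e) c)))
          case (no ¬c) = trans (cong (_⋆ parity (length (filter (crosses? e) E))) (crossing-no ¬c))
                               (cong (parity ∘ length) (sym (filter-reject (crosses? e) ¬c)))

    parity-+ : ∀ l m → parity (l ℕ.+ m) ≡ parity l ⋆ parity m
    parity-+ ℕ.zero    m = refl
    parity-+ (ℕ.suc l) m =
      trans (cong opposite (parity-+ l m)) (sym (opposite-⋆ˡ (parity l) (parity m)))

    -- This turns the sign of a term of the Pfaffian into an alternating function of the word, which
    -- is what the exterior algebra can see.
    sgn-word : ∀ E → Unique (word E) → sgn (word E) ≡ parity (cr E)
    sgn-word []      u = refl
    sgn-word (e ∷ E) ((_ ∷ l) ∷ h ∷ u) = begin
      (descent (lo e) (hi e) ⋆ inversions (lo e) (word E)) ⋆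
        (inversions (hi e) (word E) ⋆ sgn (word E))
        ≡⟨ cong (λ z → (z ⋆ inversions (lo e) (word E)) ⋆
          (inversions (hi e) (word E) ⋆ sgn (word E))) (descent-< (lo<hi e)) ⟩
      inversions (lo e) (word E) ⋆ (inversions (hi e) (word E) ⋆ sgn (word E))
        ≡⟨ Sign.*-assoc (inversions (lo e) (word E)) _ _ ⟨
      (inversions (lo e) (word E) ⋆ inversions (hi e) (word E)) ⋆ sgn (word E)
        ≡⟨ cong₂ _⋆_ (edge-sign e E l h) (sgn-word E u) ⟩
      parity (length (filter (crosses? e) E)) ⋆ parity (cr E)
        ≡⟨ parity-+ (length (filter (crosses? e) E)) (cr E) ⟨
      parity (cr (e ∷ E)) ∎
      where open ≡-Reasoning

-- Exchange steps from a matching to the all-crossing matching on the same vertices.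

module Uncrossing where
  open import Data.Fin.Base as Fin using (Fin; toℕ)
  import Data.Fin.Properties as Fin
  open import Data.Fin.Subset using (Subset; ∣_∣) renaming (_∈_ to _∈ˢ_)
  open import Data.List.Base using (List; []; _∷_; length; _++_; filter; map)
  open import Data.List.Membership.Propositional using (_∈_; find)
  open import Data.List.Membership.Propositional.Properties
    using (∈-map⁺; ∈-map⁻; ∈-filter⁺; ∈-filter⁻; ∈-++⁺ˡ; ∈-++⁺ʳ; ∈-++⁻)
  open import Data.List.Properties using (∷-injectiveˡ; ∷-injectiveʳ; length-map)
  open import Data.List.Relation.Binary.Permutation.Propositional as ↭
    using (_↭_; ↭-sym; ↭-trans; ↭-refl; prep; ↭-reflexive)
  open import Data.List.Relation.Binary.Permutation.Propositional.Properties
    using (↭-length; ++⁺; shift; drop-∷; ∈-resp-↭; ↭-empty-inv; ¬x∷xs↭[])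
  open import Data.List.Relation.Unary.All as All using (All; []; _∷_)
  import Data.List.Relation.Unary.All.Properties as All
  open import Data.List.Relation.Unary.AllPairs as AllPairs using (AllPairs; []; _∷_)
  import Data.List.Relation.Unary.AllPairs.Properties as AllPairs
  open import Data.List.Relation.Unary.Any using (here; there)
  open import Data.List.Relation.Unary.Unique.Propositional using (Unique)
  import Data.List.Relation.Unary.Unique.Propositional.Properties as Unique
  open import Data.Nat.Base as ℕ using (ℕ; z≤n; s≤s)
  import Data.Nat.Properties as ℕ
  open import Data.Product.Base using (_×_; _,_; ∃; ∃₂; proj₁; proj₂)
  open import Data.Sum.Base as Sum using (_⊎_; inj₁; inj₂)
  open import Data.Vec.Base using (tabulate; lookup)
  open import Data.Vec.Properties using (lookup∘tabulate; []=⇒lookup; lookup⇒[]=)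
  open import Function.Base using (_∘_)
  open import Relation.Binary.Definitions using (tri<; tri≈; tri>)
  open import Relation.Binary.PropositionalEquality
  open import Relation.Nullary.Decidable using (yes; no; does; dec-true)
  open import Relation.Nullary.Negation using (¬_; contradiction)
  open import Data.Nat.Tactic.RingSolver using (solve-∀)
  open GrowthDiagrams using (edge-≡; ∈⇒↭∷)
  open Matchings

  module _ {n : ℕ} where

    infix 3 _⇝_ _⇝*_

    -- A step replaces a pair of disjoint noncrossing edges by the crossing pair with the same endpoints.
    data _⇝_ (E : Monomial n) : Monomial n → Set where
      rejoin : ∀ {a a′ b b′ : Fin n} (p : a Fin.< a′) (q : a′ Fin.< b) (r : b Fin.< b′) F →
             E ↭ edge p ∷ edge r ∷ F ⊎ E ↭ edge (Fin.<-trans p (Fin.<-trans q r)) ∷ edge q ∷ F →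
             E ⇝ edge (Fin.<-trans p q) ∷ edge (Fin.<-trans q r) ∷ F

    data _⇝*_ (E C : Monomial n) : Set where
      done : E ↭ C → E ⇝* C
      more : ∀ {E′} → E ⇝ E′ → E′ ⇝* C → E ⇝* C

    crosses-sym : ∀ {e f : Edge n} → Crosses e f → Crosses f e
    crosses-sym = Sum.swap

    crosses-< : ∀ {e f : Edge n} → Crosses e f → lo e Fin.< hi f × lo f Fin.< hi e
    crosses-< {e} {f} (inj₁ (a , b , c)) = Fin.<-trans {i = lo e} {lo f} {hi f} a (lo<hi f) , b
    crosses-< {e} {f} (inj₂ (a , b , c)) = b , Fin.<-trans {i = lo f} {lo e} {hi e} a (lo<hi e)

    Apart : Edge n → Edge n → Set
    Apart e f = lo e ≢ lo f × lo e ≢ hi f × hi e ≢ lo f × hi e ≢ hi f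

    crosses⇒apart : ∀ {e f : Edge n} → Crosses e f → Apart e f
    crosses⇒apart {e} {f} c with crosses-< {e} {f} c | c
    ... | p , q | inj₁ (a , b , d) =
      (λ eq → ℕ.<⇒≢ a (cong toℕ eq)) , (λ eq → ℕ.<⇒≢ p (cong toℕ eq)) ,
                                     (λ eq → ℕ.<⇒≢ q (cong toℕ (sym eq))) ,
                                       (λ eq → ℕ.<⇒≢ d (cong toℕ eq))
    ... | p , q | inj₂ (a , b , d) =
      (λ eq → ℕ.<⇒≢ a (cong toℕ (sym eq))) , (λ eq → ℕ.<⇒≢ p (cong toℕ eq)) ,
                                     (λ eq → ℕ.<⇒≢ q (cong toℕ (sym eq))) ,
                                       (λ eq → ℕ.<⇒≢ d (cong toℕ (sym eq)))

    crossing-unique-word : ∀ {C : Monomial n} → AllPairs Crosses C → Unique (word C)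
    crossing-unique-word []         = []
    crossing-unique-word {e ∷ C} (ce ∷ cs) =
      ((λ eq → ℕ.<⇒≢ (lo<hi e) (cong toℕ eq)) ∷ fresh (λ {f} (ll , lh , _) → ll , lh) ce) ∷
      fresh (λ {f} (_ , _ , hs) → hs) ce ∷ crossing-unique-word cs
      where
      fresh : ∀ {i} {D : Monomial n} → (∀ {f} → Apart e f → i ≢ lo f × i ≢ hi f) →
        All (Crosses e) D → All (i ≢_) (word D)
      fresh apart []       = []
      fresh {D = f ∷ D} apart (c ∷ cs) = proj₁ (apart {f} (crosses⇒apart {e} {f} c)) ∷ proj₂
        (apart {f} (crosses⇒apart {e} {f} c)) ∷ fresh (λ {g} → apart {g}) cs

    unique-word⇒apart : ∀ {e f : Edge n} {F} → Unique (word (e ∷ f ∷ F)) → Apart e f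
    unique-word⇒apart ((_ ∷ ll ∷ lh ∷ _) ∷ (hl ∷ hh ∷ _) ∷ _) = ll , lh , hl , hh

    noncrossing-pair : ∀ (E : Monomial n) → AllPairs Crosses E ⊎ ∃₂ λ e f → ∃ λ F → E ↭
      e ∷ f ∷ F × ¬ Crosses e f
    noncrossing-pair []      = inj₁ []
    noncrossing-pair (e ∷ E) with noncrossing-pair E
    ... | inj₂ (f , g , F , p , ¬c) =
      inj₂ (f , g , e ∷ F , ↭-trans (prep e p) (↭-sym (shift e (f ∷ g ∷ []) F)) , ¬c)
    ... | inj₁ cs with All.all? (crosses? e) E
    ...   | yes ce = inj₁ (ce ∷ cs)
    ...   | no ¬ce with find (All.¬All⇒Any¬ (crosses? e) E ¬ce)
    ...     | f , f∈ , ¬c = let (F , p) = ∈⇒↭∷ f∈ in inj₂ (e , f , F , prep e p , ¬c)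

    uncross-pair : ∀ {E} e f F → E ↭ e ∷ f ∷ F → Apart e f → ¬ Crosses e f → lo e Fin.< lo f →
      ∃ (E ⇝_)
    uncross-pair {E} e f F p (_ , _ , hl , hh) ¬c lo< with Fin.<-cmp (hi e) (lo f) | Fin.<-cmp
      (hi e) (hi f)
    ... | tri≈ _ eq _ | _ = contradiction eq hl
    ... | _ | tri≈ _ eq _ = contradiction eq hh
    ... | tri< h<l _ _ | _ = _ , rejoin (lo<hi e) h<l (lo<hi f) F (inj₁ p)
    ... | tri> _ _ l<h | tri< h<h _ _ = contradiction (inj₁ (lo< , l<h , h<h)) ¬c
    ... | tri> _ _ l<h | tri> _ _ h>h = _ , rejoin lo< (lo<hi f) h>h F
          (inj₂ (subst (λ z → E ↭ z ∷ f ∷ F) (edge-≡ refl refl) p))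

    improve : ∀ E → Unique (word E) → AllPairs Crosses E ⊎ ∃ (E ⇝_)
    improve E u with noncrossing-pair E
    ... | inj₁ cs = inj₁ cs
    ... | inj₂ (e , f , F , p , ¬c) with unique-word⇒apart {e} {f} {F} (unique-resp-↭ (word-↭ p) u)
    ...   | apart@(ll , lh , hl , hh) with Fin.<-cmp (lo e) (lo f)
    ...     | tri< lt _ _ = inj₂ (uncross-pair e f F p apart ¬c lt)
    ...     | tri≈ _ eq _ = contradiction eq ll
    ...     | tri> _ _ gt =
      inj₂ (uncross-pair f e F (↭-trans p (↭.swap e f ↭-refl))
        (ll ∘ sym , hl ∘ sym , lh ∘ sym , hh ∘ sym)
                                    (¬c ∘ crosses-sym {f} {e}) gt)

    ⇝-word : ∀ {E E′} → E ⇝ E′ → word E ↭ word E′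
    ⇝-word (rejoin {a} {a′} {b} {b′} p q r F (inj₁ E↭)) =
      ↭-trans (word-↭ E↭) (prep a (↭-trans (↭.swap a′ b ↭-refl) ↭-refl))
    ⇝-word (rejoin {a} {a′} {b} {b′} p q r F (inj₂ E↭)) = ↭-trans (word-↭ E↭)
      (prep a (↭-trans (↭.swap b′ a′ ↭-refl)
        (↭-trans (prep a′ (↭.swap b′ b ↭-refl)) (↭.swap a′ b ↭-refl))))

    -- Up to a function of the endpoints, twice this is the concave weight ℓ (n ∸ ℓ) of the length ℓ
    -- of e, which makes it strictly fp-positive.
    rank : Edge n → ℕ
    rank e = toℕ (hi e) ℕ.* (toℕ (lo e) ℕ.+ n)

    ranks : Monomial n → ℕ
    ranks []      = 0
    ranks (e ∷ E) = rank e ℕ.+ ranks E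

    ranks-↭ : ∀ {E E′} → E ↭ E′ → ranks E ≡ ranks E′
    ranks-↭ ↭.refl         = refl
    ranks-↭ (prep e p)     = cong (rank e ℕ.+_) (ranks-↭ p)
    ranks-↭ (↭.swap e f p) =
      trans (cong (λ z → rank e ℕ.+ (rank f ℕ.+ z)) (ranks-↭ p)) (x∙yz≈y∙xz (rank e) (rank f) _)
      where open import Algebra.Properties.CommutativeSemigroup ℕ.+-commutativeSemigroup using (x∙yz≈y∙xz)
    ranks-↭ (↭.trans p q)  = trans (ranks-↭ p) (ranks-↭ q)

    ranks-++ : ∀ E F → ranks (E ++ F) ≡ ranks E ℕ.+ ranks F
    ranks-++ []      F = refl
    ranks-++ (e ∷ E) F =
      trans (cong (rank e ℕ.+_) (ranks-++ E F)) (sym (ℕ.+-assoc (rank e) (ranks E) (ranks F)))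

    private
      -- The right side exceeds the left by `(b - a′) * (a + (n - b′))`, and in `rank-nest` by
      -- `(a′ - a) * (b′ - b)`.
      rank-side : ∀ a a′ b b′ → a′ ℕ.< b → b′ ℕ.< n →
        a′ ℕ.* (a ℕ.+ n) ℕ.+ b′ ℕ.* (b ℕ.+ n) ℕ.< b ℕ.* (a ℕ.+ n) ℕ.+ b′ ℕ.* (a′ ℕ.+ n)
      rank-side a a′ b b′ a′<b b′<n with ℕ.m≤n⇒∃[o]m+o≡n a′<b | ℕ.m≤n⇒∃[o]m+o≡n b′<n
      ... | x , refl | y , refl =
        subst₂ ℕ._<_ refl (expand a a′ b′ x y) (ℕ.m<m+n _ {ℕ.suc x ℕ.* (a ℕ.+ ℕ.suc y)} positive)
        where
        expand : ∀ a a′ b′ x y → a′ ℕ.* (a ℕ.+ (ℕ.suc b′ ℕ.+ y)) ℕ.+ b′ ℕ.*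
          (ℕ.suc (a′ ℕ.+ x) ℕ.+ (ℕ.suc b′ ℕ.+ y)) ℕ.+ ℕ.suc x ℕ.* (a ℕ.+ ℕ.suc y)
                 ≡ ℕ.suc (a′ ℕ.+ x) ℕ.* (a ℕ.+ (ℕ.suc b′ ℕ.+ y)) ℕ.+ b′ ℕ.*
                   (a′ ℕ.+ (ℕ.suc b′ ℕ.+ y))
        expand = solve-∀
        positive : 0 ℕ.< ℕ.suc x ℕ.* (a ℕ.+ ℕ.suc y)
        positive rewrite ℕ.+-suc a y = s≤s z≤n
      rank-nest : ∀ a a′ b b′ → a ℕ.< a′ → b ℕ.< b′ →
        b′ ℕ.* (a ℕ.+ n) ℕ.+ b ℕ.* (a′ ℕ.+ n) ℕ.< b ℕ.* (a ℕ.+ n) ℕ.+ b′ ℕ.* (a′ ℕ.+ n)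
      rank-nest a a′ b b′ a<a′ b<b′ with ℕ.m≤n⇒∃[o]m+o≡n a<a′ | ℕ.m≤n⇒∃[o]m+o≡n b<b′
      ... | x , refl | y , refl =
        subst₂ ℕ._<_ refl (expand a b x y n) (ℕ.m<m+n _ {ℕ.suc x ℕ.* ℕ.suc y} (s≤s z≤n))
        where
        expand : ∀ a b x y n → ℕ.suc (b ℕ.+ y) ℕ.* (a ℕ.+ n) ℕ.+ b ℕ.* (ℕ.suc (a ℕ.+ x) ℕ.+ n) ℕ.+
          ℕ.suc x ℕ.* ℕ.suc y
                 ≡ b ℕ.* (a ℕ.+ n) ℕ.+ ℕ.suc (b ℕ.+ y) ℕ.* (ℕ.suc (a ℕ.+ x) ℕ.+ n)
        expand = solve-∀

    ⇝-ranks : ∀ {E E′} → E ⇝ E′ → ranks E ℕ.< ranks E′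
    ⇝-ranks (rejoin {a} {a′} {b} {b′} p q r F (inj₁ E↭)) =
      subst₂ ℕ._<_ (trans (ℕ.+-assoc (toℕ a′ ℕ.* (toℕ a ℕ.+ n)) _ _) (sym (ranks-↭ E↭)))
        (ℕ.+-assoc (toℕ b ℕ.* (toℕ a ℕ.+ n)) _ _)
        (ℕ.+-monoˡ-< (ranks F) (rank-side (toℕ a) (toℕ a′) (toℕ b) (toℕ b′) q (Fin.toℕ<n b′)))
    ⇝-ranks (rejoin {a} {a′} {b} {b′} p q r F (inj₂ E↭)) =
      subst₂ ℕ._<_ (trans (ℕ.+-assoc (toℕ b′ ℕ.* (toℕ a ℕ.+ n)) _ _) (sym (ranks-↭ E↭)))
        (ℕ.+-assoc (toℕ b ℕ.* (toℕ a ℕ.+ n)) _ _)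
        (ℕ.+-monoˡ-< (ranks F) (rank-nest (toℕ a) (toℕ a′) (toℕ b) (toℕ b′) p r))

    ranks-bound : ∀ E → ranks E ℕ.≤ length E ℕ.* (n ℕ.* (n ℕ.+ n))
    ranks-bound []      = z≤n
    ranks-bound (e ∷ E) =
      ℕ.+-mono-≤ (ℕ.*-mono-≤ (ℕ.<⇒≤ (Fin.toℕ<n (hi e))) (ℕ.+-monoˡ-≤ n (ℕ.<⇒≤ (Fin.toℕ<n (lo e)))))
        (ranks-bound E)

    private
      sorted-↭⇒≡ : ∀ {xs ys : List (Fin n)} → AllPairs Fin._<_ xs → AllPairs Fin._<_ ys → xs ↭ ys →
        xs ≡ ys
      sorted-↭⇒≡ {[]}     {ys}     _ _ p = sym (↭-empty-inv (↭-sym p))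
      sorted-↭⇒≡ {x ∷ xs} {[]}     _ _ p = contradiction p ¬x∷xs↭[]
      sorted-↭⇒≡ {x ∷ xs} {y ∷ ys} (x< ∷ xs↗) (y< ∷ ys↗) p with head≡
        where
        head≡ : x ≡ y
        head≡ with ∈-resp-↭ p (here refl) | ∈-resp-↭ (↭-sym p) (here refl)
        ... | here eq   | _         = eq
        ... | there _   | here eq   = sym eq
        ... | there x∈  | there y∈  = contradiction (All.lookup y< x∈) (ℕ.<-asym (All.lookup x< y∈))
      ... | refl = cong (x ∷_) (sorted-↭⇒≡ xs↗ ys↗ (drop-∷ p))

      los his : Monomial n → List (Fin n)
      los = map lo
      his = map hi

      word-split : ∀ E → word E ↭ los E ++ his E
      word-split []      = ↭-refl
      word-split (e ∷ E) =
        prep (lo e) (↭-trans (prep (hi e) (word-split E)) (↭-sym (shift (hi e) (los E) (his E))))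

      split-injective : ∀ E E′ → length E ≡ length E′ → los E ++ his E ≡ los E′ ++ his E′ → E ≡ E′
      split-injective E E′ len eq with append-injective (los E) (los E′)
        (trans (length-map lo E) (trans len (sym (length-map lo E′)))) eq
        where
        append-injective : ∀ (xs ys : List (Fin n)) {us vs} → length xs ≡ length ys → xs ++ us ≡
          ys ++ vs → xs ≡ ys × us ≡ vs
        append-injective []       []       _   eq = refl , eq
        append-injective (x ∷ xs) (y ∷ ys) len eq with append-injective xs ys (ℕ.suc-injective len)
          (∷-injectiveʳ eq)
        ... | p , q = cong₂ _∷_ (∷-injectiveˡ eq) p , q
      ... | ls , hs = same E E′ ls hs
        where
        same : ∀ E E′ → los E ≡ los E′ → his E ≡ his E′ → E ≡ E′
        same []      []       _  _  = refl
        same (e ∷ E) (f ∷ E′) ls hs =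
          cong₂ _∷_ (edge-≡ (∷-injectiveˡ ls) (∷-injectiveˡ hs))
            (same E E′ (∷-injectiveʳ ls) (∷-injectiveʳ hs))

      Starts : Edge n → Edge n → Set
      Starts e f = lo e Fin.≤ lo f

      split-sorted : ∀ E → AllPairs Starts E → AllPairs Crosses E →
        AllPairs Fin._<_ (los E ++ his E)
      split-sorted E ss cs =
        AllPairs.++⁺ (AllPairs.map⁺ (AllPairs.map (λ {e} {f} → lower e f) (AllPairs.zip (ss , cs))))
          (AllPairs.map⁺ (AllPairs.map (λ {e} {f} → upper e f) (AllPairs.zip (ss , cs))))
          (All.map⁺ (All.tabulate λ {e} e∈ → All.map⁺ (All.tabulate λ {f} f∈ → mixed e∈ f∈ cs)))
        where
        lower : ∀ e f → Starts e f × Crosses e f → lo e Fin.< lo f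
        lower e f (s , inj₁ (p , _)) = p
        lower e f (s , inj₂ (p , _)) = contradiction s (ℕ.<⇒≱ p)
        upper : ∀ e f → Starts e f × Crosses e f → hi e Fin.< hi f
        upper e f (s , inj₁ (_ , _ , p)) = p
        upper e f (s , inj₂ (p , _))     = contradiction s (ℕ.<⇒≱ p)
        mixed : ∀ {e f E} → e ∈ E → f ∈ E → AllPairs Crosses E → lo e Fin.< hi f
        mixed {e} (here refl) (here refl) _        = lo<hi e
        mixed {e} {f} (here refl) (there f∈)  (c ∷ _) = proj₁ (crosses-< {e} {f} (All.lookup c f∈))
        mixed {e} {f} (there e∈)  (here refl) (c ∷ _) = proj₂ (crosses-< {f} {e} (All.lookup c e∈))
        mixed (there e∈)  (there f∈)  (_ ∷ cs) = mixed e∈ f∈ cs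

    -- In a crossing every lower endpoint precedes every upper one, so after sorting by lower
    -- endpoints the list `los ++ his` is strictly increasing. It is then the sorted list of
    -- vertices, which determines the edges.
    crossing-↭ : ∀ {E C} → AllPairs Crosses E → AllPairs Crosses C → word E ↭ word C → E ↭ C
    crossing-↭ {E} {C} cE cC p with sort E | sort C
      where open InsertionSort {R = Starts} (λ e f → ℕ.≤-total (toℕ (lo e)) (toℕ (lo f))) (λ {e} {f} {g} → ℕ.≤-trans)
    ... | E′ , E↭ , sE | C′ , C↭ , sC = ↭-trans E↭ (↭-trans (↭-reflexive eq) (↭-sym C↭))
      where
      p′ : word E′ ↭ word C′
      p′ = ↭-trans (word-↭ (↭-sym E↭)) (↭-trans p (word-↭ C↭))
      len : length E′ ≡ length C′
      len = ℕ.*-cancelˡ-≡ _ _ 2 (trans (sym (length-word E′))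
        (trans (↭-length p′) (length-word C′)))
      eq : E′ ≡ C′
      eq = split-injective E′ C′ len (sorted-↭⇒≡
        (split-sorted E′ sE (allPairs-resp-↭ (λ {e} {f} → crosses-sym {e} {f}) E↭ cE))
        (split-sorted C′ sC (allPairs-resp-↭ (λ {e} {f} → crosses-sym {e} {f}) C↭ cC))
        (↭-trans (↭-sym (word-split E′)) (↭-trans p′ (word-split C′))))

    -- Steps keep the vertices and increase `ranks`, which is bounded for a fixed number of edges. A
    -- matching that admits no step is all-crossing and hence equal to `C`.
    uncrossing : ∀ {E C} → AllPairs Crosses C → word E ↭ word C → E ⇝* C
    uncrossing {E} {C} cC p = go (B ℕ.∸ ranks E) E p (ℕ.≤-reflexive (sym (ℕ.m∸n+n≡m (bound E p))))
      where
      B = length C ℕ.* (n ℕ.* (n ℕ.+ n))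
      bound : ∀ E → word E ↭ word C → ranks E ℕ.≤ B
      bound E p = subst (λ z → ranks E ℕ.≤ z ℕ.* (n ℕ.* (n ℕ.+ n)))
        (ℕ.*-cancelˡ-≡ (length E) (length C) 2
          (trans (sym (length-word E)) (trans (↭-length p) (length-word C)))) (ranks-bound E)
      go : ∀ d E → word E ↭ word C → B ℕ.≤ d ℕ.+ ranks E → E ⇝* C
      go d E p le with improve E (unique-resp-↭ (↭-sym p) (crossing-unique-word cC))
      ... | inj₁ cE = done (crossing-↭ cE cC p)
      go ℕ.zero    E p le | inj₂ (E′ , s) =
        contradiction (bound E′ (↭-trans (↭-sym (⇝-word s)) p)) (ℕ.<⇒≱ (ℕ.≤-<-trans le (⇝-ranks s)))
      go (ℕ.suc d) E p le | inj₂ (E′ , s) = more s (go d E′ (↭-trans (↭-sym (⇝-word s)) p)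
        (ℕ.≤-trans le (ℕ.≤-trans (ℕ.≤-reflexive (sym (ℕ.+-suc d (ranks E))))
          (ℕ.+-monoʳ-≤ d (⇝-ranks s)))))

    ⇝*-ranks : ∀ {E C} → E ⇝* C → E ↭ C ⊎ ranks E ℕ.< ranks C
    ⇝*-ranks (done p)   = inj₁ p
    ⇝*-ranks (more s r) with ⇝*-ranks r
    ... | inj₁ p  = inj₂ (subst (_ ℕ.<_) (ranks-↭ p) (⇝-ranks s))
    ... | inj₂ lt = inj₂ (ℕ.<-trans (⇝-ranks s) lt)

    support : Monomial n → Subset n
    support C = tabulate λ i → does (i ∈ᶠ? word C)
      where open import Data.List.Membership.DecPropositional (Fin._≟_ {n}) using () renaming (_∈?_ to _∈ᶠ?_)

    elements-support : ∀ {C} → Unique (word C) → elements (support C) ↭ word C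
    elements-support {C} u =
      unique-same⇒↭ (elements-unique (support C)) u (from ∘ ∈-elements⁻) (∈-elements⁺ ∘ to)
      where
      open import Data.List.Membership.DecPropositional (Fin._≟_ {n}) using () renaming (_∈?_ to _∈ᶠ?_)
      to : ∀ {i} → i ∈ word C → i ∈ˢ support C
      to {i} i∈ =
        lookup⇒[]= i (support C) (trans (lookup∘tabulate (λ i → does (i ∈ᶠ? word C)) i)
          (dec-true (i ∈ᶠ? word C) i∈))
      from : ∀ {i} → i ∈ˢ support C → i ∈ word C
      from {i} i∈ with i ∈ᶠ? word C | trans (sym (lookup∘tabulate (λ i → does (i ∈ᶠ? word C)) i))
        ([]=⇒lookup i∈)
      ... | yes p | _ = p
      ... | no _  | ()

    size-support : ∀ {C} → Unique (word C) → ∣ support C ∣ ≡ 2 ℕ.* length C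
    size-support {C} u =
      trans (sym (length-elements (support C)))
        (trans (↭-length (elements-support {C} u)) (length-word C))

    -- Distinctness is up to permutation, the equality of monomials; it ensures that no coefficient
    -- of a Pfaffian collects two matchings.
    sublists-distinct : ∀ {xs : List (Edge n)} → Unique xs →
      AllPairs (λ s t → ¬ (s ↭ t)) (sublists xs)
    sublists-distinct {[]}     u        = [] ∷ []
    sublists-distinct {x ∷ xs} (x∉ ∷ u) = AllPairs.++⁺
      (AllPairs.map⁺ (AllPairs.map (λ ¬p p → ¬p (drop-∷ p)) (sublists-distinct u)))
      (sublists-distinct u)
      (All.map⁺ (All.tabulate λ {s} _ → All.tabulate λ {t} t∈ p →
        All.lookup x∉ (∈-sublist xs t∈ (∈-resp-↭ p (here refl))) refl))
      where
      ∈-sublist : ∀ (xs : List (Edge n)) {t y} → t ∈ sublists xs → y ∈ t → y ∈ xs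
      ∈-sublist []       (here refl) ()
      ∈-sublist (x ∷ xs) t∈ y∈ with ∈-++⁻ (map (x ∷_) (sublists xs)) t∈
      ... | inj₂ t∈′ = there (∈-sublist xs t∈′ y∈)
      ... | inj₁ t∈′ with ∈-map⁻ (x ∷_) t∈′
      ...   | s , s∈ , refl with y∈
      ...     | here eq   = here eq
      ...     | there y∈′ = there (∈-sublist xs s∈ y∈′)

    sublist-↭ : ∀ {C : Monomial n} → Unique C → ∃ λ C′ → C′ ∈ sublists (edges n) × C′ ↭ C
    sublist-↭ {C} u = filter (_∈ₑ? C) (edges n) , filter∈ (edges n) ,
      unique-same⇒↭ (Unique.filter⁺ (_∈ₑ? C) edges-unique) u
        (proj₂ ∘ ∈-filter⁻ (_∈ₑ? C) {xs = edges n}) (λ {e} → ∈-filter⁺ (_∈ₑ? C) (∈-edges e))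
      where
      filter∈ : ∀ xs → filter (_∈ₑ? C) xs ∈ sublists xs
      filter∈ []       = here refl
      filter∈ (x ∷ xs) with x ∈ₑ? C
      ... | yes _ = ∈-++⁺ˡ (∈-map⁺ (x ∷_) (filter∈ xs))
      ... | no  _ = ∈-++⁺ʳ (map (x ∷_) (sublists xs)) (filter∈ xs)

    crossing-unique : ∀ {C : Monomial n} → AllPairs Crosses C → Unique C
    crossing-unique = AllPairs.map λ {e} {f} c eq → proj₁ (crosses⇒apart {e} {f} c) (cong lo eq)

    -- `C` may list its edges in another order than `edges n` does; `C′` is the reordering of `C`
    -- that occurs among the enumerated matchings.
    matchings-split : ∀ {C : Monomial n} → AllPairs Crosses C → ∃₂ λ C′ Es →
                      perfectMatchings (support C) ↭ C′ ∷ Es × C′ ↭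
                        C × All (λ E → word E ↭ word C × ¬ (E ↭ C)) Es
    matchings-split {C} cC = C′ , Es , p , C′↭ , All.tabulate λ {E} E∈ →
        ↭-trans (matching⇒↭ U E (proj₂ (∈-filter⁻ (isPerfectMatching? U) {xs = sublists (edges n)}
          (∈-resp-↭ (↭-sym p) (there E∈))))) elems ,
        λ q → All.lookup (AllPairs.head distinct) E∈ (↭-trans C′↭ (↭-sym q))
      where
      U = support C
      elems = elements-support {C} (crossing-unique-word cC)
      found = sublist-↭ (crossing-unique cC)
      C′ = proj₁ found
      C′↭ = proj₂ (proj₂ found)
      C′∈ : C′ ∈ perfectMatchings U
      C′∈ = ∈-filter⁺ (isPerfectMatching? U) (proj₁ (proj₂ found))
        (↭⇒matching U C′ (↭-trans (word-↭ C′↭) (↭-sym elems)))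
      Es = proj₁ (∈⇒↭∷ C′∈)
      p = proj₂ (∈⇒↭∷ C′∈)
      distinct : AllPairs (λ s t → ¬ (s ↭ t)) (C′ ∷ Es)
      distinct = allPairs-resp-↭ (λ ¬p q → ¬p (↭-sym q)) p
        (AllPairs.filter⁺ (isPerfectMatching? U) (sublists-distinct edges-unique))

open import Algebra.Apartness.Bundles using (HeytingField)
open import Algebra.Bundles using (CommutativeRing)
import Algebra.Construct.NaturalChoice.Max as Max
import Algebra.Properties.CommutativeSemigroup as CommutativeSemigroupProperties
import Algebra.Properties.Ring as RingProperties
import Algebra.Properties.Semiring.Exp as Exp
open import Axiom.ExcludedMiddle using (ExcludedMiddle)
open import Data.Fin.Base as Fin using (Fin; toℕ; fromℕ<)
import Data.Fin.Properties as Fin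
open import Data.Fin.Subset using (Subset; ∣_∣)
open import Data.List.Base
  using (List; []; _∷_; length; _++_; filter; map; concatMap; foldr; cartesianProductWith;
         cartesianProduct; allFin; [_])
open import Data.List.Membership.Propositional using (_∈_; find; lose)
open import Data.List.Membership.Propositional.Properties
  using (∈-filter⁻; ∈-map⁻; ∈-map⁺; ∈-++⁺ˡ; ∈-++⁺ʳ; ∈-++⁻; ∈-allFin; ∈-cartesianProduct⁺;
         ∈-concatMap⁺; ∈-concatMap⁻; ∈-filter⁺; ∈-cartesianProductWith⁺)
open import Data.List.Properties
  using (filter-reject; length-filter; map-++; ++-assoc; length-tabulate; length-map; length-++)
open import Data.List.Relation.Binary.Disjoint.Propositional using (Disjoint)
open import Data.List.Relation.Binary.Permutation.Propositional as ↭
  using (_↭_; ↭-sym; ↭-trans; ↭-refl; prep; ↭-reflexive)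
open import Data.List.Relation.Binary.Permutation.Propositional.Properties
  using (↭-length; ++⁺ˡ; drop-∷; map⁺; ∈-resp-↭; ¬x∷xs↭[]; ++-comm)
open import Data.List.Relation.Binary.Pointwise.Base as Pointwise using (Pointwise; []; _∷_)
open import Data.List.Relation.Unary.All as All using (All; []; _∷_)
import Data.List.Relation.Unary.All.Properties as All
open import Data.List.Relation.Unary.AllPairs as AllPairs using (AllPairs; []; _∷_)
import Data.List.Relation.Unary.AllPairs.Properties as AllPairs
open import Data.List.Relation.Unary.Any as Any using (here; there; Any)
open import Data.List.Relation.Unary.Unique.Propositional using (Unique)
import Data.List.Relation.Unary.Unique.Propositional.Properties as Unique
open import Data.Nat.Base as ℕ using (ℕ; z≤n; s≤s)
open import Data.Nat.Induction using (<-rec)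
import Data.Nat.Properties as ℕ
open import Data.Nat.Tactic.RingSolver using (solve-∀)
open import Data.Product.Base using (_×_; _,_; ∃; ∃₂; proj₁; proj₂)
open import Data.Sign.Base as Sign using (Sign; opposite)
open import Data.Sum.Base as Sum using (_⊎_; inj₁; inj₂; [_,_]′)
open import Function.Base using (_∘_)
open import Level using (Level; _⊔_; 0ℓ)
open import Relation.Binary.Definitions using (tri<; tri≈; tri>; Total; Transitive)
open import Relation.Binary.PropositionalEquality as ≡ using (_≡_; _≢_)
open import Relation.Nullary.Decidable using (Dec; yes; no; ¬?; _×-dec_)
open import Relation.Nullary.Negation using (¬_; contradiction)
open import Relation.Unary using (Pred; Decidable; _⊆_; _≐_)

open GrowthDiagrams using
  (edge-≡; Standard; NestingFree; Encloses; ∈⇒↭∷; uncross; uncross-length; uncross-injective;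
    uncross-nestingFree)
open Matchings
open Uncrossing

-- Finite sums and linear extensions of functions to formal sums.

module Sums {c ℓ} (R : CommutativeRing c ℓ) where
  open CommutativeRing R hiding (zero)
  open import Relation.Binary.Reasoning.Setoid setoid
  open CommutativeSemigroupProperties +-commutativeSemigroup using (interchange; x∙yz≈y∙xz) public
  open RingProperties ring using (-‿+-comm; -0#≈0#; -‿distribˡ-*; -‿distribʳ-*; -‿involutive) public

  private variable
    b d p : Level
    B : Set b
    D : Set d

  ∑ : List B → (B → Carrier) → Carrier
  ∑ xs g = foldr (λ x s → g x + s) 0# xs

  ∑-cong : ∀ (xs : List B) {g h} → (∀ {x} → x ∈ xs → g x ≈ h x) → ∑ xs g ≈ ∑ xs h
  ∑-cong []       eq = refl
  ∑-cong (x ∷ xs) eq = +-cong (eq (here ≡.refl)) (∑-cong xs (eq ∘ there))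

  ∑-cong′ : ∀ (xs : List B) {g h} → (∀ x → g x ≈ h x) → ∑ xs g ≈ ∑ xs h
  ∑-cong′ xs eq = ∑-cong xs λ {x} _ → eq x

  ∑-zero : ∀ (xs : List B) {g} → (∀ {x} → x ∈ xs → g x ≈ 0#) → ∑ xs g ≈ 0#
  ∑-zero []       eq = refl
  ∑-zero (x ∷ xs) eq = trans (+-cong (eq (here ≡.refl)) (∑-zero xs (eq ∘ there))) (+-identityˡ 0#)

  ∑-zero′ : ∀ (xs : List B) {g} → (∀ x → g x ≈ 0#) → ∑ xs g ≈ 0#
  ∑-zero′ xs eq = ∑-zero xs λ {x} _ → eq x

  ∑-++ : ∀ (xs ys : List B) {g} → ∑ (xs ++ ys) g ≈ ∑ xs g + ∑ ys g
  ∑-++ []       ys = sym (+-identityˡ _)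
  ∑-++ (x ∷ xs) ys = trans (+-congˡ (∑-++ xs ys)) (sym (+-assoc _ _ _))

  ∑-map : ∀ (f : B → D) xs {g} → ∑ (map f xs) g ≈ ∑ xs (g ∘ f)
  ∑-map f []       = refl
  ∑-map f (x ∷ xs) = +-congˡ (∑-map f xs)

  ∑-concatMap : ∀ (f : B → List D) xs {g} → ∑ (concatMap f xs) g ≈ ∑ xs (λ x → ∑ (f x) g)
  ∑-concatMap f []       = refl
  ∑-concatMap f (x ∷ xs) = trans (∑-++ (f x) (concatMap f xs)) (+-congˡ (∑-concatMap f xs))

  ∑-+ : ∀ (xs : List B) {g h} → ∑ xs (λ x → g x + h x) ≈ ∑ xs g + ∑ xs h
  ∑-+ []       = sym (+-identityˡ 0#)
  ∑-+ (x ∷ xs) = trans (+-congˡ (∑-+ xs)) (interchange _ _ _ _)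

  ∑-*ˡ : ∀ (xs : List B) a {g} → a * ∑ xs g ≈ ∑ xs (λ x → a * g x)
  ∑-*ˡ []       a = zeroʳ a
  ∑-*ˡ (x ∷ xs) a = trans (distribˡ a _ _) (+-congˡ (∑-*ˡ xs a))

  ∑-*ʳ : ∀ (xs : List B) a {g} → ∑ xs g * a ≈ ∑ xs (λ x → g x * a)
  ∑-*ʳ []       a = zeroˡ a
  ∑-*ʳ (x ∷ xs) a = trans (distribʳ a _ _) (+-congˡ (∑-*ʳ xs a))

  ∑-neg : ∀ (xs : List B) {g} → ∑ xs (λ x → - g x) ≈ - ∑ xs g
  ∑-neg []       = sym -0#≈0#
  ∑-neg (x ∷ xs) = trans (+-congˡ (∑-neg xs)) (-‿+-comm _ _)

  ∑-swap : ∀ (xs : List B) (ys : List D) {g : B → D → Carrier} →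
           ∑ xs (λ x → ∑ ys (g x)) ≈ ∑ ys (λ y → ∑ xs (λ x → g x y))
  ∑-swap []       ys = sym (∑-zero′ ys λ _ → refl)
  ∑-swap (x ∷ xs) ys = trans (+-congˡ (∑-swap xs ys)) (sym (∑-+ ys))

  ∑-↭ : ∀ {xs ys : List B} {g} → xs ↭ ys → ∑ xs g ≈ ∑ ys g
  ∑-↭ ↭.refl        = refl
  ∑-↭ (prep x p)    = +-congˡ (∑-↭ p)
  ∑-↭ (↭.swap x y p) = trans (+-congˡ (+-congˡ (∑-↭ p))) (x∙yz≈y∙xz _ _ _)
  ∑-↭ (↭.trans p q) = trans (∑-↭ p) (∑-↭ q)

  ∑-filter : ∀ {P : Pred B p} (P? : Decidable P) xs {g} → (∀ {x} → ¬ P x → g x ≈ 0#) →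
    ∑ (filter P? xs) g ≈ ∑ xs g
  ∑-filter P? []       null = refl
  ∑-filter P? (x ∷ xs) null with P? x
  ... | yes _  = +-congˡ (∑-filter P? xs null)
  ... | no ¬Px = trans (∑-filter P? xs null) (sym (trans (+-congʳ (null ¬Px)) (+-identityˡ _)))

  ∑-filter-split : ∀ {P : Pred B p} (P? : Decidable P) xs {g} →
    ∑ (filter P? xs) g + ∑ (filter (¬? ∘ P?) xs) g ≈ ∑ xs g
  ∑-filter-split P? []       = +-identityˡ 0#
  ∑-filter-split P? (x ∷ xs) with P? x
  ... | yes _ = trans (+-assoc _ _ _) (+-congˡ (∑-filter-split P? xs))
  ... | no  _ = trans (x∙yz≈y∙xz _ _ _) (+-congˡ (∑-filter-split P? xs))

  ∑-cartesianProductWith : ∀ {a} {A : Set a} (f : B → D → A) xs ys {g} →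
                           ∑ (cartesianProductWith f xs ys) g ≈ ∑ xs (λ x → ∑ ys (λ y → g (f x y)))
  ∑-cartesianProductWith f []       ys = refl
  ∑-cartesianProductWith f (x ∷ xs) ys = trans (∑-++ (map (f x) ys) _)
    (+-cong (∑-map (f x) ys) (∑-cartesianProductWith f xs ys))

  -- The diagonal is a hypothesis of its own, because antisymmetry does not make it vanish in
  -- characteristic 2.
  ∑-alternating : ∀ (xs : List B) (ψ : B → B → Carrier) → (∀ x y → ψ x y ≈ - ψ y x) →
    (∀ x → ψ x x ≈ 0#) →
                  ∑ xs (λ x → ∑ xs (ψ x)) ≈ 0#
  ∑-alternating []       ψ anti diag = refl
  ∑-alternating (x ∷ xs) ψ anti diag = begin
    (ψ x x + ∑ xs (ψ x)) + ∑ xs (λ y → ψ y x + ∑ xs (ψ y))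
      ≈⟨ +-cong (+-congʳ (diag x)) (∑-+ xs) ⟩
    (0# + ∑ xs (ψ x)) + (∑ xs (λ y → ψ y x) + ∑ xs (λ y → ∑ xs (ψ y)))
      ≈⟨ +-cong (+-identityˡ _) (+-cong (∑-cong′ xs (λ y → anti y x))
        (∑-alternating xs ψ anti diag)) ⟩
    ∑ xs (ψ x) + (∑ xs (λ y → - ψ x y) + 0#)
      ≈⟨ +-congˡ (trans (+-identityʳ _) (∑-neg xs)) ⟩
    ∑ xs (ψ x) + - ∑ xs (ψ x)                                          ≈⟨ -‿inverseʳ _ ⟩
    0#                                                                 ∎

  lin : List (Carrier × B) → (B → Carrier) → Carrier
  lin f χ = ∑ f λ (a , m) → a * χ m

  lin-cong : ∀ (f : List (Carrier × B)) {χ χ′} → (∀ m → χ m ≈ χ′ m) → lin f χ ≈ lin f χ′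
  lin-cong f eq = ∑-cong′ f λ (a , m) → *-congˡ (eq m)

  lin-∑ : ∀ (f : List (Carrier × B)) (ys : List D) (g : D → Carrier) (χ : D → B → Carrier) →
          lin f (λ m → ∑ ys (λ y → g y * χ y m)) ≈ ∑ ys (λ y → g y * lin f (χ y))
  lin-∑ f ys g χ = begin
    ∑ f (λ (a , m) → a * ∑ ys (λ y → g y * χ y m))     ≈⟨ ∑-cong′ f (λ (a , m) → ∑-*ˡ ys a) ⟩
    ∑ f (λ (a , m) → ∑ ys (λ y → a * (g y * χ y m)))   ≈⟨ ∑-swap f ys ⟩
    ∑ ys (λ y → ∑ f (λ (a , m) → a * (g y * χ y m)))
      ≈⟨ ∑-cong′ ys (λ y → trans (∑-cong′ f (λ (a , m) → x∙yz≈y∙xz′ a (g y) (χ y m)))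
        (sym (∑-*ˡ f (g y)))) ⟩
    ∑ ys (λ y → g y * lin f (χ y))                     ∎
    where open CommutativeSemigroupProperties *-commutativeSemigroup using () renaming (x∙yz≈y∙xz to x∙yz≈y∙xz′)

  scale : Carrier → List (Carrier × B) → List (Carrier × B)
  scale a = map λ (b , m) → a * b , m

  lin-scale : ∀ a (f : List (Carrier × B)) {χ} → lin (scale a f) χ ≈ a * lin f χ
  lin-scale a f = trans (∑-map _ f) (trans (∑-cong′ f λ _ → *-assoc a _ _) (sym (∑-*ˡ f a)))

  Invariant : (List B → Carrier) → Set _
  Invariant χ = ∀ {s t} → s ↭ t → χ s ≈ χ t

-- Polynomials are compared by evaluating them on all permutation-invariant functions of monomials,
-- which makes identities between products of polynomials accessible without a ring structure on them.
module Polynomials {c ℓ} (R : CommutativeRing c ℓ) {n : ℕ} where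
  open CommutativeRing R hiding (zero)
  open import Relation.Binary.Reasoning.Setoid setoid
  open Sums R

  private P = Poly R n

  δ : Monomial n → Monomial n → Carrier
  δ m s with s ≟ₘ m
  ... | yes _ = 1#
  ... | no  _ = 0#

  δ-yes : ∀ {m s} → s ↭ m → δ m s ≈ 1#
  δ-yes {m} {s} p with s ≟ₘ m
  ... | yes _ = refl
  ... | no ¬p = contradiction p ¬p

  δ-no : ∀ {m s} → ¬ (s ↭ m) → δ m s ≈ 0#
  δ-no {m} {s} ¬p with s ≟ₘ m
  ... | yes p = contradiction p ¬p
  ... | no  _ = refl

  δ-invariant : ∀ m → Invariant (δ m)
  δ-invariant m {s} {t} s↭t with t ≟ₘ m
  ... | yes p = δ-yes (↭-trans s↭t p)
  ... | no ¬p = δ-no (λ p → ¬p (↭-trans (↭-sym s↭t) p))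

  coeff-lin : ∀ f m → coeff R f m ≈ lin f (δ m)
  coeff-lin []            m = refl
  coeff-lin ((a , s) ∷ f) m with s ≟ₘ m
  ... | yes p = +-cong (sym (*-identityʳ a)) (coeff-lin f m)
  ... | no ¬p = trans (coeff-lin f m) (sym (trans (+-congʳ (zeroʳ a)) (+-identityˡ _)))

  lin⇒≈ₚ : ∀ (f g : P) → (∀ {χ} → Invariant χ → lin f χ ≈ lin g χ) → _≈ₚ_ R f g
  lin⇒≈ₚ f g eq m = trans (coeff-lin f m) (trans (eq (δ-invariant m)) (sym (coeff-lin g m)))

  private
    -- A formal sum may repeat a monomial. All terms equal to the first one are split off; together
    -- they contribute the coefficient of `m` times `χ m`, which is zero, and the rest is shorter
    -- with the same vanishing coefficients.
    vanish : ∀ N (f : P) → length f ℕ.≤ N → (∀ m → lin f (δ m) ≈ 0#) → ∀ {χ} → Invariant χ →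
      lin f χ ≈ 0#
    vanish N       []               _         _ _ = refl
    vanish (ℕ.suc N) f@((a , m) ∷ f₀) (s≤s len) null {χ} inv = begin
      lin f χ                            ≈⟨ ∑-filter-split (λ t → proj₂ t ≟ₘ m) f ⟨
      lin f₁ χ + lin f₂ χ                ≈⟨ +-cong part₁ (vanish N f₂ len₂ null₂ inv) ⟩
      0# + 0#                            ≈⟨ +-identityˡ 0# ⟩
      0#                                 ∎
      where
      f₁ = filter (λ t → proj₂ t ≟ₘ m) f
      f₂ = filter (¬? ∘ λ t → proj₂ t ≟ₘ m) f
      len₂ : length f₂ ℕ.≤ N
      len₂ rewrite filter-reject (¬? ∘ λ (t : Carrier × Monomial n) → proj₂ t ≟ₘ m) {x = a , m}
        {xs = f₀} (λ ¬p → ¬p ↭-refl) =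
        ℕ.≤-trans (length-filter _ f₀) len
      same : ∀ (g : P) → lin (filter (λ t → proj₂ t ≟ₘ m) g) χ ≈ lin g (δ m) * χ m
      same []            = sym (zeroˡ _)
      same ((b , s) ∷ g) with s ≟ₘ m
      ... | yes p =
        trans (+-cong (*-cong (sym (*-identityʳ b)) (inv p)) (same g)) (sym (distribʳ _ _ _))
      ... | no ¬p = trans (same g) (*-congʳ (sym (trans (+-congʳ (zeroʳ b)) (+-identityˡ _))))
      part₁ : lin f₁ χ ≈ 0#
      part₁ = trans (same f) (trans (*-congʳ (null m)) (zeroˡ _))
      null₂ : ∀ s → lin f₂ (δ s) ≈ 0#
      null₂ s with s ≟ₘ m
      ... | yes p = ∑-zero f₂ λ {(b , t)} t∈ →
        trans (*-congˡ (δ-no (λ t↭s → proj₂ (∈-filter⁻ (¬? ∘ λ t → proj₂ t ≟ₘ m) {xs = f} t∈)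
          (↭-trans t↭s p)))) (zeroʳ b)
      ... | no ¬p = trans (∑-filter (¬? ∘ λ t → proj₂ t ≟ₘ m) f λ {(b , t)} ¬¬t↭m →
                      trans (*-congˡ (δ-no λ t↭s → ¬¬t↭m λ t↭m → ¬p (↭-trans (↭-sym t↭s) t↭m)))
                        (zeroʳ b)) (null s)

  ≈ₚ⇒lin : ∀ (f g : P) → _≈ₚ_ R f g → ∀ {χ} → Invariant χ → lin f χ ≈ lin g χ
  ≈ₚ⇒lin f g eq {χ} inv = begin
    lin f χ                                   ≈⟨ +-identityʳ _ ⟨
    lin f χ + 0#                              ≈⟨ +-congˡ (-‿inverseˡ _) ⟨
    lin f χ + (- lin g χ + lin g χ)           ≈⟨ +-assoc _ _ _ ⟨
    (lin f χ + - lin g χ) + lin g χ           ≈⟨ +-congʳ (diff χ) ⟨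
    lin (f ++ scale (- 1#) g) χ + lin g χ
      ≈⟨ +-congʳ (vanish _ (f ++ scale (- 1#) g) ℕ.≤-refl diff≈0 inv) ⟩
    0# + lin g χ                              ≈⟨ +-identityˡ _ ⟩
    lin g χ                                   ∎
    where
    diff : ∀ χ → lin (f ++ scale (- 1#) g) χ ≈ lin f χ + - lin g χ
    diff χ = trans (∑-++ f _) (+-congˡ (trans (lin-scale (- 1#) g)
      (trans (sym (-‿distribˡ-* 1# _)) (-‿cong (*-identityˡ _)))))
    diff≈0 : ∀ m → lin (f ++ scale (- 1#) g) (δ m) ≈ 0#
    diff≈0 m = trans (diff (δ m)) (trans (+-congʳ
      (trans (sym (coeff-lin f m)) (trans (eq m) (coeff-lin g m)))) (-‿inverseʳ _))

  lin-*ₚ : ∀ (g f : P) χ → lin (_*ₚ_ R g f) χ ≈ lin g (λ s → lin f (λ t → χ (s ++ t)))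
  lin-*ₚ g f χ = trans (∑-cartesianProductWith _ g f)
    (∑-cong′ g λ (a , s) → trans (∑-cong′ f λ (b , t) → *-assoc a b _) (sym (∑-*ˡ f a)))

-- A triple (l , i , j) stands for the product η_{l,i} ζ_{l,j} of two odd variables.
module Exterior {c ℓ} (R : CommutativeRing c ℓ) {Lane V : Set} where
  open CommutativeRing R hiding (zero)
  open import Relation.Binary.Reasoning.Setoid setoid
  open Sums R

  Triple : Set
  Triple = Lane × V × V

  record Alternating (κ : List V → Carrier) : Set (c ⊔ ℓ) where
    field
      anti : ∀ p a b w → κ (p ++ a ∷ b ∷ w) ≈ - κ (p ++ b ∷ a ∷ w)
      same : ∀ p a w → κ (p ++ a ∷ a ∷ w) ≈ 0#

  module _ {κ : List V → Carrier} (alt : Alternating κ) where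
    open Alternating alt

    alternating-∷ : ∀ a → Alternating (κ ∘ (a ∷_))
    alternating-∷ a = record { anti = λ p → anti (a ∷ p) ; same = λ p → same (a ∷ p) }

    alt-dup₁₃ : ∀ a b d w → a ≡ b ⊎ a ≡ d → κ (a ∷ b ∷ d ∷ w) ≈ 0#
    alt-dup₁₃ a b d w (inj₁ ≡.refl) = same [] a _
    alt-dup₁₃ a b d w (inj₂ ≡.refl) =
      trans (anti (a ∷ []) b a w) (trans (-‿cong (same [] a _)) -0#≈0#)

    alt-block : ∀ a b d e w → κ (a ∷ b ∷ d ∷ e ∷ w) ≈ κ (d ∷ e ∷ a ∷ b ∷ w)
    alt-block a b d e w = begin
      κ (a ∷ b ∷ d ∷ e ∷ w)          ≈⟨ anti (a ∷ []) b d (e ∷ w) ⟩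
      - κ (a ∷ d ∷ b ∷ e ∷ w)        ≈⟨ -‿cong (anti [] a d (b ∷ e ∷ w)) ⟩
      - - κ (d ∷ a ∷ b ∷ e ∷ w)      ≈⟨ -‿involutive _ ⟩
      κ (d ∷ a ∷ b ∷ e ∷ w)          ≈⟨ anti (d ∷ a ∷ []) b e w ⟩
      - κ (d ∷ a ∷ e ∷ b ∷ w)        ≈⟨ -‿cong (anti (d ∷ []) a e (b ∷ w)) ⟩
      - - κ (d ∷ e ∷ a ∷ b ∷ w)      ≈⟨ -‿involutive _ ⟩
      κ (d ∷ e ∷ a ∷ b ∷ w)          ∎

    alt-exchange : ∀ a b d e w → κ (a ∷ b ∷ d ∷ e ∷ w) ≈ - κ (a ∷ e ∷ d ∷ b ∷ w)
    alt-exchange a b d e w = begin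
      κ (a ∷ b ∷ d ∷ e ∷ w)          ≈⟨ anti (a ∷ []) b d (e ∷ w) ⟩
      - κ (a ∷ d ∷ b ∷ e ∷ w)        ≈⟨ -‿cong (anti (a ∷ d ∷ []) b e w) ⟩
      - - κ (a ∷ d ∷ e ∷ b ∷ w)      ≈⟨ -‿cong (-‿cong (anti (a ∷ []) d e (b ∷ w))) ⟩
      - - - κ (a ∷ e ∷ d ∷ b ∷ w)    ≈⟨ -‿cong (-‿involutive _) ⟩
      - κ (a ∷ e ∷ d ∷ b ∷ w)        ∎

  vertices : List Triple → List V
  vertices []                = []
  vertices ((_ , i , j) ∷ W) = i ∷ j ∷ vertices W

  length-vertices : ∀ W → length (vertices W) ≡ 2 ℕ.* length W
  length-vertices []      = ≡.refl
  length-vertices (t ∷ W) =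
    ≡.trans (≡.cong (ℕ.suc ∘ ℕ.suc) (length-vertices W)) (≡.sym (ℕ.*-suc 2 (length W)))

  -- A block of two letters passes another such block in four transpositions, so the order of the
  -- pairs does not affect the sign.
  alt-vertices : ∀ {κ} → Alternating κ → ∀ {W W′} → W ↭ W′ → κ (vertices W) ≈ κ (vertices W′)
  alt-vertices alt ↭.refl = refl
  alt-vertices alt (prep (_ , i , j) p) = alt-vertices (alternating-∷ (alternating-∷ alt i) j) p
  alt-vertices alt (↭.swap (_ , i , j) (_ , i′ , j′) p) = trans (alt-block alt i j i′ j′ _)
    (alt-vertices (alternating-∷ (alternating-∷ (alternating-∷ (alternating-∷ alt i′) j′) i) j) p)
  alt-vertices alt (↭.trans p q) = trans (alt-vertices alt p) (alt-vertices alt q)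

  Share : Triple → Triple → Set
  Share (_ , i , j) (_ , i′ , j′) = (i ≡ i′ ⊎ i ≡ j′) ⊎ (j ≡ i′ ⊎ j ≡ j′)

  -- Functions of products of such pairs that behave like coefficients in the exterior algebra.
  record Grassmann (Ψ : List Triple → Carrier) : Set (c ⊔ ℓ) where
    field
      invariant : Invariant Ψ
      exchange  : ∀ l i j i′ j′ W → Ψ ((l , i , j) ∷ (l , i′ , j′) ∷ W) ≈
        - Ψ ((l , i , j′) ∷ (l , i′ , j) ∷ W)
      share     : ∀ t t′ W → Share t t′ → Ψ (t ∷ t′ ∷ W) ≈ 0#
      loop      : ∀ l i W → Ψ ((l , i , i) ∷ W) ≈ 0#

  module _ {Ψ : List Triple → Carrier} (grass : Grassmann Ψ) where
    open Grassmann grass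

    grassmann-∷ : ∀ t → Grassmann (Ψ ∘ (t ∷_))
    grassmann-∷ t = record
      { invariant = λ p → invariant (prep t p)
      ; exchange  =
        λ l i j i′ j′ W → trans (invariant (move₂ _ _ W)) (trans (exchange l i j i′ j′ (t ∷ W))
                      (-‿cong (invariant (↭-sym (move₂ _ _ W)))))
      ; share     = λ u u′ W s → trans (invariant (move₂ u u′ W)) (share u u′ (t ∷ W) s)
      ; loop      = λ l i W → trans (invariant (↭.swap t _ ↭-refl)) (loop l i (t ∷ W))
      }
      where
      move₂ : ∀ u u′ W → t ∷ u ∷ u′ ∷ W ↭ u ∷ u′ ∷ t ∷ W
      move₂ u u′ W = ↭-trans (↭.swap t u ↭-refl) (prep u (↭.swap t u′ ↭-refl))

  -- The value of Ψ on the product of 1 + t over all t in L.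
  expand : List Triple → (List Triple → Carrier) → Carrier
  expand []      Ψ = Ψ []
  expand (t ∷ L) Ψ = expand L (Ψ ∘ (t ∷_)) + expand L Ψ

  expand-cong : ∀ L {Ψ Ψ′} → (∀ W → Ψ W ≈ Ψ′ W) → expand L Ψ ≈ expand L Ψ′
  expand-cong []      eq = eq []
  expand-cong (t ∷ L) eq = +-cong (expand-cong L (eq ∘ (t ∷_))) (expand-cong L eq)

  expand-zero : ∀ L {Ψ} → (∀ W → Ψ W ≈ 0#) → expand L Ψ ≈ 0#
  expand-zero []      eq = eq []
  expand-zero (t ∷ L) eq =
    trans (+-cong (expand-zero L (eq ∘ (t ∷_))) (expand-zero L eq)) (+-identityˡ 0#)

  expand-neg : ∀ L {Ψ} → expand L (-_ ∘ Ψ) ≈ - expand L Ψ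
  expand-neg []      = refl
  expand-neg (t ∷ L) = trans (+-cong (expand-neg L) (expand-neg L)) (-‿+-comm _ _)

  expand-↭ : ∀ {L L′ Ψ} → Invariant Ψ → L ↭ L′ → expand L Ψ ≈ expand L′ Ψ
  expand-↭ inv ↭.refl = refl
  expand-↭ inv (prep t p) = +-cong (expand-↭ (inv ∘ prep t) p) (expand-↭ inv p)
  expand-↭ inv (↭.trans p q) = trans (expand-↭ inv p) (expand-↭ inv q)
  expand-↭ {u ∷ v ∷ L} {_ ∷ _ ∷ L′} {Ψ} inv (↭.swap u v p) = begin
    (E L (Ψ ∘ (u ∷_) ∘ (v ∷_)) + E L (Ψ ∘ (u ∷_))) + (E L (Ψ ∘ (v ∷_)) + E L Ψ)
      ≈⟨ interchange _ _ _ _ ⟩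
    (E L (Ψ ∘ (u ∷_) ∘ (v ∷_)) + E L (Ψ ∘ (v ∷_))) + (E L (Ψ ∘ (u ∷_)) + E L Ψ)
      ≈⟨ +-cong (+-cong
          (trans (expand-cong L λ W → inv (↭.swap u v ↭-refl)) (expand-↭ (inv ∘ prep v ∘ prep u) p))
          (expand-↭ (inv ∘ prep v) p)) (+-cong (expand-↭ (inv ∘ prep u) p) (expand-↭ inv p)) ⟩
    (E L′ (Ψ ∘ (v ∷_) ∘ (u ∷_)) + E L′ (Ψ ∘ (v ∷_))) + (E L′ (Ψ ∘ (u ∷_)) + E L′ Ψ)   ∎
    where E = expand

  -- Any two pairs in `P` share a vertex and multiply to zero, so the product of `1 + t` over `P` is
  -- 1 plus the sum of `P`.
  expand-block : ∀ P L {Ψ} → Grassmann Ψ → (∀ {t t′} → t ∈ P → t′ ∈ P → Share t t′) →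
                 expand (P ++ L) Ψ ≈ expand L Ψ + ∑ P (λ t → expand L (Ψ ∘ (t ∷_)))
  expand-block []      L grass all = sym (+-identityʳ _)
  expand-block (t ∷ P) L {Ψ} grass all = begin
    expand (P ++ L) (Ψ ∘ (t ∷_)) + expand (P ++ L) Ψ
      ≈⟨ +-cong (expand-block P L (grassmann-∷ grass t) all′) (expand-block P L grass all′) ⟩
    (expand L (Ψ ∘ (t ∷_)) + ∑ P (λ t′ → expand L (Ψ ∘ (t ∷_) ∘ (t′ ∷_)))) +
      (expand L Ψ + ∑ P (λ t′ → expand L (Ψ ∘ (t′ ∷_))))
      ≈⟨ +-congʳ (trans (+-congˡ (∑-zero P λ {t′} t′∈ → expand-zero L λ W →
        Grassmann.share grass t t′ W (all (here ≡.refl) (there t′∈)))) (+-identityʳ _)) ⟩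
    expand L (Ψ ∘ (t ∷_)) + (expand L Ψ + ∑ P (λ t′ → expand L (Ψ ∘ (t′ ∷_))))
      ≈⟨ x∙yz≈y∙xz _ _ _ ⟩
    expand L Ψ + (expand L (Ψ ∘ (t ∷_)) + ∑ P (λ t′ → expand L (Ψ ∘ (t′ ∷_)))) ∎
    where
    all′ : ∀ {t t′} → t ∈ P → t′ ∈ P → Share t t′
    all′ t∈ t′∈ = all (there t∈) (there t′∈)

  lane : Lane → List V → List V → List Triple
  lane l I J = map (l ,_) (cartesianProduct I J)

  lanes : List Lane → List V → List Triple
  lanes ls I = cartesianProduct ls (cartesianProduct I I)

  -- exp (η ζ) = 1 + η ζ for η = Σ η_i and ζ = Σ ζ_j, because (η ζ)² = 0.
  expand-lane : ∀ l I J L {Ψ} → Grassmann Ψ →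
                expand (lane l I J ++ L) Ψ ≈
                  expand L Ψ + ∑ I (λ i → ∑ J (λ j → expand L (Ψ ∘ ((l , i , j) ∷_))))
  expand-lane l []      J L     grass = sym (+-identityʳ _)
  expand-lane l (i ∷ I) J L {Ψ} grass = begin
    expand (lane l (i ∷ I) J ++ L) Ψ
      ≡⟨ ≡.cong (λ z → expand z Ψ) (≡.trans (≡.cong (_++ L) (map-++ (l ,_) (map (i ,_) J) _))
        (++-assoc (map (l ,_) (map (i ,_) J)) _ L)) ⟩
    expand (map (l ,_) (map (i ,_) J) ++ L′) Ψ
      ≈⟨ expand-block (map (l ,_) (map (i ,_) J)) L′ grass share-i ⟩
    expand L′ Ψ + ∑ (map (l ,_) (map (i ,_) J)) (λ t → expand L′ (Ψ ∘ (t ∷_)))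
      ≈⟨ +-congˡ (trans (∑-map (l ,_) (map (i ,_) J)) (∑-map (i ,_) J)) ⟩
    expand L′ Ψ + ∑ J (λ j → expand L′ (Ψ ∘ ((l , i , j) ∷_)))
      ≈⟨ +-cong (expand-lane l I J L grass)
        (∑-cong′ J λ j → expand-lane l I J L (grassmann-∷ grass (l , i , j))) ⟩
    (expand L Ψ + S) + ∑ J (λ j → T j + ∑ I
      (λ i′ → ∑ J (λ j′ → expand L (Ψ ∘ ((l , i , j) ∷_) ∘ ((l , i′ , j′) ∷_)))))
      ≈⟨ +-congˡ (trans (∑-+ J) (trans (+-congˡ (trans (∑-swap J I) (∑-zero′ I cross)))
        (+-identityʳ _))) ⟩
    (expand L Ψ + S) + ∑ J T
      ≈⟨ trans (+-assoc _ _ _) (+-congˡ (+-comm _ _)) ⟩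
    expand L Ψ + (∑ J T + S) ∎
    where
    L′ = lane l I J ++ L
    S  = ∑ I (λ i → ∑ J (λ j → expand L (Ψ ∘ ((l , i , j) ∷_))))
    T  = λ j → expand L (Ψ ∘ ((l , i , j) ∷_))
    share-i : ∀ {t t′} → t ∈ map (l ,_) (map (i ,_) J) → t′ ∈ map (l ,_) (map (i ,_) J) → Share t t′
    share-i t∈ t′∈ with ∈-map⁻ (l ,_) t∈ | ∈-map⁻ (l ,_) t′∈
    ... | u , u∈ , ≡.refl | u′ , u′∈ , ≡.refl with ∈-map⁻ (i ,_) u∈ | ∈-map⁻ (i ,_) u′∈
    ...   | _ , _ , ≡.refl | _ , _ , ≡.refl = inj₁ (inj₁ ≡.refl)
    -- By `exchange` the terms for `(j , j′)` and `(j′ , j)` cancel; this is the square of the odd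
    -- sum `ζ` being zero.
    cross : ∀ i′ → ∑ J (λ j → ∑ J (λ j′ → expand L (Ψ ∘ ((l , i , j) ∷_) ∘ ((l , i′ , j′) ∷_)))) ≈
      0#
    cross i′ = ∑-alternating J _
      (λ j j′ → trans (expand-cong L λ W → Grassmann.exchange grass l i j i′ j′ W) (expand-neg L))
      (λ j → expand-zero L λ W → Grassmann.share grass (l , i , j) (l , i′ , j) W
        (inj₂ (inj₂ ≡.refl)))

  -- Each lane contributes at most one pair to a surviving word, so no word has more pairs than
  -- there are lanes.
  expand-lanes : ∀ ls I {Ψ} → Grassmann Ψ → (∀ W → length W ℕ.≤ length ls → Ψ W ≈ 0#) →
    expand (lanes ls I) Ψ ≈ 0#
  expand-lanes []       I grass small = small [] z≤n
  expand-lanes (l ∷ ls) I grass small = trans (expand-lane l I I (lanes ls I) grass)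
    (trans (+-cong (expand-lanes ls I grass λ W le → small W (ℕ.m≤n⇒m≤1+n le))
      (∑-zero′ I λ i → ∑-zero′ I λ j → expand-lanes ls I (grassmann-∷ grass (l , i , j)) λ W le →
        small _ (s≤s le)))
      (+-identityˡ 0#))

  expand-skip : ∀ P L {Ψ} → (∀ {t} → t ∈ P → ∀ W → Ψ (t ∷ W) ≈ 0#) → expand (P ++ L) Ψ ≈ expand L Ψ
  expand-skip []      L null = refl
  expand-skip (t ∷ P) L null =
    trans (+-cong (expand-zero (P ++ L) (null (here ≡.refl))) (expand-skip P L (null ∘ there)))
      (+-identityˡ _)

  -- The dependence on the commuting variables y_{l,i} and z_{l,j} alone: only the multisets of the
  -- (l , i) and of the (l , j) matter.
  record Admissible (χ : List Triple → Carrier) : Set (c ⊔ ℓ) where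
    field
      invariant : Invariant χ
      exchange  : ∀ l i j i′ j′ W → χ ((l , i , j) ∷ (l , i′ , j′) ∷ W) ≈
        χ ((l , i , j′) ∷ (l , i′ , j) ∷ W)

  admissible-∷ : ∀ {χ} → Admissible χ → ∀ t → Admissible (χ ∘ (t ∷_))
  admissible-∷ adm t = record
    { invariant = λ p → invariant (prep t p)
    ; exchange  =
      λ l i j i′ j′ W → trans (invariant (move₂ _ _ W)) (trans (exchange l i j i′ j′ (t ∷ W))
                    (invariant (↭-sym (move₂ _ _ W))))
    }
    where
    open Admissible adm
    move₂ : ∀ u u′ W → t ∷ u ∷ u′ ∷ W ↭ u ∷ u′ ∷ t ∷ W
    move₂ u u′ W = ↭-trans (↭.swap t u ↭-refl) (prep u (↭.swap t u′ ↭-refl))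

  -- Exchanging the right vertices of two pairs in one lane fixes the commuting part `χ` and flips
  -- the sign of the alternating part `κ`.
  admissible⇒grassmann : ∀ {χ κ} → Admissible χ → Alternating κ →
    Grassmann (λ W → χ W * κ (vertices W))
  admissible⇒grassmann {χ} {κ} adm alt = record
    { invariant = λ p → *-cong (invariant p) (alt-vertices alt p)
    ; exchange  =
      λ l i j i′ j′ W → trans (*-cong (exchange l i j i′ j′ W) (alt-exchange alt i j i′ j′ _))
        (sym (-‿distribʳ-* _ _))
    ; share     = λ t t′ W s → trans (*-congˡ (shared t t′ W s)) (zeroʳ _)
    ; loop      = λ l i W → trans (*-congˡ (Alternating.same alt [] i _)) (zeroʳ _)
    }
    where
    open Admissible adm
    shared : ∀ t t′ W → Share t t′ → κ (vertices (t ∷ t′ ∷ W)) ≈ 0#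
    shared (_ , i , j) (_ , i′ , j′) W (inj₂ s) = alt-dup₁₃ (alternating-∷ alt i) j i′ j′ _ s
    shared (_ , i , j) (_ , i′ , j′) W (inj₁ s) = trans (Alternating.anti alt [] i j _)
      (trans (-‿cong (alt-dup₁₃ (alternating-∷ alt j) i i′ j′ _ s)) -0#≈0#)

unique-++⁻ʳ : ∀ {a} {A : Set a} p {w : List A} → Unique (p ++ w) → Unique w
unique-++⁻ʳ []      u       = u
unique-++⁻ʳ (x ∷ p) (_ ∷ u) = unique-++⁻ʳ p u

-- The substitution by `k` decomposable forms and the vanishing of Pfaffians.

module Substitution (em : ∀ {ℓ} → ExcludedMiddle ℓ) {c ℓ} (R : CommutativeRing c ℓ) (k n : ℕ) where
  open CommutativeRing R hiding (zero)
  open import Relation.Binary.Reasoning.Setoid setoid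
  open Sums R
  open Polynomials R {n}
  open Exterior R {Fin k} {Fin n} public

  ⟦_⟧ : Sign → Carrier
  ⟦ Sign.+ ⟧ = 1#
  ⟦ Sign.- ⟧ = - 1#

  ⟦opposite⟧ : ∀ s → ⟦ opposite s ⟧ ≈ - ⟦ s ⟧
  ⟦opposite⟧ Sign.+ = refl
  ⟦opposite⟧ Sign.- = sym (-‿involutive 1#)

  open Exp semiring using (_^_)

  ⟦parity⟧ : ∀ m → ⟦ parity m ⟧ ≈ (- 1#) ^ m
  ⟦parity⟧ ℕ.zero    = refl
  ⟦parity⟧ (ℕ.suc m) =
    trans (⟦opposite⟧ (parity m)) (trans (-‿cong (trans (⟦parity⟧ m) (sym (*-identityˡ _))))
      (-‿distribˡ-* 1# _))

  -- The coefficient of the product of the odd variables indexed by `U`, taken in increasing order.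
  signature : Subset n → List (Fin n) → Carrier
  signature U w with em {0ℓ} {w ↭ elements U}
  ... | yes _ = ⟦ sgn w ⟧
  ... | no  _ = 0#

  signature-yes : ∀ {U w} → w ↭ elements U → signature U w ≈ ⟦ sgn w ⟧
  signature-yes {U} {w} p with em {0ℓ} {w ↭ elements U}
  ... | yes _ = refl
  ... | no ¬p = contradiction p ¬p

  signature-no : ∀ {U w} → ¬ (w ↭ elements U) → signature U w ≈ 0#
  signature-no {U} {w} ¬p with em {0ℓ} {w ↭ elements U}
  ... | yes p = contradiction p ¬p
  ... | no _  = refl

  signature-alternating : ∀ U → Alternating (signature U)
  signature-alternating U = record { anti = anti ; same = same }
    where
    unique : ∀ {w} → w ↭ elements U → Unique w
    unique p = unique-resp-↭ (↭-sym p) (elements-unique U)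
    transpose : ∀ p (a b : Fin n) w → p ++ b ∷ a ∷ w ↭ p ++ a ∷ b ∷ w
    transpose p a b w = ++⁺ˡ p (↭.swap b a ↭-refl)
    anti : ∀ p a b w → signature U (p ++ a ∷ b ∷ w) ≈ - signature U (p ++ b ∷ a ∷ w)
    anti p a b w with em {0ℓ} {p ++ a ∷ b ∷ w ↭ elements U}
    ... | yes q with unique-++⁻ʳ p (unique q)
    ...   | (a≢b ∷ _) ∷ _ = begin
      ⟦ sgn (p ++ a ∷ b ∷ w) ⟧              ≡⟨ ≡.cong ⟦_⟧ (sgn-swap p w a≢b) ⟩
      ⟦ opposite (sgn (p ++ b ∷ a ∷ w)) ⟧   ≈⟨ ⟦opposite⟧ (sgn (p ++ b ∷ a ∷ w)) ⟩
      - ⟦ sgn (p ++ b ∷ a ∷ w) ⟧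
        ≈⟨ -‿cong (signature-yes (↭-trans (transpose p a b w) q)) ⟨
      - signature U (p ++ b ∷ a ∷ w)        ∎
    anti p a b w | no ¬q =
      sym (trans (-‿cong (signature-no λ q → ¬q (↭-trans (transpose p b a w) q))) -0#≈0#)
    same : ∀ p a w → signature U (p ++ a ∷ a ∷ w) ≈ 0#
    same p a w = signature-no λ q → absurd (unique-++⁻ʳ p (unique q))
      where
      absurd : ¬ Unique (a ∷ a ∷ w)
      absurd ((a≢a ∷ _) ∷ _) = a≢a ≡.refl

  labels : Edge n → List (Carrier × Triple)
  labels e = map (λ l → 1# , (l , lo e , hi e)) (allFin k) ++ map (λ l → - 1# , (l , hi e , lo e))
    (allFin k)

  -- Φ χ m is the value of χ on the image of m under x_e ↦ Σ_l (y_{l,lo} z_{l,hi} − y_{l,hi} z_{l,lo}).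
  Φ : (List Triple → Carrier) → Monomial n → Carrier
  Φ χ []      = χ []
  Φ χ (e ∷ m) = lin (labels e) λ t → Φ (χ ∘ (t ∷_)) m

  Φ-cong : ∀ m {χ χ′} → (∀ W → χ W ≈ χ′ W) → Φ χ m ≈ Φ χ′ m
  Φ-cong []      eq = eq []
  Φ-cong (e ∷ m) eq = lin-cong (labels e) λ t → Φ-cong m (eq ∘ (t ∷_))

  Φ-invariant : ∀ {χ} → Invariant χ → Invariant (Φ χ)
  Φ-invariant inv ↭.refl         = refl
  Φ-invariant inv (prep e p)     = lin-cong (labels e) λ t → Φ-invariant (inv ∘ prep t) p
  Φ-invariant inv (↭.trans p q)  = trans (Φ-invariant inv p) (Φ-invariant inv q)
  Φ-invariant {χ} inv {_} {_ ∷ _ ∷ m′} (↭.swap e f p) = trans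
    (lin-cong (labels e) λ t → lin-cong (labels f) λ u →
      trans (Φ-invariant (inv ∘ prep t ∘ prep u) p) (Φ-cong m′ λ W → inv (↭.swap t u ↭-refl)))
    (lin-∑ (labels e) (labels f) proj₁ (λ (_ , u) t → Φ (λ W → χ (u ∷ t ∷ W)) m′))

  -- Membership in the kernel of the substitution, tested by all functionals that see only the
  -- multisets of the variables `y` and of the variables `z`.
  Kills : Poly R n → Set _
  Kills f = ∀ {χ} → Admissible χ → lin f (Φ χ) ≈ 0#

  kills-++ : ∀ {f} → Kills f → ∀ s {χ} → Admissible χ → lin f (λ t → Φ χ (s ++ t)) ≈ 0#
  kills-++ kills []      adm = kills adm
  kills-++ {f} kills (e ∷ s) {χ} adm =
    trans (lin-∑ f (labels e) proj₁ (λ (_ , t) m → Φ (χ ∘ (t ∷_)) (s ++ m)))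
    (∑-zero′ (labels e) λ (a , t) → trans (*-congˡ (kills-++ {f} kills s (admissible-∷ adm t)))
      (zeroʳ a))

  triples : Edge n → List Triple
  triples e = map proj₂ (labels e)

  ∈-triples⁻ : ∀ {e l i j} → (l , i , j) ∈ triples e → (i ≡ lo e × j ≡ hi e) ⊎ (i ≡ hi e × j ≡ lo e)
  ∈-triples⁻ {e} t∈ with ∈-map⁻ proj₂ t∈
  ... | _ , p∈ , ≡.refl with ∈-++⁻ (map (λ l → 1# , (l , lo e , hi e)) (allFin k)) p∈
  ...   | inj₁ q with ∈-map⁻ (λ l → 1# , (l , lo e , hi e)) q
  ...     | _ , _ , ≡.refl = inj₁ (≡.refl , ≡.refl)
  ∈-triples⁻ {e} t∈ | _ , p∈ , ≡.refl | inj₂ q with ∈-map⁻ (λ l → - 1# , (l , hi e , lo e)) q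
  ...     | _ , _ , ≡.refl = inj₂ (≡.refl , ≡.refl)

  ∈-triples⁺ : ∀ e l → (l , lo e , hi e) ∈ triples e × (l , hi e , lo e) ∈ triples e
  ∈-triples⁺ e l =
    ∈-map⁺ proj₂ (∈-++⁺ˡ (∈-map⁺ _ (∈-allFin l))) , ∈-map⁺ proj₂ (∈-++⁺ʳ _ (∈-map⁺ _ (∈-allFin l)))

  triples-share : ∀ {e t t′} → t ∈ triples e → t′ ∈ triples e → Share t t′
  triples-share {e} t∈ t′∈ with ∈-triples⁻ {e} t∈ | ∈-triples⁻ {e} t′∈
  ... | inj₁ (≡.refl , ≡.refl) | inj₁ (≡.refl , ≡.refl) = inj₁ (inj₁ ≡.refl)
  ... | inj₁ (≡.refl , ≡.refl) | inj₂ (≡.refl , ≡.refl) = inj₁ (inj₂ ≡.refl)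
  ... | inj₂ (≡.refl , ≡.refl) | inj₁ (≡.refl , ≡.refl) = inj₁ (inj₂ ≡.refl)
  ... | inj₂ (≡.refl , ≡.refl) | inj₂ (≡.refl , ≡.refl) = inj₁ (inj₁ ≡.refl)

  -- `Φ` with the signs of the labels removed. An alternating function of the vertices restores
  -- them, since a reversed label swaps two adjacent letters.
  unsigned : (List Triple → Carrier) → Monomial n → Carrier
  unsigned Ψ []      = Ψ []
  unsigned Ψ (e ∷ m) = ∑ (triples e) λ t → unsigned (Ψ ∘ (t ∷_)) m

  unsigned-Φ : ∀ m {χ κ} → Alternating κ → unsigned (λ W → χ W * κ (vertices W)) m ≈
    Φ χ m * κ (word m)
  unsigned-Φ []      alt = refl
  unsigned-Φ (e ∷ m) {χ} {κ} alt = begin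
    ∑ (triples e) (λ t → unsigned (λ W → χ (t ∷ W) * κ (vertices (t ∷ W))) m)
      ≈⟨ ∑-map proj₂ (labels e) ⟩
    ∑ (labels e) (λ (_ , t) → unsigned (λ W → χ (t ∷ W) * κ (vertices (t ∷ W))) m)
      ≈⟨ ∑-cong (labels e) label ⟩
    ∑ (labels e) (λ (a , t) → (a * Φ (χ ∘ (t ∷_)) m) * κ (word (e ∷ m)))
      ≈⟨ ∑-*ʳ (labels e) _ ⟨
    Φ χ (e ∷ m) * κ (word (e ∷ m)) ∎
    where
    label : ∀ {p} → p ∈ labels e → unsigned (λ W → χ (proj₂ p ∷ W) * κ (vertices (proj₂ p ∷ W))) m ≈
            (proj₁ p * Φ (χ ∘ (proj₂ p ∷_)) m) * κ (word (e ∷ m))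
    label {a , (l , i , j)} p∈ with ∈-++⁻ (map (λ l → 1# , (l , lo e , hi e)) (allFin k)) p∈
    ... | inj₁ q with ∈-map⁻ (λ l → 1# , (l , lo e , hi e)) q
    ...   | _ , _ , ≡.refl =
      trans (unsigned-Φ m (alternating-∷ (alternating-∷ alt (lo e)) (hi e)))
        (*-congʳ (sym (*-identityˡ _)))
    label {a , (l , i , j)} p∈ | inj₂ q with ∈-map⁻ (λ l → - 1# , (l , hi e , lo e)) q
    ...   | _ , _ , ≡.refl = begin
      unsigned (λ W → χ (t ∷ W) * κ (hi e ∷ lo e ∷ vertices W)) m
        ≈⟨ unsigned-Φ m (alternating-∷ (alternating-∷ alt (hi e)) (lo e)) ⟩
      φ * κ (hi e ∷ lo e ∷ word m)
        ≈⟨ *-congˡ (Alternating.anti alt [] (hi e) (lo e) (word m)) ⟩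
      φ * - κ (lo e ∷ hi e ∷ word m)       ≈⟨ -‿distribʳ-* _ _ ⟨
      - (φ * κ (lo e ∷ hi e ∷ word m))     ≈⟨ -‿distribˡ-* _ _ ⟩
      - φ * κ (lo e ∷ hi e ∷ word m)       ≈⟨ *-congʳ (-‿cong (sym (*-identityˡ φ))) ⟩
      - (1# * φ) * κ (lo e ∷ hi e ∷ word m) ≈⟨ *-congʳ (-‿distribˡ-* 1# φ) ⟩
      (- 1# * φ) * κ (lo e ∷ hi e ∷ word m) ∎
      where
      t = (l , hi e , lo e)
      φ = Φ (χ ∘ (t ∷_)) m

  -- The sum over all sets of edges is the product of the factors `1 + x_e`. Each factor splits
  -- further into factors `1 + t` over the triples of `e`, because these triples share vertices.
  unsigned-expand : ∀ es {Ψ} → Grassmann Ψ → ∑ (sublists es) (unsigned Ψ) ≈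
    expand (concatMap triples es) Ψ
  unsigned-expand []       grass = +-identityʳ _
  unsigned-expand (e ∷ es) {Ψ} grass = begin
    ∑ (map (e ∷_) (sublists es) ++ sublists es) (unsigned Ψ)
      ≈⟨ ∑-++ (map (e ∷_) (sublists es)) (sublists es) ⟩
    ∑ (map (e ∷_) (sublists es)) (unsigned Ψ) + ∑ (sublists es) (unsigned Ψ)
      ≈⟨ +-cong (∑-map (e ∷_) (sublists es)) (unsigned-expand es grass) ⟩
    ∑ (sublists es) (λ E → ∑ (triples e) (λ t → unsigned (Ψ ∘ (t ∷_)) E)) + expand L Ψ
      ≈⟨ +-congʳ (trans (∑-swap (sublists es) (triples e))
        (∑-cong′ (triples e) λ t → unsigned-expand es (grassmann-∷ grass t))) ⟩
    ∑ (triples e) (λ t → expand L (Ψ ∘ (t ∷_))) + expand L Ψ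
      ≈⟨ +-comm _ _ ⟩
    expand L Ψ + ∑ (triples e) (λ t → expand L (Ψ ∘ (t ∷_)))
      ≈⟨ expand-block (triples e) L grass (triples-share {e}) ⟨
    expand (triples e ++ L) Ψ ∎
    where L = concatMap triples es

  -- The pairs that belong to no edge. They contribute nothing to an alternating function and
  -- complete each lane to a full product of an `η` and a `ζ`.
  loops : List Triple
  loops = map (λ (l , i) → l , i , i) (cartesianProduct (allFin k) (allFin n))

  private
    triples-unique : ∀ e → Unique (triples e)
    triples-unique e = ≡.subst Unique (≡.sym split)
      (Unique.++⁺ (Unique.map⁺ (≡.cong proj₁) (Unique.allFin⁺ k))
        (Unique.map⁺ (≡.cong proj₁) (Unique.allFin⁺ k)) disjoint)
      where
      open import Data.List.Properties using (map-++; map-∘)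
      split : triples e ≡ map (λ l → l , lo e , hi e) (allFin k) ++ map (λ l → l , hi e , lo e)
        (allFin k)
      split = ≡.trans (map-++ proj₂ (map (λ l → 1# , (l , lo e , hi e)) (allFin k)) _)
                (≡.sym (≡.cong₂ _++_ (map-∘ (allFin k)) (map-∘ (allFin k))))
      disjoint : Disjoint (map (λ l → l , lo e , hi e) (allFin k))
        (map (λ l → l , hi e , lo e) (allFin k))
      disjoint (p , q) with ∈-map⁻ (λ l → l , lo e , hi e) p | ∈-map⁻ (λ l → l , hi e , lo e) q
      ... | _ , _ , ≡.refl | _ , _ , eq =
        contradiction (≡.cong (toℕ ∘ proj₁ ∘ proj₂) eq) (ℕ.<⇒≢ (lo<hi e))

    triples-disjoint : ∀ {e f} → e ≢ f → Disjoint (triples e) (triples f)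
    triples-disjoint {e} {f} e≢f (p , q) with ∈-triples⁻ {e} p | ∈-triples⁻ {f} q
    ... | inj₁ (≡.refl , ≡.refl) | inj₁ (l , h) = e≢f (edge-≡ l h)
    ... | inj₂ (≡.refl , ≡.refl) | inj₂ (h , l) = e≢f (edge-≡ l h)
    ... | inj₁ (≡.refl , ≡.refl) | inj₂ (h , l) =
      ℕ.<-asym (≡.subst₂ ℕ._<_ (≡.cong toℕ h) (≡.cong toℕ l) (lo<hi e)) (lo<hi f)
    ... | inj₂ (≡.refl , ≡.refl) | inj₁ (h , l) =
      ℕ.<-asym (≡.subst₂ ℕ._<_ (≡.cong toℕ l) (≡.cong toℕ h) (lo<hi e)) (lo<hi f)

  all-triples : loops ++ concatMap triples (edges n) ↭ lanes (allFin k) (allFin n)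
  all-triples = unique-same⇒↭ unique (Unique.cartesianProduct⁺ (Unique.allFin⁺ k)
    (Unique.cartesianProduct⁺ (Unique.allFin⁺ n) (Unique.allFin⁺ n)))
    (λ {(l , i , j)} _ → ∈-cartesianProduct⁺ (∈-allFin l)
      (∈-cartesianProduct⁺ (∈-allFin i) (∈-allFin j))) (λ {t} _ → member t)
    where
    unique : Unique (loops ++ concatMap triples (edges n))
    unique = Unique.++⁺
      (Unique.map⁺ (λ eq → ≡.cong₂ _,_ (≡.cong proj₁ eq) (≡.cong (proj₁ ∘ proj₂) eq))
        (Unique.cartesianProduct⁺ (Unique.allFin⁺ k) (Unique.allFin⁺ n)))
      (Unique.concat⁺ (All.map⁺ (All.universal triples-unique (edges n)))
                      (AllPairs.map⁺ (AllPairs.map (λ {e} {f} → triples-disjoint {e} {f})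
                        edges-unique)))
      disjoint
      where
      disjoint : Disjoint loops (concatMap triples (edges n))
      disjoint (p , q) with ∈-map⁻ (λ (l , i) → l , i , i) p | Any.satisfied
        (∈-concatMap⁻ triples {xs = edges n} q)
      ... | _ , _ , ≡.refl | e , t∈ with ∈-triples⁻ {e} t∈
      ...   | inj₁ (l , h) = contradiction (≡.cong toℕ (≡.trans (≡.sym l) h)) (ℕ.<⇒≢ (lo<hi e))
      ...   | inj₂ (h , l) = contradiction (≡.cong toℕ (≡.trans (≡.sym l) h)) (ℕ.<⇒≢ (lo<hi e))
    member : ∀ t → t ∈ loops ++ concatMap triples (edges n)
    member (l , i , j) with Fin.<-cmp i j
    ... | tri< i<j _ _ = ∈-++⁺ʳ loops (∈-concatMap⁺ triples
      (Any.map (λ { ≡.refl → proj₁ (∈-triples⁺ (edge i<j) l) }) (∈-edges (edge i<j))))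
    ... | tri≈ _ ≡.refl _ = ∈-++⁺ˡ (∈-map⁺ _ (∈-cartesianProduct⁺ (∈-allFin l) (∈-allFin i)))
    ... | tri> _ _ j<i = ∈-++⁺ʳ loops (∈-concatMap⁺ triples
      (Any.map (λ { ≡.refl → proj₂ (∈-triples⁺ (edge j<i) l) }) (∈-edges (edge j<i))))

  -- The signed sum over matchings is the `U`-coefficient of the product of `1 + t` over all
  -- triples. This coefficient needs `k + 1` pairs, while `k` lanes supply at most `k`.
  pfaffian-killed : ∀ U → ∣ U ∣ ≡ 2 ℕ.* (k ℕ.+ 1) → Kills (pfaffian R U)
  pfaffian-killed U size {χ} adm = begin
    lin (pfaffian R U) (Φ χ)
      ≈⟨ ∑-map _ (perfectMatchings U) ⟩
    ∑ (perfectMatchings U) (λ E → (- 1#) ^ cr E * Φ χ E)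
      ≈⟨ ∑-cong (perfectMatchings U) matching ⟩
    ∑ (perfectMatchings U) (unsigned Ψ)
      ≈⟨ ∑-filter (isPerfectMatching? U) (sublists (edges n)) nonmatching ⟩
    ∑ (sublists (edges n)) (unsigned Ψ)
      ≈⟨ unsigned-expand (edges n) grass ⟩
    expand (concatMap triples (edges n)) Ψ                            ≈⟨ expand-skip loops _ loop ⟨
    expand (loops ++ concatMap triples (edges n)) Ψ
      ≈⟨ expand-↭ (Grassmann.invariant grass) all-triples ⟩
    expand (lanes (allFin k) (allFin n)) Ψ
      ≈⟨ expand-lanes (allFin k) (allFin n) grass small ⟩
    0#                                                                ∎
    where
    alt = signature-alternating U
    Ψ : List Triple → Carrier
    Ψ W = χ W * signature U (vertices W)
    grass : Grassmann Ψ
    grass = admissible⇒grassmann adm alt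
    matching : ∀ {E} → E ∈ perfectMatchings U → (- 1#) ^ cr E * Φ χ E ≈ unsigned Ψ E
    matching {E} E∈ = begin
      (- 1#) ^ cr E * Φ χ E            ≈⟨ *-comm _ _ ⟩
      Φ χ E * (- 1#) ^ cr E            ≈⟨ *-congˡ (⟦parity⟧ (cr E)) ⟨
      Φ χ E * ⟦ parity (cr E) ⟧        ≡⟨ ≡.cong (λ s → Φ χ E * ⟦ s ⟧)
        (sgn-word E (unique-resp-↭ (↭-sym p) (elements-unique U))) ⟨
      Φ χ E * ⟦ sgn (word E) ⟧         ≈⟨ *-congˡ (signature-yes p) ⟨
      Φ χ E * signature U (word E)     ≈⟨ unsigned-Φ E alt ⟨
      unsigned Ψ E                     ∎
      where p = matching⇒↭ U E (proj₂ (∈-filter⁻ (isPerfectMatching? U) {xs = sublists (edges n)} E∈))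
    nonmatching : ∀ {E} → ¬ IsPerfectMatching U E → unsigned Ψ E ≈ 0#
    nonmatching {E} ¬m =
      trans (unsigned-Φ E alt) (trans (*-congˡ (signature-no (¬m ∘ ↭⇒matching U E))) (zeroʳ _))
    loop : ∀ {t} → t ∈ loops → ∀ W → Ψ (t ∷ W) ≈ 0#
    loop t∈ W with ∈-map⁻ (λ (l , i) → l , i , i) t∈
    ... | (l , i) , _ , ≡.refl = Grassmann.loop grass l i W
    small : ∀ W → length W ℕ.≤ length (allFin k) → Ψ W ≈ 0#
    small W le = trans (*-congˡ (signature-no λ p → ℕ.<-irrefl
      (ℕ.*-cancelˡ-≡ (length W) (k ℕ.+ 1) 2
        (≡.trans (≡.sym (length-vertices W))
          (≡.trans (↭-length p) (≡.trans (length-elements U) size))))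
      (≡.subst (length W ℕ.<_) (ℕ.+-comm 1 k)
        (s≤s (≡.subst (length W ℕ.≤_) (length-tabulate (λ i → i)) le))))) (zeroʳ _)

  ideal-killed : ∀ {f} → PfaffianIdeal R k f → Kills f
  ideal-killed (gen {f} (U , size , eq)) adm =
    trans (≈ₚ⇒lin f (pfaffian R U) eq (Φ-invariant (Admissible.invariant adm)))
      (pfaffian-killed U size adm)
  ideal-killed zero adm = refl
  ideal-killed (add {f} {g} f∈ g∈) adm =
    trans (∑-++ f g) (trans (+-cong (ideal-killed f∈ adm) (ideal-killed g∈ adm)) (+-identityˡ 0#))
  ideal-killed (mult {f} g f∈) {χ} adm = trans (lin-*ₚ g f (Φ χ))
    (∑-zero′ g λ (a , s) → trans (*-congˡ (kills-++ {f} (ideal-killed f∈) s adm)) (zeroʳ a))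
  ideal-killed (resp {f} {g} eq f∈) adm =
    trans (sym (≈ₚ⇒lin f g eq (Φ-invariant (Admissible.invariant adm)))) (ideal-killed f∈ adm)

-- The rearrangement inequality, lane by lane.
module Rearrangement {k n : ℕ} where
  private
    Triple : Set
    Triple = Fin k × Fin n × Fin n

  left right : Triple → Fin k × Fin n
  left  (l , i , j) = l , i
  right (l , i , j) = l , j

  total : List Triple → ℕ
  total []                = 0
  total ((l , i , j) ∷ T) = toℕ i ℕ.* toℕ j ℕ.+ total T

  total-↭ : ∀ {T T′} → T ↭ T′ → total T ≡ total T′
  total-↭ ↭.refl         = ≡.refl
  total-↭ (prep t p)     = ≡.cong (_ ℕ.+_) (total-↭ p)
  total-↭ (↭.swap (_ , i , j) (_ , i′ , j′) p) =
    ≡.trans (≡.cong (λ z → toℕ i ℕ.* toℕ j ℕ.+ (toℕ i′ ℕ.* toℕ j′ ℕ.+ z)) (total-↭ p))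
      (x∙yz≈y∙xz (toℕ i ℕ.* toℕ j) (toℕ i′ ℕ.* toℕ j′) _)
    where open import Algebra.Properties.CommutativeSemigroup ℕ.+-commutativeSemigroup using (x∙yz≈y∙xz)
  total-↭ (↭.trans p q)  = ≡.trans (total-↭ p) (total-↭ q)

  -- In a list ordered this way both vertices weakly decrease along every lane, which is the pairing
  -- that maximises `total`.
  Dominates : Triple → Triple → Set
  Dominates (l , i , j) (l′ , i′ , j′) = l ≡ l′ → i′ Fin.≤ i × j′ Fin.≤ j

  private
    exchange-< : ∀ {a b c d} → a ℕ.< b → c ℕ.< d → b ℕ.* c ℕ.+ a ℕ.* d ℕ.< b ℕ.* d ℕ.+ a ℕ.* c
    exchange-< {a} {b} {c} {d} a<b c<d with ℕ.m≤n⇒∃[o]m+o≡n a<b | ℕ.m≤n⇒∃[o]m+o≡n c<d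
    ... | p , ≡.refl | q , ≡.refl = ≡.subst₂ ℕ._<_ ≡.refl (rearrange a c p q)
      (ℕ.m<m+n (ℕ.suc (a ℕ.+ p) ℕ.* c ℕ.+ a ℕ.* ℕ.suc (c ℕ.+ q)) {ℕ.suc p ℕ.* ℕ.suc q} (s≤s z≤n))
      where
      rearrange : ∀ a c p q → ℕ.suc (a ℕ.+ p) ℕ.* c ℕ.+ a ℕ.* ℕ.suc (c ℕ.+ q) ℕ.+ ℕ.suc p ℕ.* ℕ.suc
        q
                            ≡ ℕ.suc (a ℕ.+ p) ℕ.* ℕ.suc (c ℕ.+ q) ℕ.+ a ℕ.* c
      rearrange = solve-∀

  private
    cancel-common : ∀ {p P T} → p ∈ T → map left T ↭ map left (p ∷ P) → map right T ↭
      map right (p ∷ P) →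
                    (∀ T₁ → map left T₁ ↭ map left P → map right T₁ ↭ map right P → T₁ ↭ P ⊎
                      total T₁ ℕ.< total P) →
                    T ↭ p ∷ P ⊎ total T ℕ.< total (p ∷ P)
    cancel-common {p@(l , i , j)} {P} p∈ ls rs rec = let (T₁ , T↭) = ∈⇒↭∷ p∈ in
      Sum.map (λ q → ↭-trans T↭ (prep p q))
              (λ lt → ≡.subst (ℕ._< total (p ∷ P)) (≡.sym (total-↭ T↭))
                (ℕ.+-monoʳ-< (toℕ i ℕ.* toℕ j) lt))
              (rec T₁ (drop-∷ (↭-trans (↭-sym (map⁺ left T↭)) ls))
                (drop-∷ (↭-trans (↭-sym (map⁺ right T↭)) rs)))

  -- The first pair `(i , j)` of `P` has the largest left and the largest right vertex of its lane.
  -- If `T` does not contain it, `T` pairs `i` with some `j₁ < j` and `j` with some `i₂ < i`;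
  -- exchanging these raises `total` strictly, and the induction applies to what remains after
  -- removing `(i , j)`.
  rearrange : ∀ P T → AllPairs Dominates P → map left T ↭ map left P → map right T ↭ map right P →
              T ↭ P ⊎ total T ℕ.< total P
  rearrange [] [] _ _ _ = inj₁ ↭-refl
  rearrange [] (t ∷ T) _ ls _ = contradiction ls ¬x∷xs↭[]
  rearrange (p@(l , i , j) ∷ P) T (dom ∷ sorted) ls rs
    with ∈-map⁻ left (∈-resp-↭ (↭-sym ls) (here ≡.refl)) | ∈-map⁻ right
      (∈-resp-↭ (↭-sym rs) (here ≡.refl))
  ... | (.l , .i , j₁) , t₁∈ , ≡.refl | (.l , i₂ , .j) , t₂∈ , ≡.refl with j₁ Fin.≟ j | i₂ Fin.≟ i
  ...   | yes ≡.refl | _ = cancel-common t₁∈ ls rs λ T₁ → rearrange P T₁ sorted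
  ...   | no _ | yes ≡.refl = cancel-common t₂∈ ls rs λ T₁ → rearrange P T₁ sorted
  ...   | no j₁≢j | no i₂≢i with ∈⇒↭∷ t₁∈
  ...     | T₁ , T↭ with ∈-resp-↭ T↭ t₂∈
  ...       | here eq = contradiction (≡.sym (≡.cong (proj₂ ∘ proj₂) eq)) j₁≢j
  ...       | there t₂∈T₁ with ∈⇒↭∷ t₂∈T₁
  ...         | T₂ , T₁↭ = inj₂ (ℕ.<-≤-trans strict (ℕ.+-monoʳ-≤ (toℕ i ℕ.* toℕ j) le))
    where
    T↭₂ : T ↭ (l , i , j₁) ∷ (l , i₂ , j) ∷ T₂
    T↭₂ = ↭-trans T↭ (prep _ T₁↭)
    T′ = (l , i₂ , j₁) ∷ T₂
    ls′ : map left T′ ↭ map left P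
    ls′ = drop-∷ (↭-trans (↭-sym (map⁺ left T↭₂)) ls)
    rs′ : map right T′ ↭ map right P
    rs′ = drop-∷ (↭-trans (↭.swap (l , j) (l , j₁) ↭-refl) (↭-trans (↭-sym (map⁺ right T↭₂)) rs))
    le : total T′ ℕ.≤ total P
    le = case (rearrange P T′ sorted ls′ rs′)
      where
      case : T′ ↭ P ⊎ total T′ ℕ.< total P → total T′ ℕ.≤ total P
      case (inj₁ q)  = ℕ.≤-reflexive (total-↭ q)
      case (inj₂ lt) = ℕ.<⇒≤ lt
    j₁<j : toℕ j₁ ℕ.< toℕ j
    j₁<j with ∈-map⁻ right (∈-resp-↭ rs′ (here ≡.refl))
    ... | u , u∈ , eq = ℕ.≤∧≢⇒< (≡.subst (λ z → toℕ z ℕ.≤ toℕ j) (≡.sym (≡.cong proj₂ eq))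
      (proj₂ (All.lookup dom u∈ (≡.cong proj₁ eq)))) (j₁≢j ∘ Fin.toℕ-injective)
    i₂<i : toℕ i₂ ℕ.< toℕ i
    i₂<i with ∈-map⁻ left (∈-resp-↭ ls′ (here ≡.refl))
    ... | u , u∈ , eq = ℕ.≤∧≢⇒< (≡.subst (λ z → toℕ z ℕ.≤ toℕ i) (≡.sym (≡.cong proj₂ eq))
      (proj₁ (All.lookup dom u∈ (≡.cong proj₁ eq)))) (i₂≢i ∘ Fin.toℕ-injective)
    strict : total T ℕ.< toℕ i ℕ.* toℕ j ℕ.+ total T′
    strict = ≡.subst₂ ℕ._<_ (≡.trans (ℕ.+-assoc (toℕ i ℕ.* toℕ j₁) _ _) (≡.sym (total-↭ T↭₂)))
      (ℕ.+-assoc (toℕ i ℕ.* toℕ j) _ _)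
      (ℕ.+-monoˡ-< (total T₂) (exchange-< i₂<i j₁<j))

-- Lanes without nestings.

module _ {n : ℕ} where

  encloses? : ∀ (e f : Edge n) → Dec (Encloses e f)
  encloses? e f = (lo e Fin.<? lo f) ×-dec (hi f Fin.<? hi e)

  encloses-trans : ∀ {e f g : Edge n} → Encloses e f → Encloses f g → Encloses e g
  encloses-trans (l , h) (l′ , h′) = ℕ.<-trans l l′ , ℕ.<-trans h′ h

  -- The greedy colouring of Mirsky's theorem: edges enclosed by nothing receive colour 0, and the
  -- others form a monomial with shorter nestings, since each nesting among them extends outwards by
  -- an enclosing edge.
  colouring : ∀ k (m : Monomial n) → NestingFree k m →
              ∃ λ (h : Edge n → ℕ) → (∀ {e} → e ∈ m → h e ℕ.< k) ×
                (∀ {e f} → e ∈ m → f ∈ m → Encloses e f → h e ≢ h f)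
  colouring ℕ.zero    m free =
    (λ _ → 0) , (λ e∈ → contradiction e∈ (none e∈)) , λ e∈ → contradiction e∈ (none e∈)
    where
    none : ∀ {e} → e ∈ m → ¬ (e ∈ m)
    none {e} e∈ _ = free (e ∷ []) ≡.refl ([] ∷ []) (e∈ ∷ [])
  colouring (ℕ.suc k) m free = h , h< , h≢
    where
    enclosed? : ∀ f → Dec (Any (λ e → Encloses e f) m)
    enclosed? f = Any.any? (λ e → encloses? e f) m
    m₁ = filter enclosed? m
    free₁ : NestingFree k m₁
    free₁ (f ∷ C) len pairs@(pf ∷ _) C∈@(f∈ ∷ _) with find (proj₂ (∈-filter⁻ enclosed? {xs = m} f∈))
    ... | e , e∈ , enc = free (e ∷ f ∷ C) (≡.cong ℕ.suc len)
            ((enc ∷ All.map (λ {g} → encloses-trans {e} {f} {g} enc) pf) ∷ pairs)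
            (e∈ ∷ All.map (λ g∈ → proj₁ (∈-filter⁻ enclosed? {xs = m} g∈)) C∈)
    rec = colouring k m₁ free₁
    h₁ = proj₁ rec
    h : Edge n → ℕ
    h f with enclosed? f
    ... | yes _ = ℕ.suc (h₁ f)
    ... | no  _ = 0
    h< : ∀ {e} → e ∈ m → h e ℕ.< ℕ.suc k
    h< {e} e∈ with enclosed? e
    ... | yes p = s≤s (proj₁ (proj₂ rec) (∈-filter⁺ enclosed? e∈ p))
    ... | no  _ = s≤s z≤n
    h≢ : ∀ {e f} → e ∈ m → f ∈ m → Encloses e f → h e ≢ h f
    h≢ {e} {f} e∈ f∈ enc eq with enclosed? e | enclosed? f
    ... | _     | no ¬p = ¬p (lose e∈ enc)
    ... | no  _ | yes _ = contradiction eq λ ()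
    ... | yes p | yes q =
      proj₂ (proj₂ rec) (∈-filter⁺ enclosed? e∈ p) (∈-filter⁺ enclosed? f∈ q) enc
        (ℕ.suc-injective eq)

  product-weight : Monomial n → ℕ
  product-weight []      = 0
  product-weight (e ∷ m) = toℕ (lo e) ℕ.* toℕ (hi e) ℕ.+ product-weight m

  product-weight-↭ : ∀ {m m′} → m ↭ m′ → product-weight m ≡ product-weight m′
  product-weight-↭ ↭.refl         = ≡.refl
  product-weight-↭ (prep e p)     = ≡.cong (_ ℕ.+_) (product-weight-↭ p)
  product-weight-↭ (↭.swap e f p) =
    ≡.trans (≡.cong (λ z → toℕ (lo e) ℕ.* toℕ (hi e) ℕ.+ (toℕ (lo f) ℕ.* toℕ (hi f) ℕ.+ z))
      (product-weight-↭ p))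
    (x∙yz≈y∙xz (toℕ (lo e) ℕ.* toℕ (hi e)) (toℕ (lo f) ℕ.* toℕ (hi f)) _)
    where open import Algebra.Properties.CommutativeSemigroup ℕ.+-commutativeSemigroup using (x∙yz≈y∙xz)
  product-weight-↭ (↭.trans p q)  = ≡.trans (product-weight-↭ p) (product-weight-↭ q)

  -- Lower endpoints decrease, and ties are broken by decreasing upper endpoints. In a lane without
  -- nestings the upper endpoints then decrease throughout, as `Dominates` requires.
  After : Edge n → Edge n → Set
  After e f = lo f Fin.< lo e ⊎ (lo f ≡ lo e × hi f Fin.≤ hi e)

  after-total : Total After
  after-total e f with Fin.<-cmp (lo e) (lo f)
  ... | tri< lt _ _ = inj₂ (inj₁ lt)
  ... | tri> _ _ gt = inj₁ (inj₁ gt)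
  ... | tri≈ _ eq _ with ℕ.≤-total (toℕ (hi e)) (toℕ (hi f))
  ...   | inj₁ le = inj₂ (inj₂ (eq , le))
  ...   | inj₂ ge = inj₁ (inj₂ (≡.sym eq , ge))

  after-trans : Transitive After
  after-trans (inj₁ p) (inj₁ q) = inj₁ (ℕ.<-trans q p)
  after-trans (inj₁ p) (inj₂ (eq , _)) = inj₁ (≡.subst (Fin._< _) (≡.sym eq) p)
  after-trans (inj₂ (eq , _)) (inj₁ q) = inj₁ (≡.subst (_ Fin.<_) eq q)
  after-trans (inj₂ (eq , p)) (inj₂ (eq′ , q)) = inj₂ (≡.trans eq′ eq , ℕ.≤-trans q p)

-- Independence of nesting-free monomials modulo the kernel of the substitution.

module NestingIndependence (em : ∀ {ℓ} → ExcludedMiddle ℓ) {c ℓ} (R : CommutativeRing c ℓ) (k n : ℕ) where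
  open CommutativeRing R hiding (zero)
  open import Relation.Binary.Reasoning.Setoid setoid
  open Sums R
  open Polynomials R {n}
  open Substitution em R k n
  open Rearrangement {k} {n}

  ∑-single : ∀ {b} {B : Set b} {x} (xs : List B) {g} → Unique xs → x ∈ xs →
    (∀ {y} → y ≢ x → g y ≈ 0#) → ∑ xs g ≈ g x
  ∑-single (x ∷ xs) (x∉ ∷ u) (here ≡.refl) null =
    trans (+-congˡ (∑-zero xs λ y∈ → null (All.lookup x∉ y∈ ∘ ≡.sym))) (+-identityʳ _)
  ∑-single (y ∷ xs) (y∉ ∷ u) (there x∈) null =
    trans (+-cong (null (All.lookup y∉ x∈)) (∑-single xs u x∈ null)) (+-identityˡ _)

  Labels : Monomial n → List Triple → Set _
  Labels = Pointwise λ e t → t ∈ triples e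

  Φ-zero : ∀ m {χ} → (∀ T → Labels m T → χ T ≈ 0#) → Φ χ m ≈ 0#
  Φ-zero []      null = null [] []
  Φ-zero (e ∷ m) null = ∑-zero (labels e) λ {p} p∈ →
    trans (*-congˡ (Φ-zero m λ T lab → null (proj₂ p ∷ T) (∈-map⁺ proj₂ p∈ ∷ lab))) (zeroʳ _)

  paint : ∀ m → All (λ _ → Fin k) m → List Triple
  paint []      []       = []
  paint (e ∷ m) (l ∷ ls) = (l , lo e , hi e) ∷ paint m ls

  Φ-single : ∀ m ls {χ} → (∀ T → Labels m T → T ≢ paint m ls → χ T ≈ 0#) → Φ χ m ≈ χ (paint m ls)
  Φ-single []      []       null = refl
  Φ-single (e ∷ m) (l ∷ ls) {χ} null = begin
    ∑ (labels e) (λ (a , t) → a * Φ (χ ∘ (t ∷_)) m)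
      ≈⟨ ∑-++ (map (λ l → 1# , (l , lo e , hi e)) (allFin k)) _ ⟩
    ∑ (map (λ l → 1# , (l , lo e , hi e)) (allFin k)) (λ (a , t) → a * Φ (χ ∘ (t ∷_)) m) +
    ∑ (map (λ l → - 1# , (l , hi e , lo e)) (allFin k)) (λ (a , t) → a * Φ (χ ∘ (t ∷_)) m)
      ≈⟨ +-cong (∑-map _ (allFin k)) (trans (∑-map _ (allFin k))
        (∑-zero′ (allFin k) λ l′ → trans (*-congˡ (reversed l′)) (zeroʳ _))) ⟩
    ∑ (allFin k) (λ l′ → 1# * Φ (χ ∘ ((l′ , lo e , hi e) ∷_)) m) + 0#
      ≈⟨ trans (+-identityʳ _) (∑-single (allFin k) (Unique.allFin⁺ k) (∈-allFin l) λ l′≢l →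
        trans (*-congˡ (other l′≢l)) (zeroʳ _)) ⟩
    1# * Φ (χ ∘ ((l , lo e , hi e) ∷_)) m
      ≈⟨ trans (*-identityˡ _) (Φ-single m ls λ T lab T≢ →
        null _ (proj₁ (∈-triples⁺ e l) ∷ lab) (T≢ ∘ ∷-injectiveʳ)) ⟩
    χ (paint (e ∷ m) (l ∷ ls)) ∎
    where
    open import Data.List.Properties using (∷-injectiveʳ; ∷-injectiveˡ)
    reversed : ∀ l′ → Φ (χ ∘ ((l′ , hi e , lo e) ∷_)) m ≈ 0#
    reversed l′ = Φ-zero m λ T lab → null _ (proj₂ (∈-triples⁺ e l′) ∷ lab)
      λ eq → ℕ.<⇒≢ (lo<hi e) (≡.cong (toℕ ∘ proj₂ ∘ proj₂) (∷-injectiveˡ eq))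
    other : ∀ {l′} → l′ ≢ l → Φ (χ ∘ ((l′ , lo e , hi e) ∷_)) m ≈ 0#
    other {l′} l′≢l =
      Φ-zero m λ T lab → null _ (proj₁ (∈-triples⁺ e l′) ∷ lab) λ eq →
        l′≢l (≡.cong proj₁ (∷-injectiveˡ eq))

  Matches : List Triple → List Triple → Set
  Matches P T = map left T ↭ map left P × map right T ↭ map right P

  -- Extracts the coefficient of the monomial in the variables `y` and `z` that belongs to `P`.
  indicator : List Triple → List Triple → Carrier
  indicator P T with em {0ℓ} {Matches P T}
  ... | yes _ = 1#
  ... | no  _ = 0#

  indicator-yes : ∀ {P T} → Matches P T → indicator P T ≈ 1#
  indicator-yes {P} {T} p with em {0ℓ} {Matches P T}
  ... | yes _ = refl
  ... | no ¬p = contradiction p ¬p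

  indicator-no : ∀ {P T} → ¬ Matches P T → indicator P T ≈ 0#
  indicator-no {P} {T} ¬p with em {0ℓ} {Matches P T}
  ... | yes p = contradiction p ¬p
  ... | no _  = refl

  indicator-cong : ∀ {P T T′} → (Matches P T → Matches P T′) → (Matches P T′ → Matches P T) →
    indicator P T ≈ indicator P T′
  indicator-cong {P} {T} to from with em {0ℓ} {Matches P T}
  ... | yes p = sym (indicator-yes (to p))
  ... | no ¬p = sym (indicator-no (¬p ∘ from))

  indicator-admissible : ∀ P → Admissible (indicator P)
  indicator-admissible P = record
    { invariant = λ s↭t → indicator-cong {P} (move s↭t) (move (↭-sym s↭t))
    ; exchange  =
      λ l i j i′ j′ W → indicator-cong {P} (λ (ls , rs) → ls , ↭-trans (↭.swap _ _ ↭-refl) rs)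
                                                       (λ (ls , rs) → ls ,
                                                         ↭-trans (↭.swap _ _ ↭-refl) rs)
    }
    where
    move : ∀ {T T′} → T ↭ T′ → Matches P T → Matches P T′
    move p (ls , rs) = ↭-trans (↭-sym (map⁺ left p)) ls , ↭-trans (↭-sym (map⁺ right p)) rs

  edgeOf : ∀ {e t} → t ∈ triples e → toℕ (proj₁ (proj₂ t)) ℕ.* toℕ (proj₂ (proj₂ t)) ≡
    toℕ (lo e) ℕ.* toℕ (hi e)
  edgeOf {e} t∈ with ∈-triples⁻ {e} t∈
  ... | inj₁ (≡.refl , ≡.refl) = ≡.refl
  ... | inj₂ (≡.refl , ≡.refl) = ℕ.*-comm (toℕ (hi e)) (toℕ (lo e))

  total-labels : ∀ {m T} → Labels m T → total T ≡ product-weight m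
  total-labels []                 = ≡.refl
  total-labels {e ∷ m} (t∈ ∷ lab) = ≡.cong₂ ℕ._+_ (edgeOf {e} t∈) (total-labels lab)

  paint-labels : ∀ m ls → Labels m (paint m ls)
  paint-labels []      []       = []
  paint-labels (e ∷ m) (l ∷ ls) = proj₁ (∈-triples⁺ e l) ∷ paint-labels m ls

  labels-↭ : ∀ {m m′ T T′} → Labels m T → Labels m′ T′ → T ↭ T′ → m ↭ m′
  labels-↭ lab lab′ T↭T′ =
    ↭-trans (↭-reflexive (recover lab)) (↭-trans (mapMaybe-↭ underlying T↭T′)
      (↭-reflexive (≡.sym (recover lab′))))
    where
    open import Data.List.Base using (mapMaybe)
    open import Data.List.Relation.Binary.Permutation.Propositional.Properties using (mapMaybe-↭)
    open import Data.Maybe.Base using (Maybe; just; nothing)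
    underlying : Triple → Maybe (Edge n)
    underlying (l , i , j) with i Fin.<? j | j Fin.<? i
    ... | yes i<j | _       = just (edge i<j)
    ... | no _    | yes j<i = just (edge j<i)
    ... | no _    | no _    = nothing
    underlying-just : ∀ {e t} → t ∈ triples e → underlying t ≡ just e
    underlying-just {e} {l , i , j} t∈ with ∈-triples⁻ {e} t∈
    ... | inj₁ (≡.refl , ≡.refl) with lo e Fin.<? hi e | hi e Fin.<? lo e
    ...   | yes _ | _ = ≡.cong just (edge-≡ ≡.refl ≡.refl)
    ...   | no ¬p | _ = contradiction (lo<hi e) ¬p
    underlying-just {e} {l , i , j} t∈ | inj₂ (≡.refl , ≡.refl) with hi e Fin.<? lo e | lo e Fin.<?
      hi e
    ...   | yes p | _     = contradiction p (ℕ.<-asym (lo<hi e))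
    ...   | no _  | yes _ = ≡.cong just (edge-≡ ≡.refl ≡.refl)
    ...   | no _  | no ¬p = contradiction (lo<hi e) ¬p
    recover : ∀ {m T} → Labels m T → m ≡ mapMaybe underlying T
    recover [] = ≡.refl
    recover {e ∷ m} {t ∷ T} (t∈ ∷ lab) with underlying t | underlying-just {e} t∈
    ... | just _ | ≡.refl = ≡.cong (e ∷_) (recover lab)

  private
    module Painting {m : Monomial n} (h : Edge n → ℕ) (h< : ∀ {e} → e ∈ m → h e ℕ.< k) where

      lane′ : ∀ {e} → e ∈ m → Fin k
      lane′ e∈ = fromℕ< (h< e∈)

      lane-≡ : ∀ {e f} (e∈ : e ∈ m) (f∈ : f ∈ m) → lane′ e∈ ≡ lane′ f∈ → h e ≡ h f
      lane-≡ e∈ f∈ eq =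
        ≡.trans (≡.sym (Fin.toℕ-fromℕ< (h< e∈))) (≡.trans (≡.cong toℕ eq) (Fin.toℕ-fromℕ< (h< f∈)))

      ≡-lane : ∀ {e f} (e∈ : e ∈ m) (f∈ : f ∈ m) → h e ≡ h f → lane′ e∈ ≡ lane′ f∈
      ≡-lane e∈ f∈ eq =
        Fin.toℕ-injective (≡.trans (Fin.toℕ-fromℕ< (h< e∈))
          (≡.trans eq (≡.sym (Fin.toℕ-fromℕ< (h< f∈)))))

      paintFrom : ∀ m′ → (∀ {e} → e ∈ m′ → e ∈ m) → List Triple
      paintFrom m′ ⊆ = paint m′ (All.tabulate (lane′ ∘ ⊆))

      ∈-paintFrom : ∀ m′ (⊆ : ∀ {e} → e ∈ m′ → e ∈ m) {t} → t ∈ paintFrom m′ ⊆ →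
                    ∃ λ e → ∃ λ (e∈ : e ∈ m′) → t ≡ (lane′ (⊆ e∈) , lo e , hi e)
      ∈-paintFrom (e ∷ m′) ⊆ (here eq)  = e , here ≡.refl , eq
      ∈-paintFrom (e ∷ m′) ⊆ (there t∈) = let (f , f∈ , eq) = ∈-paintFrom m′ (⊆ ∘ there) t∈ in f , there f∈ , eq

      module _ (h≢ : ∀ {e f} → e ∈ m → f ∈ m → Encloses e f → h e ≢ h f) where

        paint-sorted : ∀ m′ (⊆ : ∀ {e} → e ∈ m′ → e ∈ m) → AllPairs After m′ →
          AllPairs Dominates (paintFrom m′ ⊆)
        paint-sorted []       ⊆ [] = []
        paint-sorted (e ∷ m′) ⊆ (after ∷ sorted) =
          All.tabulate dominated ∷ paint-sorted m′ (⊆ ∘ there) sorted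
          where
          dominated : ∀ {t} → t ∈ paintFrom m′ (⊆ ∘ there) →
            Dominates (lane′ (⊆ (here ≡.refl)) , lo e , hi e) t
          dominated t∈ with ∈-paintFrom m′ (⊆ ∘ there) t∈
          ... | f , f∈ , ≡.refl = λ eq → case (All.lookup after f∈) eq
            where
            case : After e f → lane′ (⊆ (here ≡.refl)) ≡ lane′ (⊆ (there f∈)) → lo f Fin.≤
              lo e × hi f Fin.≤ hi e
            case (inj₂ (lo≡ , hi≤)) eq = ℕ.≤-reflexive (≡.cong toℕ lo≡) , hi≤
            case (inj₁ lo<) eq = ℕ.<⇒≤ lo< , ℕ.≮⇒≥ λ hi< →
              h≢ (⊆ (there f∈)) (⊆ (here ≡.refl)) (lo< , hi<)
                (≡.sym (lane-≡ (⊆ (here ≡.refl)) (⊆ (there f∈)) eq))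

        -- The lane depends on the edge alone, so repeated edges receive equal triples and a
        -- labelling that merely permutes the painted triples is the painting itself. Hence the
        -- coefficient is 1 and not a multinomial number, which could vanish in the field.
        paint-determined : ∀ m′ (⊆ : ∀ {e} → e ∈ m′ → e ∈ m) {T} → Labels m′ T →
                           (∀ {t} → t ∈ T → ∃ λ e → ∃ λ (e∈ : e ∈ m) → t ≡ (lane′ e∈ , lo e , hi e))
                             → T ≡ paintFrom m′ ⊆
        paint-determined []       ⊆ []         known = ≡.refl
        paint-determined (e ∷ m′) ⊆ (t∈ ∷ lab) known =
          ≡.cong₂ _∷_ first (paint-determined m′ (⊆ ∘ there) lab (known ∘ there))
          where
          first : _ ≡ (lane′ (⊆ (here ≡.refl)) , lo e , hi e)
          first with known (here ≡.refl)
          ... | f , f∈ , ≡.refl with ∈-triples⁻ {e} t∈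
          ...   | inj₁ (l≡ , h≡) =
            ≡.cong₂ _,_ (≡-lane f∈ (⊆ (here ≡.refl)) (≡.cong h (edge-≡ {e = f} {e} l≡ h≡)))
              (≡.cong₂ _,_ l≡ h≡)
          ...   | inj₂ (l≡ , h≡) =
            contradiction (≡.subst₂ ℕ._<_ (≡.cong toℕ l≡) (≡.cong toℕ h≡) (lo<hi f))
              (ℕ.<-asym (lo<hi e))

  record Detects (m : Monomial n) (χ : List Triple → Carrier) : Set (c ⊔ ℓ) where
    field
      admissible : Admissible χ
      self       : Φ χ m ≈ 1#
      others     : ∀ {m′} → product-weight m ℕ.≤ product-weight m′ → ¬ (m ↭ m′) → Φ χ m′ ≈ 0#

  detect : ∀ m → NestingFree k m → ∃ (Detects m)
  detect m free = indicator P , record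
    { admissible = indicator-admissible P
    ; self       = trans (Φ-invariant (Admissible.invariant (indicator-admissible P)) m↭)
                     (trans (Φ-single ms ls λ T lab T≢ → indicator-no λ match →
                       T≢ (unique T lab match)) (indicator-yes (↭-refl , ↭-refl)))
    ; others     = λ {m′} le m≁ → Φ-zero m′ λ T lab → indicator-no λ match →
                     m≁ (↭-trans m↭ (labels-↭
                       (paint-labels ms ls) lab
                         (↭-sym (best T lab
                           (ℕ.≤-trans (ℕ.≤-reflexive (≡.sym (product-weight-↭ m↭))) le) match))))
    }
    where
    sorting = InsertionSort.sort {R = After} after-total
      (λ {e} {f} {g} → after-trans {n} {e} {f} {g}) m
    ms = proj₁ sorting
    m↭ : m ↭ ms
    m↭ = proj₁ (proj₂ sorting)
    col = colouring k m free
    h = proj₁ col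
    h< : ∀ {e} → e ∈ ms → h e ℕ.< k
    h< e∈ = proj₁ (proj₂ col) (∈-resp-↭ (↭-sym m↭) e∈)
    open Painting {ms} h h<
    ls = All.tabulate lane′
    P = paint ms ls
    sorted : AllPairs Dominates P
    sorted = paint-sorted (λ e∈ f∈ → proj₂ (proj₂ col) (∈-resp-↭ (↭-sym m↭) e∈)
      (∈-resp-↭ (↭-sym m↭) f∈)) ms (λ e∈ → e∈) (proj₂ (proj₂ sorting))
    best : ∀ {m′} T → Labels m′ T → product-weight ms ℕ.≤ product-weight m′ → Matches P T → T ↭ P
    best T lab le (match₁ , match₂) with rearrange P T sorted match₁ match₂
    ... | inj₁ T↭P = T↭P
    ... | inj₂ lt  = contradiction (≡.subst₂ ℕ._≤_ (≡.sym (total-labels (paint-labels ms ls)))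
      (≡.sym (total-labels lab)) le) (ℕ.<⇒≱ lt)
    unique : ∀ T → Labels ms T → Matches P T → T ≡ P
    unique T lab match = paint-determined
      (λ e∈ f∈ → proj₂ (proj₂ col) (∈-resp-↭ (↭-sym m↭) e∈) (∈-resp-↭ (↭-sym m↭) f∈)) ms (λ e∈ → e∈)
        lab
      (λ t∈ → ∈-paintFrom ms (λ e∈ → e∈) (∈-resp-↭ (best T lab ℕ.≤-refl match) t∈))

  -- The functionals of `detect` are triangular for `product-weight`: terms of smaller weight have
  -- coefficient zero by induction, and other terms of equal or larger weight are not seen.
  nesting-independent : ∀ (f : Poly R n) → AllPairs (λ p q → ¬ (proj₂ p ↭ proj₂ q)) f →
    All (NestingFree k ∘ proj₂) f →
                        Kills f → ∀ {p} → p ∈ f → proj₁ p ≈ 0#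
  nesting-independent f distinct free kills {p} p∈ =
    <-rec (λ N → ∀ {p} → p ∈ f → product-weight (proj₂ p) ≡ N → proj₁ p ≈ 0#) step _ p∈ ≡.refl
    where
    step : ∀ N → (∀ {M} → M ℕ.< N → ∀ {p} → p ∈ f → product-weight (proj₂ p) ≡ M → proj₁ p ≈ 0#) →
           ∀ {p} → p ∈ f → product-weight (proj₂ p) ≡ N → proj₁ p ≈ 0#
    step _ rec {a , m} p∈ ≡.refl with ∈⇒↭∷ p∈ | detect m (All.lookup free p∈)
    ... | rest , f↭ | χ , det = begin
      a                              ≈⟨ trans (+-identityʳ _) (trans (*-congˡ self) (*-identityʳ a))
        ⟨
      a * Φ χ m + 0#                 ≈⟨ +-congˡ (∑-zero rest small) ⟨
      a * Φ χ m + lin rest (Φ χ)     ≈⟨ ∑-↭ f↭ ⟨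
      lin f (Φ χ)                    ≈⟨ kills admissible ⟩
      0#                             ∎
      where
      open Detects det
      small : ∀ {q} → q ∈ rest → proj₁ q * Φ χ (proj₂ q) ≈ 0#
      small {b , m′} q∈ with product-weight m′ ℕ.<? product-weight m
      ... | yes lt = trans (*-congʳ (rec lt (∈-resp-↭ (↭-sym f↭) (there q∈)) ≡.refl)) (zeroˡ _)
      ... | no ¬lt = trans (*-congˡ (others (ℕ.≮⇒≥ ¬lt)
        (All.lookup (AllPairs.head (allPairs-resp-↭ (λ ¬p p → ¬p (↭-sym p)) f↭ distinct)) q∈)))
          (zeroʳ _)

-- Reduction of monomials to standard ones modulo the Pfaffians.

module Reduction (em : ∀ {ℓ} → ExcludedMiddle ℓ) {c ℓ} (R : CommutativeRing c ℓ) (k n : ℕ) where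
  open CommutativeRing R hiding (zero)
  open import Relation.Binary.Reasoning.Setoid setoid
  open Sums R
  open Exp semiring using (_^_)

  unit : ℕ → Carrier
  unit m = (- 1#) ^ m

  unit-square : ∀ m → unit m * unit m ≈ 1#
  unit-square ℕ.zero    = *-identityˡ 1#
  unit-square (ℕ.suc m) = begin
    (- 1# * unit m) * (- 1# * unit m)     ≈⟨ *-cong (negate m) (negate m) ⟩
    - unit m * - unit m                   ≈⟨ -‿distribˡ-* _ _ ⟨
    - (unit m * - unit m)                 ≈⟨ -‿cong (-‿distribʳ-* _ _) ⟨
    - - (unit m * unit m)                 ≈⟨ -‿involutive _ ⟩
    unit m * unit m                       ≈⟨ unit-square m ⟩
    1#                                    ∎
    where
    negate : ∀ m → - 1# * unit m ≈ - unit m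
    negate m = trans (sym (-‿distribˡ-* 1# _)) (-‿cong (*-identityˡ _))

  Crossing : Set
  Crossing = ∃ λ (C : Monomial n) → IsCrossing (ℕ.suc k) C

  -- A formal combination of the polynomials s * pfaffian (support C).
  Combination : Set c
  Combination = List (Carrier × Monomial n × Crossing)

  value : Combination → (Monomial n → Carrier) → Carrier
  value J χ = ∑ J λ (a , s , (C , _)) → a * lin (pfaffian R (support C)) (λ t → χ (s ++ t))

  scaleᶜ : Carrier → Combination → Combination
  scaleᶜ a = map λ (b , x) → a * b , x

  value-scale : ∀ a J χ → value (scaleᶜ a J) χ ≈ a * value J χ
  value-scale a J χ = trans (∑-map _ J) (trans (∑-cong′ J λ _ → *-assoc a _ _) (sym (∑-*ˡ J a)))

  lin-pfaffian : ∀ {C C′ Es} → perfectMatchings (support {n} C) ↭ C′ ∷ Es → ∀ χ →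
                 lin (pfaffian R (support C)) χ ≈
                   unit (cr C′) * χ C′ + ∑ Es (λ E → unit (cr E) * χ E)
  lin-pfaffian {C} p χ = trans (∑-map _ (perfectMatchings (support C))) (∑-↭ p)

  -- `P` is a bound that the reduction must respect; it passes from a crossing to every matching
  -- that can be uncrossed into it. It is instantiated by a bound on the degree and by a bound on
  -- the `v`-weight.
  module _ {p} (P : Monomial n → Set p) (P-↭ : ∀ {s t} → s ↭ t → P s → P t)
           (P-⇝ : ∀ s {E C} → E ⇝* C → P (s ++ C) → P (s ++ E)) where

    record Reducible (φ : (Monomial n → Carrier) → Carrier) : Set (c ⊔ ℓ ⊔ p) where
      field
        remainder   : Poly R n
        combination : Combination
        identity    : ∀ {χ} → Invariant χ → φ χ ≈ lin remainder χ + value combination χ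
        standard    : All (λ t → Standard k (proj₂ t) × P (proj₂ t)) remainder
        bounded     : All (λ (_ , s , (C , _)) → P (s ++ C)) combination

    open Reducible

    reduce-poly : ∀ f → All (λ t → Reducible (λ χ → χ (proj₂ t))) f → Reducible (lin f)
    reduce-poly [] [] = record { remainder = [] ; combination = [] ; identity = λ _ →
      sym (+-identityˡ 0#) ; standard = [] ; bounded = [] }
    reduce-poly ((a , m) ∷ f) (h ∷ hs) = record
      { remainder   = scale a (remainder h) ++ remainder hs′
      ; combination = scaleᶜ a (combination h) ++ combination hs′
      ; identity    = λ {χ} inv → begin
          a * χ m + lin f χ
            ≈⟨ +-cong (trans (*-congˡ (identity h inv)) (distribˡ a _ _)) (identity hs′ inv) ⟩
          (a * lin (remainder h) χ + a * value (combination h) χ) +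
            (lin (remainder hs′) χ + value (combination hs′) χ)
            ≈⟨ interchange _ _ _ _ ⟩
          (a * lin (remainder h) χ + lin (remainder hs′) χ) +
            (a * value (combination h) χ + value (combination hs′) χ)
            ≈⟨ +-cong (trans (∑-++ (scale a (remainder h)) _) (+-congʳ (lin-scale a (remainder h))))
                      (trans (∑-++ (scaleᶜ a (combination h)) _)
                        (+-congʳ (value-scale a (combination h) χ))) ⟨
          lin (scale a (remainder h) ++ remainder hs′) χ + value
            (scaleᶜ a (combination h) ++ combination hs′) χ ∎
      ; standard    = All.++⁺ (All.map⁺ (standard h)) (standard hs′)
      ; bounded     = All.++⁺ (All.map⁺ (bounded h)) (bounded hs′)
      }
      where hs′ = reduce-poly f hs

    find-crossing : ∀ {m : Monomial n} → ¬ Standard k m → ∃ λ C →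
      IsCrossing (ℕ.suc k) C × All (_∈ m) C
    find-crossing {m} ¬std with em {0ℓ} {∃ λ C → IsCrossing (ℕ.suc k) C × All (_∈ m) C}
    ... | yes x = x
    ... | no ¬x = contradiction (λ C cC C∈ → ¬x (C , cC , C∈)) ¬std

    private
      -- A nonstandard monomial is `s ++ C` for a crossing `C`. The Pfaffian on the vertices of `C`
      -- is solved for `C`, whose coefficient is a sign and so its own inverse, and the other
      -- matchings have smaller `ranks`. The recursion uses `ranks` because the `v`-weight of an
      -- fp-positive `v` may stay constant.
      reduce-step : ∀ N → (∀ {M} → M ℕ.< N → ∀ m → ranks m ≡ M → P m → Reducible (λ χ → χ m)) →
             ∀ m → ranks m ≡ N → P m → Reducible (λ χ → χ m)
      reduce-step _ rec m ≡.refl Pm with em {0ℓ} {Standard k m}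
      ... | yes std = record
        { remainder = [ 1# , m ] ; combination = [] ; standard = (std , Pm) ∷ [] ; bounded = []
        ; identity = λ _ → sym (trans (+-identityʳ _) (trans (+-identityʳ _) (*-identityˡ _))) }
      ... | no ¬std with find-crossing ¬std
      ...   | C , cC , C∈ with unique-⊆⇒++ (crossing-unique (proj₂ cC)) (All.lookup C∈) |
        matchings-split (proj₂ cC)
      ...     | s , m↭C++s | C′ , Es , split , C′↭ , others = record
        { remainder   = remainder rest
        ; combination = (σ , s , (C , cC)) ∷ combination rest
        ; identity    = λ {χ} inv → begin
            χ m                                           ≈⟨ inv (↭-trans m↭ (++⁺ˡ s (↭-sym C′↭))) ⟩
            χ (s ++ C′)                                   ≈⟨ solve-leading χ ⟩
            lin f χ + σ * L χ                             ≈⟨ +-congʳ (identity rest inv) ⟩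
            (lin (remainder rest) χ + value (combination rest) χ) + σ * L χ
              ≈⟨ trans (+-assoc _ _ _) (+-congˡ (+-comm _ _)) ⟩
            lin (remainder rest) χ + (σ * L χ + value (combination rest) χ)   ∎
        ; standard    = standard rest
        ; bounded     = PsC ∷ bounded rest
        }
        where
        m↭ : m ↭ s ++ C
        m↭ = ↭-trans m↭C++s (++-comm C s)
        PsC : P (s ++ C)
        PsC = P-↭ m↭ Pm
        σ = unit (cr C′)
        L : (Monomial n → Carrier) → Carrier
        L χ = lin (pfaffian R (support C)) (λ t → χ (s ++ t))
        f : Poly R n
        f = map (λ E → - (σ * unit (cr E)) , s ++ E) Es
        smaller : ∀ {E} → word E ↭ word C × ¬ (E ↭ C) → Reducible (λ χ → χ (s ++ E))
        smaller {E} (w , ¬p) = rec lt (s ++ E) ≡.refl (P-⇝ s E⇝C PsC)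
          where
          E⇝C : E ⇝* C
          E⇝C = uncrossing (proj₂ cC) w
          lt : ranks (s ++ E) ℕ.< ranks m
          lt with ⇝*-ranks E⇝C
          ... | inj₁ q  = contradiction q ¬p
          ... | inj₂ lt = ≡.subst₂ ℕ._<_ (≡.sym (ranks-++ s E))
            (≡.trans (≡.sym (ranks-++ s C)) (≡.sym (ranks-↭ m↭))) (ℕ.+-monoʳ-< (ranks s) lt)
        rest : Reducible (lin f)
        rest = reduce-poly f (All.map⁺ (All.map smaller others))
        solve-leading : ∀ χ → χ (s ++ C′) ≈ lin f χ + σ * L χ
        solve-leading χ = begin
          χ (s ++ C′)                            ≈⟨ +-identityˡ _ ⟨
          0# + χ (s ++ C′)                       ≈⟨ +-congʳ (-‿inverseˡ _) ⟨
          (- S + S) + χ (s ++ C′)                ≈⟨ trans (+-assoc _ _ _) (+-congˡ (+-comm _ _)) ⟩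
          - S + (χ (s ++ C′) + S)                ≈⟨ +-cong left right ⟩
          lin f χ + σ * L χ                      ∎
          where
          S = ∑ Es (λ E → σ * (unit (cr E) * χ (s ++ E)))
          left : - S ≈ lin f χ
          left = trans (sym (∑-neg Es)) (trans
            (∑-cong′ Es λ E → trans (-‿cong (sym (*-assoc σ _ _))) (-‿distribˡ-* _ _))
              (sym (∑-map _ Es)))
          right : χ (s ++ C′) + S ≈ σ * L χ
          right = sym (trans (*-congˡ (lin-pfaffian {C} split (λ t → χ (s ++ t))))
            (trans (distribˡ σ _ _)
            (+-cong (trans (sym (*-assoc σ σ _))
              (trans (*-congʳ (unit-square (cr C′))) (*-identityˡ _))) (∑-*ˡ Es σ))))

    -- Opaque, so that the well-founded recursion is not unfolded in the types that mention its
    -- results.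
    abstract
      reduce-monomial : ∀ m → P m → Reducible (λ χ → χ m)
      reduce-monomial m Pm =
        <-rec (λ N → ∀ m → ranks m ≡ N → P m → Reducible (λ χ → χ m)) reduce-step _ m ≡.refl Pm

-- Linear dependence over a domain.

NoZeroDivisors : ∀ {c ℓ} → CommutativeRing c ℓ → Set (c ⊔ ℓ)
NoZeroDivisors R = ∀ {x y} → x * y ≈ 0# → x ≈ 0# ⊎ y ≈ 0#
  where open CommutativeRing R

Nontrivial : ∀ {c ℓ} → CommutativeRing c ℓ → Set ℓ
Nontrivial R = ¬ (1# ≈ 0#)
  where open CommutativeRing R

module LinearSystems (em : ∀ {ℓ} → ExcludedMiddle ℓ) {c ℓ} (R : CommutativeRing c ℓ)
                     (domain : NoZeroDivisors R) (nontrivial : Nontrivial R) where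
  open CommutativeRing R hiding (zero)
  open import Relation.Binary.Reasoning.Setoid setoid
  open Sums R

  private variable
    b : Level
    B : Set b

  private
    pivot : ∀ (φ : B → Carrier) xs → (∀ {x} → x ∈ xs → φ x ≈ 0#) ⊎ ∃₂ λ x ys → xs ↭
      x ∷ ys × ¬ (φ x ≈ 0#)
    pivot φ []       = inj₁ λ ()
    pivot φ (x ∷ xs) with em {P = φ x ≈ 0#}
    ... | no φx≉0  = inj₂ (x , xs , ↭-refl , φx≉0)
    ... | yes φx≈0 with pivot φ xs
    ...   | inj₁ null = inj₁ λ { (here ≡.refl) → φx≈0 ; (there x∈) → null x∈ }
    ...   | inj₂ (y , ys , p , φy≉0) =
      inj₂ (y , x ∷ ys , ↭-trans (prep x p) (↭.swap x y ↭-refl) , φy≉0)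

  private
    -- Gaussian elimination without division: with a pivot `φ x₀` that is not zero, each further `ψ`
    -- is replaced by the 2 by 2 minor `ψ y * φ x₀ - φ y * ψ x₀`. Scaling the smaller solution by
    -- the pivot keeps it nonzero in a domain.
    solution : ∀ N (φs : List (B → Carrier)) (xs : List B) → length φs ≡ N → N ℕ.< length xs →
      ∃ λ (f : List (Carrier × B)) → map proj₂ f ↭
        xs × Any (λ t → ¬ (proj₁ t ≈ 0#)) f × All (λ φ → lin f φ ≈ 0#) φs
    solution _ [] (x ∷ xs) _ _ =
      (1# , x) ∷ map (0# ,_) xs , prep x (↭-reflexive (map-snd xs)) , here nontrivial , []
      where
      map-snd : ∀ (xs : List B) → map proj₂ (map (0# ,_) xs) ≡ xs
      map-snd []       = ≡.refl
      map-snd (x ∷ xs) = ≡.cong (x ∷_) (map-snd xs)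
    solution {B = B} (ℕ.suc N) (φ ∷ φs) xs len lt with pivot φ xs
    ... | inj₁ null with solution N φs xs (ℕ.suc-injective len) (ℕ.<⇒≤ lt)
    ...   | f , f↭ , some , sols = f , f↭ , some ,
            ∑-zero f (λ {(a , x)} t∈ → trans (*-congˡ (null (∈-resp-↭ f↭ (∈-map⁺ proj₂ t∈))))
              (zeroʳ a)) ∷ sols
    solution {B = B} (ℕ.suc N) (φ ∷ φs) xs len lt | inj₂ (x₀ , ys , xs↭ , φx₀≉0)
      with solution N (map (λ ψ y → ψ y * φ x₀ - φ y * ψ x₀) φs) ys
             (≡.trans (length-map _ φs) (ℕ.suc-injective len))
               (ℕ.≤-pred (≡.subst (ℕ.suc (ℕ.suc N) ℕ.≤_) (↭-length xs↭) lt))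
    ...   | f , f↭ , some , sols = (- lin f φ , x₀) ∷ f′ ,
            ↭-trans (prep x₀ (↭-trans (↭-reflexive (snd f)) f↭)) (↭-sym xs↭) ,
            there (nonzero f some) ,
            eliminate φ (∑-zero f λ {(a , y)} _ → trans (*-congˡ (-‿inverseʳ _)) (zeroʳ a)) ∷
            All.map (λ {ψ} → eliminate ψ) (All.map⁻ sols)
      where
      f′ : List (Carrier × B)
      f′ = map (λ (a , y) → a * φ x₀ , y) f
      snd : ∀ (f : List (Carrier × B)) → map proj₂ (map (λ (a , y) → a * φ x₀ , y) f) ≡ map proj₂ f
      snd []      = ≡.refl
      snd (t ∷ f) = ≡.cong (proj₂ t ∷_) (snd f)
      nonzero : ∀ (f : List (Carrier × B)) → Any (λ t → ¬ (proj₁ t ≈ 0#)) f →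
        Any (λ t → ¬ (proj₁ t ≈ 0#)) (map (λ (a , y) → a * φ x₀ , y) f)
      nonzero (t ∷ f) (here a≉0)   = here λ eq → [ a≉0 , φx₀≉0 ]′ (domain eq)
      nonzero (t ∷ f) (there some) = there (nonzero f some)
      eliminate : ∀ ψ → lin f (λ y → ψ y * φ x₀ - φ y * ψ x₀) ≈ 0# → - lin f φ * ψ x₀ + lin f′ ψ ≈
        0#
      eliminate ψ eq = begin
        - lin f φ * ψ x₀ + lin f′ ψ
          ≈⟨ +-cong (trans (sym (-‿distribˡ-* _ _))
            (trans (-‿cong (∑-*ʳ f (ψ x₀))) (sym (∑-neg f)))) (∑-map _ f) ⟩
        ∑ f (λ (a , y) → - (a * φ y * ψ x₀)) + ∑ f (λ (a , y) → a * φ x₀ * ψ y)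
          ≈⟨ ∑-+ f ⟨
        ∑ f (λ (a , y) → - (a * φ y * ψ x₀) + a * φ x₀ * ψ y)
          ≈⟨ ∑-cong′ f (λ (a , y) → trans (+-comm _ _)
            (trans (+-cong (trans (*-assoc a _ _) (*-congˡ (*-comm _ _)))
               (trans (-‿cong (*-assoc a _ _)) (-‿distribʳ-* a _))) (sym (distribˡ a _ _)))) ⟩
        ∑ f (λ (a , y) → a * (ψ y * φ x₀ - φ y * ψ x₀))
          ≈⟨ eq ⟩
        0# ∎

  nontrivial-solution : ∀ (φs : List (B → Carrier)) (xs : List B) → length φs ℕ.< length xs →
    ∃ λ (f : List (Carrier × B)) → map proj₂ f ↭
      xs × Any (λ t → ¬ (proj₁ t ≈ 0#)) f × All (λ φ → lin f φ ≈ 0#) φs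
  nontrivial-solution φs xs = solution (length φs) φs xs ≡.refl

  -- The condition at `x₀` itself is a tautology, which leaves one equation fewer than there are
  -- unknowns. Cross-multiplication expresses proportionality to `coordinate` without division.
  proportional-combination : ∀ (xs : List B) (entry : B → B → Carrier) (coordinate : B → Carrier)
    {x₀} → x₀ ∈ xs →
    ∃ λ (f : List (Carrier × B)) → map proj₂ f ↭ xs × Any (λ t → ¬ (proj₁ t ≈ 0#)) f ×
      (∀ {x} → x ∈ xs → lin f (λ y → entry y x) * coordinate x₀ ≈
        lin f (λ y → entry y x₀) * coordinate x)
  proportional-combination {B = B} xs entry coordinate {x₀} x₀∈ = f , f↭ , some , balanced
    where
    r = coordinate x₀
    xs′ = proj₁ (∈⇒↭∷ x₀∈)
    xs↭ = proj₂ (∈⇒↭∷ x₀∈)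
    solved = nontrivial-solution (map (λ x y → entry y x * r - entry y x₀ * coordinate x) xs′) xs
               (≡.subst₂ ℕ._<_ (≡.sym (length-map _ xs′)) (≡.sym (↭-length xs↭)) ℕ.≤-refl)
    f    = proj₁ solved
    f↭   = proj₁ (proj₂ solved)
    some = proj₁ (proj₂ (proj₂ solved))
    sols = proj₂ (proj₂ (proj₂ solved))
    balanced : ∀ {x} → x ∈ xs → lin f (λ y → entry y x) * r ≈
      lin f (λ y → entry y x₀) * coordinate x
    balanced {x} x∈ with ∈-resp-↭ xs↭ x∈
    ... | here ≡.refl = refl
    ... | there x∈′ = begin
      lin f (λ y → entry y x) * r                                 ≈⟨ ∑-*ʳ f r ⟩
      S                                                           ≈⟨ +-identityʳ _ ⟨
      S + 0#                                                      ≈⟨ +-congˡ (-‿inverseˡ _) ⟨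
      S + (- T + T)                                               ≈⟨ +-assoc _ _ _ ⟨
      (S + - T) + T                                               ≈⟨ +-congʳ difference ⟩
      0# + T                                                      ≈⟨ +-identityˡ _ ⟩
      T                                                           ≈⟨ ∑-*ʳ f _ ⟨
      lin f (λ y → entry y x₀) * coordinate x                     ∎
      where
      S = ∑ f (λ (a , y) → a * entry y x * r)
      T = ∑ f (λ (a , y) → a * entry y x₀ * coordinate x)
      difference : S + - T ≈ 0#
      difference = trans (+-congˡ (sym (∑-neg f))) (trans (sym (∑-+ f)) (trans
        (∑-cong′ f λ (a , y) → trans (+-cong (*-assoc a _ _)
          (trans (-‿cong (*-assoc a _ _)) (-‿distribʳ-* a _))) (sym (distribˡ a _ _)))
        (All.lookup (All.map⁻ sols) x∈′)))

-- Monomials of bounded degree up to permutation.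

module _ {n : ℕ} where

  monomials : ℕ → List (Monomial n)
  monomials ℕ.zero    = [ [] ]
  monomials (ℕ.suc d) = [] ∷ cartesianProductWith _∷_ (edges n) (monomials d)

  ∈-monomials : ∀ d m → length m ℕ.≤ d → m ∈ monomials d
  ∈-monomials ℕ.zero    []      _        = here ≡.refl
  ∈-monomials (ℕ.suc d) []      _        = here ≡.refl
  ∈-monomials (ℕ.suc d) (e ∷ m) (s≤s le) =
    there (∈-cartesianProductWith⁺ _∷_ (∈-edges e) (∈-monomials d m le))

  representatives : ∀ (em : ∀ {ℓ} → ExcludedMiddle ℓ) {p} (P : Monomial n → Set p) xs →
    ∃ λ (ys : List (∃ P)) → AllPairs (λ s t → ¬ (proj₁ s ↭ proj₁ t)) ys ×
      (∀ {m} → m ∈ xs → P m → ∃ λ t → t ∈ ys × m ↭ proj₁ t)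
  representatives em P []       = [] , [] , λ ()
  representatives em P (x ∷ xs) with representatives em P xs
  ... | ys , distinct , complete with em {P = P x × ¬ Any (λ t → x ↭ proj₁ t) ys}
  ...   | yes (Px , new) = (x , Px) ∷ ys , All.¬Any⇒All¬ ys new ∷ distinct ,
          λ { (here ≡.refl) _ → (x , Px) , here ≡.refl , ↭-refl
            ; (there m∈) Pm → let (t , t∈ , p) = complete m∈ Pm in t , there t∈ , p }
  ...   | no ¬new = ys , distinct , λ { (here ≡.refl) Px → old Px ; (there m∈) → complete m∈ }
    where
    open import Data.List.Membership.Propositional using (find)
    old : P x → ∃ λ t → t ∈ ys × x ↭ proj₁ t
    old Px with em {P = Any (λ t → x ↭ proj₁ t) ys}
    ... | yes any = find any
    ... | no ¬any = contradiction (Px , ¬any) ¬new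

-- Independence of standard monomials by comparison with nesting-free ones.

module StandardIndependence (em : ∀ {ℓ} → ExcludedMiddle ℓ) {c ℓ} (R : CommutativeRing c ℓ)
                            (domain : NoZeroDivisors R) (nontrivial : Nontrivial R) (k n : ℕ) where
  open CommutativeRing R hiding (zero)
  open import Relation.Binary.Reasoning.Setoid setoid
  open Sums R
  open Polynomials R {n}
  open LinearSystems em R (λ {x} {y} → domain {x} {y}) nontrivial
  open Substitution em R k n using (Kills; Φ; Φ-invariant; kills-++; pfaffian-killed; module Admissible)
  open NestingIndependence em R k n using (nesting-independent)
  open Reduction em R k n

  combination-killed : ∀ J {χ} → Substitution.Admissible em R k n χ → value J (Φ χ) ≈ 0#
  combination-killed J adm = ∑-zero′ J λ (a , s , (C , len , cC)) → trans
    (*-congˡ (kills-++ {pfaffian R (support C)} (pfaffian-killed (support C)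
      (≡.trans (size-support {C = C} (crossing-unique-word cC))
        (≡.cong (2 ℕ.*_) (≡.trans len (ℕ.+-comm 1 k))))) s adm)) (zeroʳ a)

  module _ (f : Poly R n) (all-standard : All (Standard k ∘ proj₂) f) (kills : Kills f) where
    private
      bound : ∀ (f : Poly R n) → ∃ λ D → All (λ t → length (proj₂ t) ℕ.≤ D) f
      bound []            = 0 , []
      bound ((a , m) ∷ f) = let (D , le) = bound f in length m ℕ.⊔ D ,
        ℕ.m≤m⊔n (length m) D ∷ All.map (λ le → ℕ.≤-trans le (ℕ.m≤n⊔m (length m) D)) le

      D = proj₁ (bound f)

      Small : Monomial n → Set
      Small m = length m ℕ.≤ D

      Basic : Set
      Basic = ∃ λ m → Standard k m × Small m

      abstract
        reps : ∃ λ (ys : List Basic) → AllPairs (λ s t → ¬ (proj₁ s ↭ proj₁ t)) ys ×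
               (∀ {m} → m ∈ monomials D → Standard k m × Small m → ∃ λ t → t ∈ ys × m ↭ proj₁ t)
        reps = representatives em (λ m → Standard k m × Small m) (monomials D)

      Ls : List Basic
      Ls = proj₁ reps

      distinct : AllPairs (λ s t → ¬ (proj₁ s ↭ proj₁ t)) Ls
      distinct = proj₁ (proj₂ reps)

      complete : ∀ {m} → Standard k m → Small m → ∃ λ t → t ∈ Ls × m ↭ proj₁ t
      complete {m} std small = proj₂ (proj₂ reps) (∈-monomials D m small) (std , small)

      expansion : ∀ (g : Poly R n) → All (λ t → Standard k (proj₂ t) × Small (proj₂ t)) g → ∀ {χ} →
        Invariant χ →
                  lin g χ ≈ ∑ Ls (λ t → lin g (δ (proj₁ t)) * χ (proj₁ t))
      expansion g good {χ} inv = begin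
        ∑ g (λ (a , m) → a * χ m)
          ≈⟨ ∑-cong g (λ {(a , m)} t∈ → *-congˡ (single m (All.lookup good t∈))) ⟩
        lin g (λ m → ∑ Ls (λ t → χ (proj₁ t) * δ (proj₁ t) m))
          ≈⟨ lin-∑ g Ls (χ ∘ proj₁) (δ ∘ proj₁) ⟩
        ∑ Ls (λ t → χ (proj₁ t) * lin g (δ (proj₁ t)))
          ≈⟨ ∑-cong′ Ls (λ t → *-comm _ _) ⟩
        ∑ Ls (λ t → lin g (δ (proj₁ t)) * χ (proj₁ t)) ∎
        where
        single : ∀ m → Standard k m × Small m → χ m ≈ ∑ Ls (λ t → χ (proj₁ t) * δ (proj₁ t) m)
        single m (std , small) with complete std small
        ... | t , t∈ , m↭t with ∈⇒↭∷ t∈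
        ...   | Ls′ , Ls↭ = sym (begin
          ∑ Ls (λ u → χ (proj₁ u) * δ (proj₁ u) m)
            ≈⟨ ∑-↭ Ls↭ ⟩
          χ (proj₁ t) * δ (proj₁ t) m + ∑ Ls′ (λ u → χ (proj₁ u) * δ (proj₁ u) m)
            ≈⟨ +-cong (trans (*-congˡ (δ-yes m↭t)) (*-identityʳ _))
              (∑-zero Ls′ λ {u} u∈ → trans
                (*-congˡ (δ-no λ m↭u → All.lookup fresh u∈ (↭-trans (↭-sym m↭t) m↭u))) (zeroʳ _)) ⟩
          χ (proj₁ t) + 0#
            ≈⟨ trans (+-identityʳ _) (inv (↭-sym m↭t)) ⟩
          χ m                                                                                 ∎)
          where fresh = AllPairs.head (allPairs-resp-↭ (λ ¬p p → ¬p (↭-sym p)) Ls↭ distinct)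

      small-↭ : ∀ {s t} → s ↭ t → Small s → Small t
      small-↭ p = ≡.subst (ℕ._≤ D) (↭-length p)

      small-⇝ : ∀ s {E C} → E ⇝* C → Small (s ++ C) → Small (s ++ E)
      small-⇝ s {E} {C} r = ≡.subst (ℕ._≤ D)
        (≡.trans (length-++ s) (≡.trans (≡.cong (length s ℕ.+_) (≡.sym (⇝*-length r)))
          (≡.sym (length-++ s))))
        where
        ⇝*-length : ∀ {E C : Monomial n} → E ⇝* C → length E ≡ length C
        ⇝*-length (done p)   = ↭-length p
        ⇝*-length {E} (more {E′} s r) = ≡.trans
          (ℕ.*-cancelˡ-≡ (length E) (length E′) 2
            (≡.trans (≡.sym (length-word E)) (≡.trans (↭-length (⇝-word s)) (length-word E′))))
              (⇝*-length r)

      open Reducible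

      image : Basic → Monomial n
      image (m , std , _) = uncross m std

      normal : ∀ (t : Basic) → Reducible Small small-↭ small-⇝ (λ χ → χ (image t))
      normal (m , std , small) =
        reduce-monomial Small small-↭ small-⇝ (uncross m std)
          (≡.subst (ℕ._≤ D) (≡.sym (uncross-length m std)) small)

      -- The square matrix that expresses the nesting-free images through standard monomials modulo
      -- the Pfaffians.
      entry : Basic → Basic → Carrier
      entry t i = lin (remainder (normal t)) (δ (proj₁ i))

      image-Φ : ∀ t {χ} → Substitution.Admissible em R k n χ → Φ χ (image t) ≈
        ∑ Ls (λ i → entry t i * Φ χ (proj₁ i))
      image-Φ t adm = trans (identity (normal t) inv)
        (trans (+-cong (expansion (remainder (normal t)) (Reducible.standard (normal t)) inv)
          (combination-killed (combination (normal t)) adm)) (+-identityʳ _))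
        where inv = Φ-invariant (Admissible.invariant adm)

      f-good : All (λ t → Standard k (proj₂ t) × Small (proj₂ t)) f
      f-good = All.zip (all-standard , proj₂ (bound f))

      coordinate : Basic → Carrier
      coordinate i = lin f (δ (proj₁ i))

      -- If f had a nonzero coordinate at i₀, the images of the standard monomials would all lie in the
      -- span of the other standard monomials, hence be linearly dependent.
      coordinate-zero : ∀ {i₀} → i₀ ∈ Ls → coordinate i₀ ≈ 0#
      coordinate-zero {i₀} i₀∈ with em {P = coordinate i₀ ≈ 0#}
      ... | yes eq = eq
      ... | no r≉0 =
        contradiction some (All.All¬⇒¬Any (All.tabulate λ {t} t∈ ¬0 → ¬0 (all-zero t∈)))
        where
        dependence = proportional-combination Ls entry coordinate i₀∈
        cs = proj₁ dependence
        cs↭ = proj₁ (proj₂ dependence)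
        some = proj₁ (proj₂ (proj₂ dependence))
        balanced : ∀ {i} → i ∈ Ls → lin cs (λ t → entry t i) * coordinate i₀ ≈
          lin cs (λ t → entry t i₀) * coordinate i
        balanced = proj₂ (proj₂ (proj₂ dependence))
        r = coordinate i₀
        total = lin cs (λ t → entry t i₀)
        -- By `balanced`, `g` agrees with `total` times `f` modulo the kernel of the substitution,
        -- so it is killed along with `f`. Its monomials are distinct and nesting-free, hence all
        -- its coefficients vanish.
        g : Poly R n
        g = map (λ (a , t) → a * r , image t) cs
        g-kills : Kills g
        g-kills {χ} adm = begin
          lin g (Φ χ)
            ≈⟨ ∑-map _ cs ⟩
          ∑ cs (λ (a , t) → a * r * Φ χ (image t))
            ≈⟨ ∑-cong′ cs (λ (a , t) → trans (*-congʳ (*-comm a r))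
              (trans (*-assoc r a _) (*-congˡ
                (*-congˡ (trans (image-Φ t adm) (∑-cong′ Ls λ i → *-comm _ _)))))) ⟩
          ∑ cs (λ (a , t) → r * (a * ∑ Ls (λ i → Φ χ (proj₁ i) * entry t i)))
            ≈⟨ ∑-*ˡ cs r ⟨
          r * lin cs (λ t → ∑ Ls (λ i → Φ χ (proj₁ i) * entry t i))
            ≈⟨ *-congˡ (lin-∑ cs Ls (λ i → Φ χ (proj₁ i)) (λ i t → entry t i)) ⟩
          r * ∑ Ls (λ i → Φ χ (proj₁ i) * lin cs (λ t → entry t i))
            ≈⟨ ∑-*ˡ Ls r ⟩
          ∑ Ls (λ i → r * (Φ χ (proj₁ i) * lin cs (λ t → entry t i)))
            ≈⟨ ∑-cong Ls (λ {i} i∈ → trans (*-comm r _)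
              (trans (*-assoc _ _ r) (trans (*-congˡ (balanced i∈))
                (trans (*-comm _ _) (*-assoc total _ _))))) ⟩
          ∑ Ls (λ i → total * (coordinate i * Φ χ (proj₁ i)))
            ≈⟨ ∑-*ˡ Ls total ⟨
          total * ∑ Ls (λ i → coordinate i * Φ χ (proj₁ i))
            ≈⟨ *-congˡ (expansion f f-good (Φ-invariant (Admissible.invariant adm))) ⟨
          total * lin f (Φ χ)
            ≈⟨ trans (*-congˡ (kills adm)) (zeroʳ total) ⟩
          0# ∎
        cs-distinct : AllPairs (λ s t → ¬ (proj₁ (proj₂ s) ↭ proj₁ (proj₂ t))) cs
        cs-distinct = AllPairs.map⁻ (allPairs-resp-↭ (λ ¬p p → ¬p (↭-sym p)) (↭-sym cs↭) distinct)
        all-zero : ∀ {t} → t ∈ cs → proj₁ t ≈ 0#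
        all-zero {a , t} t∈ =
          [ (λ a≈0 → a≈0) , (λ r≈0 → contradiction r≈0 r≉0) ]′ (domain (nesting-independent g
          (AllPairs.map⁺ (AllPairs.map (λ {(_ , (m , std , _))} {(_ , (m′ , std′ , _))} ¬p p →
            ¬p (uncross-injective std std′ p)) cs-distinct))
          (All.map⁺ (All.universal (λ (_ , (m , std , _)) → uncross-nestingFree m std) cs)) g-kills
          (∈-map⁺ (λ (a , t) → a * r , image t) t∈)))

    standard-independent : _≈ₚ_ R f []
    standard-independent = lin⇒≈ₚ f [] λ {χ} inv →
      trans (expansion f f-good inv) (∑-zero Ls λ i∈ →
        trans (*-congʳ (coordinate-zero i∈)) (zeroˡ _))

-- Heyting fields as nontrivial domains.

module FieldProperties (em : ∀ {ℓ} → ExcludedMiddle ℓ) {c ℓ₁ ℓ₂} (𝕂 : HeytingField c ℓ₁ ℓ₂) where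
  open HeytingField 𝕂 using (_#_; tight; #⇒invertible; invertible⇒#)
  open CommutativeRing (fieldRing 𝕂) hiding (zero)
  open import Algebra.Properties.Ring ring using (-0#≈0#)

  private
    x-0 : ∀ x → x - 0# ≈ x
    x-0 x = trans (+-congˡ -0#≈0#) (+-identityʳ x)

  domain : NoZeroDivisors (fieldRing 𝕂)
  domain {x} {y} xy≈0 with em {P = x # 0#}
  ... | no ¬x#0 = inj₁ (proj₁ (tight x 0#) ¬x#0)
  ... | yes x#0 with #⇒invertible x#0
  ...   | z , zx≈1 , _ = inj₂ (begin
    y                  ≈⟨ *-identityˡ y ⟨
    1# * y             ≈⟨ *-congʳ zx≈1 ⟨
    z * (x - 0#) * y   ≈⟨ trans (*-congʳ (*-congˡ (x-0 x))) (*-assoc z x y) ⟩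
    z * (x * y)        ≈⟨ trans (*-congˡ xy≈0) (zeroʳ z) ⟩
    0#                 ∎)
    where open import Relation.Binary.Reasoning.Setoid setoid

  nontrivial : Nontrivial (fieldRing 𝕂)
  nontrivial eq =
    proj₂ (tight 1# 0#) eq (invertible⇒# (1# , trans (*-identityˡ _) (x-0 1#) ,
      trans (*-identityʳ _) (x-0 1#)))

-- Weights along exchange steps.

module Weights {r ℓ₁ ℓ₂ ℓ₃} (ℝ : RealNumbers r ℓ₁ ℓ₂ ℓ₃) {n : ℕ} where
  private module ℝ = RealNumbers ℝ
  open CommutativeRing (fieldRing ℝ.heytingField) using (_≈_; _+_; _*_; -_; 0#; 1#; Carrier; +-comm; +-assoc; +-cong; +-congˡ; +-congʳ;
    +-identityˡ; +-identityʳ; -‿inverseʳ; -‿inverseˡ; sym; trans; refl; setoid)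
  open Sums (fieldRing ℝ.heytingField) using (x∙yz≈y∙xz)
  open ℝ using (_≤_; +-monoˡ-≤)
  open import Relation.Binary.Bundles using (TotalOrder)
  open TotalOrder ℝ.totalOrder public using () renaming (refl to ≤-refl; trans to ≤-trans; antisym to ≤-antisym; total to ≤-total;
    reflexive to ≤-reflexive; ≤-respˡ-≈ to ≤-respˡ; ≤-respʳ-≈ to ≤-respʳ)
  open Max ℝ.totalOrder using (x⊔y≤z⇒x≤z; x⊔y≤z⇒y≤z)

  +-monoʳ-≤ : ∀ {x y} z → x ≤ y → z + x ≤ z + y
  +-monoʳ-≤ z le = ≤-respˡ (+-comm _ z) (≤-respʳ (+-comm _ z) (+-monoˡ-≤ z le))

  private
    x+z-z : ∀ x z → (x + z) + - z ≈ x
    x+z-z x z = trans (+-assoc x z (- z)) (trans (+-congˡ (-‿inverseʳ z)) (+-identityʳ x))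

  +-cancelʳ : ∀ {x y} z → x + z ≈ y + z → x ≈ y
  +-cancelʳ {x} {y} z eq = trans (sym (x+z-z x z)) (trans (+-congʳ eq) (x+z-z y z))

  weight-↭ : ∀ (v : Weight ℝ n) {s t} → s ↭ t → weight ℝ v s ≈ weight ℝ v t
  weight-↭ v ↭.refl         = refl
  weight-↭ v (prep e p)     = +-congˡ (weight-↭ v p)
  weight-↭ v (↭.swap e f p) = trans (+-congˡ (+-congˡ (weight-↭ v p))) (x∙yz≈y∙xz _ _ _)
  weight-↭ v (↭.trans p q)  = trans (weight-↭ v p) (weight-↭ v q)

  weight-++ : ∀ (v : Weight ℝ n) s t → weight ℝ v (s ++ t) ≈ weight ℝ v s + weight ℝ v t
  weight-++ v []      t = sym (+-identityˡ _)
  weight-++ v (e ∷ s) t = trans (+-congˡ (weight-++ v s t)) (sym (+-assoc _ _ _))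

  -- Excludes ties only; combined with fp-positivity it makes every exchange step raise the weight
  -- strictly.
  Strict : Weight ℝ n → Set ℓ₁
  Strict v = ∀ {a a′ b b′ : Fin n} (p : a Fin.< a′) (q : a′ Fin.< b) (r : b Fin.< b′) →
    ¬ (v (edge p) + v (edge r) ≈ v (edge (Fin.<-trans p q)) + v (edge (Fin.<-trans q r))) ×
    ¬ (v (edge (Fin.<-trans p (Fin.<-trans q r))) + v (edge q) ≈
      v (edge (Fin.<-trans p q)) + v (edge (Fin.<-trans q r)))

  module _ {v : Weight ℝ n} (positive : FPPositive ℝ v) where

    private
      reassociate : ∀ e f (F : Monomial n) {E} → E ↭ e ∷ f ∷ F → weight ℝ v E ≈
        (v e + v f) + weight ℝ v F
      reassociate e f F p = trans (weight-↭ v p) (sym (+-assoc _ _ _))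

    ⇝-weight : ∀ {E E′} → E ⇝ E′ → weight ℝ v E ≤ weight ℝ v E′
    ⇝-weight (rejoin p q r F (inj₁ E↭)) =
      ≤-respˡ (sym (reassociate _ _ F E↭))
        (≤-respʳ (+-assoc _ _ _) (+-monoˡ-≤ _ (x⊔y≤z⇒x≤z _ _ (positive p q r))))
    ⇝-weight (rejoin p q r F (inj₂ E↭)) =
      ≤-respˡ (sym (reassociate _ _ F E↭))
        (≤-respʳ (+-assoc _ _ _) (+-monoˡ-≤ _ (x⊔y≤z⇒y≤z _ _ (positive p q r))))

    ⇝*-weight : ∀ {E C} → E ⇝* C → weight ℝ v E ≤ weight ℝ v C
    ⇝*-weight (done p)   = ≤-reflexive (weight-↭ v p)
    ⇝*-weight (more s r) = ≤-trans (⇝-weight s) (⇝*-weight r)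

    ⇝-strict : Strict v → ∀ {E E′} → E ⇝ E′ → ¬ (weight ℝ v E ≈ weight ℝ v E′)
    ⇝-strict strict (rejoin p q r F (inj₁ E↭)) eq = proj₁ (strict p q r)
      (+-cancelʳ (weight ℝ v F) (trans (sym (reassociate _ _ F E↭))
        (trans eq (sym (+-assoc _ _ _)))))
    ⇝-strict strict (rejoin p q r F (inj₂ E↭)) eq = proj₂ (strict p q r)
      (+-cancelʳ (weight ℝ v F) (trans (sym (reassociate _ _ F E↭))
        (trans eq (sym (+-assoc _ _ _)))))

    ⇝*-strict : Strict v → ∀ {E C} → E ⇝* C → weight ℝ v E ≈ weight ℝ v C → E ↭ C
    ⇝*-strict strict (done p)   eq = p
    ⇝*-strict strict (more s r) eq = contradiction
      (≤-antisym (⇝-weight s) (≤-respʳ (sym eq) (⇝*-weight r))) (⇝-strict strict s)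

-- Hyperplanes whose avoidance excludes ties.

module Generic (em : ∀ {ℓ} → ExcludedMiddle ℓ) {r ℓ₁ ℓ₂ ℓ₃} (ℝ : RealNumbers r ℓ₁ ℓ₂ ℓ₃) {n : ℕ} where
  private
    module ℝ = RealNumbers ℝ
    Rℝ = fieldRing ℝ.heytingField
  open CommutativeRing Rℝ hiding (zero)
  open import Relation.Binary.Reasoning.Setoid setoid
  open Sums Rℝ
  open Weights ℝ {n}
  open FieldProperties em ℝ.heytingField using (nontrivial)

  indicator : Edge n → Edge n → Carrier
  indicator e x with e ≟ₑ x
  ... | yes _ = 1#
  ... | no  _ = 0#

  indicator-yes : ∀ e → indicator e e ≈ 1#
  indicator-yes e with e ≟ₑ e
  ... | yes _ = refl
  ... | no ¬p = contradiction ≡.refl ¬p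

  indicator-no : ∀ {e x} → e ≢ x → indicator e x ≈ 0#
  indicator-no {e} {x} e≢x with e ≟ₑ x
  ... | yes p = contradiction p e≢x
  ... | no _  = refl

  normal : Edge n → Edge n → Edge n → Edge n → Weight ℝ n
  normal e f g h x = (indicator e x + indicator f x) - (indicator g x + indicator h x)

  indicator-∑ : ∀ e (v : Weight ℝ n) → ∑ (edges n) (λ x → indicator e x * v x) ≈ v e
  indicator-∑ e v with ∈⇒↭∷ (∈-edges e)
  ... | es , p = begin
    ∑ (edges n) (λ x → indicator e x * v x)                   ≈⟨ ∑-↭ p ⟩
    indicator e e * v e + ∑ es (λ x → indicator e x * v x)
      ≈⟨ +-cong (trans (*-congʳ (indicator-yes e)) (*-identityˡ _))
      (∑-zero es λ x∈ → trans (*-congʳ (indicator-no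
        (All.lookup (AllPairs.head (unique-resp-↭ p edges-unique)) x∈))) (zeroˡ _)) ⟩
    v e + 0#                                                  ≈⟨ +-identityʳ _ ⟩
    v e                                                       ∎

  normal-∑ : ∀ e f g h (v : Weight ℝ n) → ∑ (edges n) (λ x → normal e f g h x * v x) ≈
    (v e + v f) - (v g + v h)
  normal-∑ e f g h v = begin
    ∑ (edges n) (λ x → normal e f g h x * v x)
      ≈⟨ ∑-cong′ (edges n) (λ x → trans (distribʳ (v x) _ _)
        (+-cong (distribʳ (v x) _ _) (trans (sym (-‿distribˡ-* _ _))
          (-‿cong (distribʳ (v x) _ _))))) ⟩
    ∑ (edges n) (λ x → (indicator e x * v x + indicator f x * v x) -
      (indicator g x * v x + indicator h x * v x))
      ≈⟨ trans (∑-+ (edges n)) (+-cong (∑-+ (edges n))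
        (trans (∑-neg (edges n)) (-‿cong (∑-+ (edges n))))) ⟩
    (∑ (edges n) (λ x → indicator e x * v x) + ∑ (edges n) (λ x → indicator f x * v x)) -
    (∑ (edges n) (λ x → indicator g x * v x) + ∑ (edges n) (λ x → indicator h x * v x))
      ≈⟨ +-cong (+-cong (indicator-∑ e v) (indicator-∑ f v))
        (-‿cong (+-cong (indicator-∑ g v) (indicator-∑ h v))) ⟩
    (v e + v f) - (v g + v h) ∎

  -- All hyperplanes on which `v e + v f = v g + v h`. Quadruples for which this is an identity have
  -- normal vector zero and are filtered out.
  hyperplanes : List (Weight ℝ n)
  hyperplanes = filter (λ h → em {P = Nonzero ℝ h})
    (concatMap (λ e → concatMap (λ f → concatMap (λ g → map (normal e f g) (edges n)) (edges n))
      (edges n)) (edges n))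

  hyperplanes-nonzero : All (Nonzero ℝ) hyperplanes
  hyperplanes-nonzero = All.all-filter (λ h → em {P = Nonzero ℝ h})
    (concatMap (λ e → concatMap (λ f → concatMap (λ g → map (normal e f g) (edges n)) (edges n))
      (edges n)) (edges n))

  -- The three inequalities make the entry of the normal vector at `e` equal to 1.
  ∈-hyperplanes : ∀ e f g h → e ≢ g → e ≢ h → e ≢ f → normal e f g h ∈ hyperplanes
  ∈-hyperplanes e f g h e≢g e≢h e≢f = ∈-filter⁺ (λ h → em {P = Nonzero ℝ h})
      (∈-concat e λ _ → ∈-concat f λ _ → ∈-concat g λ _ → ∈-map⁺ (normal e f g) (∈-edges h))
      (e , λ eq → nontrivial (trans (sym value) eq))
    where
    open import Data.List.Membership.Propositional.Properties using (∈-concatMap⁺)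
    ∈-concat : ∀ {a} {A : Set a} {F : Edge n → List A} {y} e → (e ≡ e → y ∈ F e) →
      y ∈ concatMap F (edges n)
    ∈-concat {F = F} e y∈ = ∈-concatMap⁺ F (Any.map (λ { ≡.refl → y∈ ≡.refl }) (∈-edges e))
    value : normal e f g h e ≈ 1#
    value = trans (+-cong (trans (+-cong (indicator-yes e) (indicator-no (e≢f ∘ ≡.sym)))
      (+-identityʳ 1#))
      (trans (-‿cong (trans (+-cong (indicator-no (e≢g ∘ ≡.sym)) (indicator-no (e≢h ∘ ≡.sym)))
        (+-identityˡ 0#))) -0#≈0#)) (+-identityʳ 1#)

  generic⇒strict : ∀ v → All (λ h → ¬ OnHyperplane ℝ h v) hyperplanes → Strict v
  generic⇒strict v avoid {a} {a′} {b} {b′} p q r =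
      separated (edge p) (edge r) (λ eq → ℕ.<⇒≢ q (≡.sym (≡.cong (toℕ ∘ hi) eq)))
        (λ eq → ℕ.<⇒≢ (ℕ.<-trans p q) (≡.cong (toℕ ∘ lo) eq)) ,
      separated (edge (Fin.<-trans p (Fin.<-trans q r))) (edge q)
        (λ eq → ℕ.<⇒≢ r (≡.cong (toℕ ∘ hi) eq)) (λ eq → ℕ.<⇒≢ p (≡.cong (toℕ ∘ lo) eq))
    where
    x = edge (Fin.<-trans p q)
    y = edge (Fin.<-trans q r)
    separated : ∀ g h → x ≢ g → x ≢ h → ¬ (v g + v h ≈ v x + v y)
    separated g h x≢g x≢h eq =
      All.lookup avoid (∈-hyperplanes x y g h x≢g x≢h (λ eq → ℕ.<⇒≢ p (≡.cong (toℕ ∘ lo) eq)))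
      (trans (normal-∑ x y g h v) (trans (+-congʳ (sym eq)) (-‿inverseʳ _)))

-- Initial forms of elements of the Pfaffian ideal.

module InitialIdeals (em : ∀ {ℓ} → ExcludedMiddle ℓ) {r ℓ₁ ℓ₂ ℓ₃ c ℓ₄ ℓ₅}
                     (ℝ : RealNumbers r ℓ₁ ℓ₂ ℓ₃) (𝕂 : HeytingField c ℓ₄ ℓ₅) (k n : ℕ) where
  R = fieldRing 𝕂
  open CommutativeRing R hiding (zero)
  open import Relation.Binary.Reasoning.Setoid setoid
  open Sums R
  open Polynomials R {n}
  open Weights ℝ {n}
  open FieldProperties em 𝕂
  open Substitution em R k n using (Kills; Φ; Φ-invariant; ideal-killed; module Admissible)
  open Reduction em R k n
  open StandardIndependence em R (λ {x} {y} → domain {x} {y}) nontrivial k n using (standard-independent; combination-killed)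

  private
    module ℝ = RealNumbers ℝ
    P = Poly R n

  ideal-bind : ∀ {s t} {S : Pred P s} {T : Pred P t} → S ⊆ Ideal⟨_⟩ R T →
    Ideal⟨_⟩ R S ⊆ Ideal⟨_⟩ R T
  ideal-bind S⊆ (gen f∈)     = S⊆ f∈
  ideal-bind S⊆ zero         = zero
  ideal-bind S⊆ (add f∈ g∈)  = add (ideal-bind S⊆ f∈) (ideal-bind S⊆ g∈)
  ideal-bind S⊆ (mult g f∈)  = mult g (ideal-bind S⊆ f∈)
  ideal-bind S⊆ (resp eq f∈) = resp eq (ideal-bind S⊆ f∈)

  coeff-↭ : ∀ (f : P) {s t} → s ↭ t → coeff R f s ≈ coeff R f t
  coeff-↭ f {s} {t} p = trans (coeff-lin f s) (trans (lin-cong f same) (sym (coeff-lin f t)))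
    where
    same : ∀ u → δ s u ≈ δ t u
    same u with em {P = u ↭ s}
    ... | yes q = trans (δ-yes q) (sym (δ-yes (↭-trans q p)))
    ... | no ¬q = trans (δ-no ¬q) (sym (δ-no λ q → ¬q (↭-trans q (↭-sym p))))

  coeff-absent : ∀ (f : P) {m} → (∀ {t} → t ∈ f → ¬ (proj₂ t ↭ m)) → coeff R f m ≈ 0#
  coeff-absent f {m} absent =
    trans (coeff-lin f m) (∑-zero f λ t∈ → trans (*-congˡ (δ-no (absent t∈))) (zeroʳ _))

  support-∈ : ∀ (f : P) {m} → ¬ (coeff R f m ≈ 0#) → ∃ λ t → t ∈ f × proj₂ t ↭ m
  support-∈ f {m} supp with em {P = ∃ λ t → t ∈ f × proj₂ t ↭ m}
  ... | yes x = x
  ... | no ¬x = contradiction (coeff-absent f λ t∈ p → ¬x (_ , t∈ , p)) supp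

  module _ (v : Weight ℝ n) where

    w : Monomial n → ℝ.Carrier
    w = weight ℝ v

    leading-exists : ∀ (f : P) → _≈ₚ_ R f [] ⊎ ∃ (IsLeading ℝ R v f)
    leading-exists f with search (map proj₂ f)
      where
      search : ∀ (ms : List (Monomial n)) → (∀ {m} → m ∈ ms → coeff R f m ≈ 0#) ⊎
               ∃ λ m → ¬ (coeff R f m ≈ 0#) ×
                 (∀ {m′} → m′ ∈ ms → ¬ (coeff R f m′ ≈ 0#) → w m′ ℝ.≤ w m)
      search []       = inj₁ λ ()
      search (m ∷ ms) with em {P = coeff R f m ≈ 0#} | search ms
      ... | yes null | inj₁ nulls = inj₁ λ { (here ≡.refl) → null ; (there m∈) → nulls m∈ }
      ... | yes null | inj₂ (l , supp , max) =
        inj₂ (l , supp , λ { (here ≡.refl) s → contradiction null s ; (there m∈) → max m∈ })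
      ... | no s     | inj₁ nulls =
        inj₂ (m , s , λ { (here ≡.refl) _ → ≤-refl ; (there m∈) s′ → contradiction (nulls m∈) s′ })
      ... | no s     | inj₂ (l , supp , max) with ≤-total (w m) (w l)
      ...   | inj₁ le = inj₂ (l , supp , λ { (here ≡.refl) _ → le ; (there m∈) → max m∈ })
      ...   | inj₂ ge =
        inj₂ (m , s , λ { (here ≡.refl) _ → ≤-refl ; (there m∈) s′ → ≤-trans (max m∈ s′) ge })
    ... | inj₁ nulls = inj₁ null
      where
      null : _≈ₚ_ R f []
      null m with em {P = coeff R f m ≈ 0#}
      ... | yes eq  = eq
      ... | no supp = let (t , t∈ , p) = support-∈ f supp in trans (coeff-↭ f (↭-sym p)) (nulls (∈-map⁺ proj₂ t∈))
    ... | inj₂ (m , supp , max) = inj₂ (m , supp , λ m′ supp′ → let (t , t∈ , p) = support-∈ f supp′ in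
            ≤-respˡ (weight-↭ v p) (max (∈-map⁺ proj₂ t∈) λ eq →
              supp′ (trans (coeff-↭ f (↭-sym p)) eq)))

    component : ℝ.Carrier → P → P
    component ω = filter λ t → em {P = w (proj₂ t) ℝ.≈ ω}

    component-lin : ∀ ω (f : P) χ → (∀ {t} → t ∈ f → ¬ (w (proj₂ t) ℝ.≈ ω) → χ (proj₂ t) ≈ 0#) →
      lin (component ω f) χ ≈ lin f χ
    component-lin ω []            χ null = refl
    component-lin ω ((a , m) ∷ f) χ null with em {P = w m ℝ.≈ ω}
    ... | yes _ = +-congˡ (component-lin ω f χ (null ∘ there))
    ... | no ¬p = trans (component-lin ω f χ (null ∘ there))
      (sym (trans (+-congʳ (trans (*-congˡ (null (here ≡.refl) ¬p)) (zeroʳ a))) (+-identityˡ _)))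

    component-coeff : ∀ ω (f : P) {m} → w m ℝ.≈ ω → coeff R (component ω f) m ≈ coeff R f m
    component-coeff ω f {m} eq = trans (coeff-lin (component ω f) m) (trans
      (component-lin ω f (δ m) λ {t} _ ¬p → δ-no {m} {proj₂ t} λ p → ¬p (ℝ.trans (weight-↭ v p) eq))
        (sym (coeff-lin f m)))

    component-coeff-0 : ∀ ω (f : P) {m} → ¬ (w m ℝ.≈ ω) → coeff R (component ω f) m ≈ 0#
    component-coeff-0 ω f ¬eq = coeff-absent (component ω f) λ {t} t∈ p →
      ¬eq (ℝ.trans (ℝ.sym (weight-↭ v p))
        (proj₂ (∈-filter⁻ (λ t → em {P = w (proj₂ t) ℝ.≈ ω}) {xs = f} t∈)))

    component-initial : ∀ (f : P) {m₀} → IsLeading ℝ R v f m₀ →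
      IsInitialForm ℝ R v f (component (w m₀) f)
    component-initial f {m₀} (supp , max) m = leading , nonleading
      where
      leading : IsLeading ℝ R v f m → coeff R (component (w m₀) f) m ≈ coeff R f m
      leading (supp′ , max′) = component-coeff (w m₀) f (≤-antisym (max m supp′) (max′ m₀ supp))
      nonleading : ¬ IsLeading ℝ R v f m → coeff R (component (w m₀) f) m ≈ 0#
      nonleading ¬lead with em {P = w m ℝ.≈ w m₀} | em {P = coeff R f m ≈ 0#}
      ... | no ¬eq | _        = component-coeff-0 (w m₀) f ¬eq
      ... | yes eq | yes null = trans (component-coeff (w m₀) f eq) null
      ... | yes eq | no supp′ = contradiction (supp′ , λ m′ s → ≤-respʳ (ℝ.sym eq) (max m′ s)) ¬lead

    module _ (positive : FPPositive ℝ v) where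

      -- This is the initial form of the Pfaffian, because `C` is one of its leading monomials.
      top : Crossing → P
      top (C , _) = component (w C) (pfaffian R (support C))

      pfaffian-terms : ∀ ((C , _) : Crossing) {t} → t ∈ pfaffian R (support C) → word (proj₂ t) ↭
        word C
      pfaffian-terms (C , _ , cC) t∈ with ∈-map⁻ _ t∈
      ... | E , E∈ , ≡.refl = ↭-trans (matching⇒↭
        (support C) E (proj₂ (∈-filter⁻ (isPerfectMatching? (support C)) {xs = sublists (edges n)}
          E∈)))
                                      (elements-support {C = C} (crossing-unique-word cC))

      pfaffian-⇝* : ∀ ((C , _) : Crossing) {t} → t ∈ pfaffian R (support C) → proj₂ t ⇝* C
      pfaffian-⇝* X@(C , _ , cC) t∈ = uncrossing cC (pfaffian-terms X t∈)

      crossing-coeff : ∀ ((C , len , cC) : Crossing) → ∃ λ m → coeff R (pfaffian R (support C)) C ≈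
        unit m
      crossing-coeff (C , len , cC) with matchings-split cC
      ... | C′ , Es , split , C′↭ , others = cr C′ , (begin
        coeff R (pfaffian R (support C)) C
          ≈⟨ coeff-lin (pfaffian R (support C)) C ⟩
        lin (pfaffian R (support C)) (δ C)
          ≈⟨ lin-pfaffian {C = C} split (δ C) ⟩
        unit (cr C′) * δ C C′ + ∑ Es (λ E → unit (cr E) * δ C E)
          ≈⟨ +-cong (trans (*-congˡ (δ-yes C′↭)) (*-identityʳ _))
             (∑-zero Es λ E∈ → trans (*-congˡ (δ-no (proj₂ (All.lookup others E∈)))) (zeroʳ _)) ⟩
        unit (cr C′) + 0#                                              ≈⟨ +-identityʳ _ ⟩
        unit (cr C′)                                                   ∎)

      unit-nonzero : ∀ m → ¬ (unit m ≈ 0#)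
      unit-nonzero m eq = nontrivial (trans (sym (unit-square m)) (trans (*-congˡ eq) (zeroʳ _)))

      crossing-leading : ∀ ((C , _) : Crossing) → IsLeading ℝ R v (pfaffian R (support C)) C
      crossing-leading X@(C , _) =
        (λ eq → unit-nonzero (proj₁ (crossing-coeff X)) (trans (sym (proj₂ (crossing-coeff X))) eq)) ,
        λ m′ supp → let (t , t∈ , p) = support-∈ (pfaffian R (support C)) supp in
          ≤-respˡ (weight-↭ v p) (⇝*-weight positive (pfaffian-⇝* X t∈))

      pfaffian-∈ : ∀ ((C , _) : Crossing) → Pfaffians R (k ℕ.+ 1) (pfaffian R (support C))
      pfaffian-∈ (C , len , cC) = support C ,
        ≡.trans (size-support {C = C} (crossing-unique-word cC))
          (≡.cong (2 ℕ.*_) (≡.trans len (ℕ.+-comm 1 k))) , λ _ → refl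

      top-∈ : ∀ X → InitialForms ℝ R v (Pfaffians R (k ℕ.+ 1)) (top X)
      top-∈ X@(C , _) =
        pfaffian R (support C) , pfaffian-∈ X ,
          component-initial (pfaffian R (support C)) (crossing-leading X)

      -- Only summands that reach the weight `ω` contribute, each through the initial form of its
      -- Pfaffian.
      tops : ℝ.Carrier → Combination → P
      tops ω J = concatMap (λ (a , s , X) → _*ₚ_ R [ a , s ] (top X))
        (filter (λ (_ , s , (C , _)) → em {P = w (s ++ C) ℝ.≈ ω}) J)

      tops-∈ : ∀ {s} {S : Pred P s} → (∀ X → Ideal⟨_⟩ R S (top X)) → ∀ ω J → Ideal⟨_⟩ R S (tops ω J)
      tops-∈ {S = S} h ω J = go (filter (λ (_ , s , (C , _)) → em {P = w (s ++ C) ℝ.≈ ω}) J)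
        where
        go : ∀ (J : Combination) → Ideal⟨_⟩ R S
          (concatMap (λ (a , s , X) → _*ₚ_ R [ a , s ] (top X)) J)
        go []                = zero
        go ((a , s , X) ∷ J) = add (mult [ a , s ] (h X)) (go J)

      tops-lin : ∀ ω J χ → lin (tops ω J) χ ≈
                 ∑ (filter (λ (_ , s , (C , _)) → em {P = w (s ++ C) ℝ.≈ ω}) J)
                   (λ (a , s , X) → a * lin (top X) (λ t → χ (s ++ t)))
      tops-lin ω J χ = trans (∑-concatMap (λ (a , s , X) → _*ₚ_ R [ a , s ] (top X)) J′)
        (∑-cong′ J′ λ (a , s , X) → trans (lin-*ₚ [ a , s ] (top X) χ) (+-identityʳ _))
        where J′ = filter (λ (_ , s , (C , _)) → em {P = w (s ++ C) ℝ.≈ ω}) J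

      -- Every term of J has weight at most ω, so the part of weight ω of the value of J is
      -- obtained by replacing each pfaffian by its initial form.
      tops-coeff : ∀ ω J → All (λ (_ , s , (C , _)) → w (s ++ C) ℝ.≤ ω) J → ∀ m → w m ℝ.≈ ω →
                   lin (tops ω J) (δ m) ≈ value J (δ m)
      tops-coeff ω J bounded m eq = trans (tops-lin ω J (δ m)) (go J bounded)
        where
        weight-s : ∀ s {E C : Monomial n} → w E ℝ.≤ w C → w (s ++ E) ℝ.≤ w (s ++ C)
        weight-s s {E} {C} le =
          ≤-respˡ (ℝ.sym (weight-++ v s E)) (≤-respʳ (ℝ.sym (weight-++ v s C)) (+-monoʳ-≤ (w s) le))
        full : ∀ s (X : Crossing) → w (s ++ proj₁ X) ℝ.≈ ω →
               lin (top X) (λ t → δ m (s ++ t)) ≈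
                 lin (pfaffian R (support (proj₁ X))) (λ t → δ m (s ++ t))
        full s X@(C , _) sC =
          component-lin (w C) (pfaffian R (support C)) (λ t → δ m (s ++ t)) λ {(_ , E)} _ ¬wE →
            δ-no {m} {s ++ E} λ p →
          ¬wE (+-cancelʳ (w s) (ℝ.trans (ℝ.+-comm _ _)
            (ℝ.trans (ℝ.sym (weight-++ v s E))
              (ℝ.trans (ℝ.trans (weight-↭ v p) (ℝ.trans eq (ℝ.sym sC)))
            (ℝ.trans (weight-++ v s C) (ℝ.+-comm _ _))))))
        none : ∀ s (X : Crossing) → w (s ++ proj₁ X) ℝ.≤ ω → ¬ (w (s ++ proj₁ X) ℝ.≈ ω) →
               lin (pfaffian R (support (proj₁ X))) (λ t → δ m (s ++ t)) ≈ 0#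
        none s X@(C , _) le ¬eq =
          ∑-zero (pfaffian R (support C)) λ {(a , E)} t∈ → trans (*-congˡ (δ-no {m} {s ++ E} λ p →
          ¬eq (≤-antisym le (≤-respˡ (ℝ.trans (weight-↭ v p) eq)
            (weight-s s (⇝*-weight positive (pfaffian-⇝* X t∈))))))) (zeroʳ a)
        go : ∀ J → All (λ (_ , s , (C , _)) → w (s ++ C) ℝ.≤ ω) J →
             ∑ (filter (λ (_ , s , (C , _)) → em {P = w (s ++ C) ℝ.≈ ω}) J)
               (λ (a , s , X) → a * lin (top X) (λ t → δ m (s ++ t))) ≈ value J (δ m)
        go []                [] = refl
        go ((a , s , X) ∷ J) (le ∷ les) with em {P = w (s ++ proj₁ X) ℝ.≈ ω}
        ... | yes sC = +-cong (*-congˡ (full s X sC)) (go J les)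
        ... | no ¬sC =
          trans (go J les) (sym (trans (+-congʳ (trans (*-congˡ (none s X le ¬sC)) (zeroʳ a)))
            (+-identityˡ _)))

      tops-coeff-0 : ∀ ω J m → ¬ (w m ℝ.≈ ω) → lin (tops ω J) (δ m) ≈ 0#
      tops-coeff-0 ω J m ¬eq = trans (tops-lin ω J (δ m))
        (∑-zero (filter (λ (_ , s , (C , _)) → em {P = w (s ++ C) ℝ.≈ ω}) J) λ {(a , s , X)} j∈ →
        trans (*-congˡ (null a s X (proj₂
          (∈-filter⁻ (λ (_ , s , (C , _)) → em {P = w (s ++ C) ℝ.≈ ω}) {xs = J} j∈)))) (zeroʳ a))
        where
        null : ∀ (a : Carrier) s (X : Crossing) → w (s ++ proj₁ X) ℝ.≈ ω →
          lin (top X) (λ t → δ m (s ++ t)) ≈ 0#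
        null _ s X@(C , _) sC =
          ∑-zero (top X) λ {(b , E)} t∈ → trans (*-congˡ (δ-no {m} {s ++ E} λ p → ¬eq
          (ℝ.trans (ℝ.sym (weight-↭ v p)) (ℝ.trans (weight-++ v s E) (ℝ.trans
            (ℝ.+-cong ℝ.refl (proj₂ (∈-filter⁻ (λ t → em {P = w (proj₂ t) ℝ.≈ w C})
              {xs = pfaffian R (support C)} t∈)))
            (ℝ.trans (ℝ.sym (weight-++ v s C)) sC)))))) (zeroʳ b)

      -- Terms of `f` above the leading weight cancel and are dropped first; the reduction never
      -- exceeds that weight afterwards. Its remainder is standard and killed by the substitution,
      -- hence zero, so `f` is a combination of Pfaffians without cancellation above the leading
      -- weight.
      representation : ∀ {f m₀} → PfaffianIdeal R k f → IsLeading ℝ R v f m₀ →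
                       ∃ λ J → All (λ (_ , s , (C , _)) → w (s ++ C) ℝ.≤ w m₀) J ×
                         (∀ {χ} → Invariant χ → lin f χ ≈ value J χ)
      representation {f} {m₀} f∈ (supp , max) = combination red , bounded red , λ {χ} inv → begin
          lin f χ                                               ≈⟨ ≈ₚ⇒lin f f₀ f≈f₀ inv ⟩
          lin f₀ χ                                              ≈⟨ identity red inv ⟩
          lin (remainder red) χ + value (combination red) χ
            ≈⟨ trans (+-congʳ (≈ₚ⇒lin (remainder red) [] remainder≈0 inv)) (+-identityˡ _) ⟩
          value (combination red) χ                             ∎
        where
        ω = w m₀
        Below : Monomial n → Set ℓ₃
        Below m = w m ℝ.≤ ω
        below? = λ (t : Carrier × Monomial n) → em {P = Below (proj₂ t)}
        f₀ = filter below? f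
        f≈f₀ : _≈ₚ_ R f f₀
        f≈f₀ m with em {P = Below m}
        ... | yes le = trans (coeff-lin f m)
          (trans (sym (∑-filter below? f λ {t} ¬le →
            trans (*-congˡ (δ-no {m} {proj₂ t} λ p → ¬le (≤-respˡ (ℝ.sym (weight-↭ v p)) le)))
              (zeroʳ _))) (sym (coeff-lin f₀ m)))
        ... | no ¬le = trans zero-coeff (sym
          (coeff-absent f₀ λ t∈ p → ¬le (≤-respˡ (weight-↭ v p)
            (proj₂ (∈-filter⁻ below? {xs = f} t∈)))))
          where
          zero-coeff : coeff R f m ≈ 0#
          zero-coeff with em {P = coeff R f m ≈ 0#}
          ... | yes eq = eq
          ... | no s   = contradiction (max m s) ¬le
        below-↭ : ∀ {s t} → s ↭ t → Below s → Below t
        below-↭ p = ≤-respˡ (weight-↭ v p)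
        below-⇝ : ∀ s {E C} → E ⇝* C → Below (s ++ C) → Below (s ++ E)
        below-⇝ s {E} {C} e le = ≤-trans (≤-respˡ (ℝ.sym (weight-++ v s E))
          (≤-respʳ (ℝ.sym (weight-++ v s C)) (+-monoʳ-≤ (w s) (⇝*-weight positive e)))) le
        open Reducible
        red : Reducible Below below-↭ below-⇝ (lin f₀)
        red = reduce-poly Below below-↭ below-⇝ f₀
          (All.map (reduce-monomial Below below-↭ below-⇝ _) (All.all-filter below? f))
        remainder≈0 : _≈ₚ_ R (remainder red) []
        remainder≈0 =
          standard-independent (remainder red) (All.map proj₁ (standard red)) λ {χ} adm → begin
          lin (remainder red) (Φ χ)                                             ≈⟨ +-identityʳ _ ⟨
          lin (remainder red) (Φ χ) + 0#
            ≈⟨ +-congˡ (combination-killed (combination red) adm) ⟨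
          lin (remainder red) (Φ χ) + value (combination red) (Φ χ)
            ≈⟨ identity red (Φ-invariant (Admissible.invariant adm)) ⟨
          lin f₀ (Φ χ)
            ≈⟨ ≈ₚ⇒lin f f₀ f≈f₀ (Φ-invariant (Admissible.invariant adm)) ⟨
          lin f (Φ χ)
            ≈⟨ ideal-killed f∈ adm ⟩
          0#                                                                    ∎

      -- Formulated for an arbitrary ideal that contains every `top X`, so that it serves both for
      -- the initial forms of the Pfaffians and for the crossing monomials.
      initial-form-∈ : ∀ {s} {S : Pred P s} → (∀ X → Ideal⟨_⟩ R S (top X)) → ∀ {g} →
        InitialForms ℝ R v (PfaffianIdeal R k) g → Ideal⟨_⟩ R S g
      initial-form-∈ {S = S} h {g} (f , f∈ , init) with leading-exists f
      ... | inj₁ f≈0 = resp (λ m → sym (proj₂ (init m) λ (supp , _) → supp (f≈0 m))) zero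
      ... | inj₂ (m₀ , lead@(supp₀ , max₀)) = resp (λ m → sym (same m)) (tops-∈ h ω J)
        where
        ω = w m₀
        rep = representation f∈ lead
        J = proj₁ rep
        same : ∀ m → coeff R g m ≈ coeff R (tops ω J) m
        same m with em {P = w m ℝ.≈ ω}
        ... | no ¬eq =
          trans (proj₂ (init m) λ (supp , max) → ¬eq (≤-antisym (max₀ m supp) (max m₀ supp₀)))
                             (sym (trans (coeff-lin (tops ω J) m) (tops-coeff-0 ω J m ¬eq)))
        ... | yes eq = trans g≈f (trans (coeff-lin f m) (trans (proj₂ (proj₂ rep) (δ-invariant m))
                         (trans (sym (tops-coeff ω J (proj₁ (proj₂ rep)) m eq))
                           (sym (coeff-lin (tops ω J) m)))))
          where
          g≈f : coeff R g m ≈ coeff R f m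
          g≈f with em {P = coeff R f m ≈ 0#}
          ... | yes null = trans (proj₂ (init m) λ (supp , _) → supp null) (sym null)
          ... | no supp  = proj₁ (init m) (supp , λ m′ s → ≤-respʳ (ℝ.sym eq) (max₀ m′ s))

      gröbner : IsGröbnerBasis ℝ R v (Pfaffians R (k ℕ.+ 1)) (PfaffianIdeal R k)
      gröbner = gen , (λ {f} → ideal-bind (λ (f , f∈ , init) → gen (f , gen f∈ , init)) {f}) ,
                      (λ {f} → ideal-bind (initial-form-∈ (gen ∘ top-∈)) {f})

      module _ (strict : Strict v) where

        -- Under strictness a matching that can be uncrossed into `C` and has the same weight is `C`
        -- itself, so a single term survives.
        top≈ : ∀ (X : Crossing) → _≈ₚ_ R (top X) [ unit (proj₁ (crossing-coeff X)) , proj₁ X ]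
        top≈ X@(C , _) m with em {P = C ↭ m}
        ... | yes p =
          trans (trans (component-coeff (w C) (pfaffian R (support C)) (ℝ.sym (weight-↭ v p)))
                        (trans (coeff-↭ (pfaffian R (support C)) (↭-sym p))
                          (proj₂ (crossing-coeff X))))
                        (sym (trans (coeff-lin [ unit (proj₁ (crossing-coeff X)) , C ] m)
                          (trans (+-identityʳ _) (trans (*-congˡ (δ-yes p)) (*-identityʳ _)))))
        ... | no ¬p = trans (coeff-absent (top X) absent)
          (sym (coeff-absent [ unit (proj₁ (crossing-coeff X)) , C ] λ { (here ≡.refl) → ¬p }))
          where
          absent : ∀ {t} → t ∈ top X → ¬ (proj₂ t ↭ m)
          absent t∈ q with ∈-filter⁻ (λ t → em {P = w (proj₂ t) ℝ.≈ w C})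
            {xs = pfaffian R (support C)} t∈
          ... | t∈′ , eq = ¬p (↭-trans (↭-sym (⇝*-strict positive strict (pfaffian-⇝* X t∈′) eq)) q)

        *ₚ-cong : ∀ (g f f′ : P) → _≈ₚ_ R f f′ → _≈ₚ_ R (_*ₚ_ R g f) (_*ₚ_ R g f′)
        *ₚ-cong g f f′ eq = lin⇒≈ₚ (_*ₚ_ R g f) (_*ₚ_ R g f′) λ {χ} inv → trans (lin-*ₚ g f χ)
          (trans (∑-cong′ g λ (a , s) → *-congˡ (≈ₚ⇒lin f f′ eq (inv ∘ ++⁺ˡ s)))
            (sym (lin-*ₚ g f′ χ)))

        crossing-initial : InitialIdeal ℝ R v (PfaffianIdeal R k) ≐ Ideal⟨_⟩ R
          (CrossingMonomials R (k ℕ.+ 1))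
        crossing-initial =
          (λ {f} → ideal-bind (initial-form-∈ top∈) {f}) , (λ {f} → ideal-bind crossing∈ {f})
          where
          top∈ : ∀ X → Ideal⟨_⟩ R (CrossingMonomials R (k ℕ.+ 1)) (top X)
          top∈ X@(C , len , cC) = resp (λ m → trans (scaled m) (sym (top≈ X m)))
            (mult [ u , [] ] (gen {f = monomial R C}
              (C , (≡.trans len (ℕ.+-comm 1 k) , cC) , λ _ → refl)))
            where
            u = unit (proj₁ (crossing-coeff X))
            scaled : _≈ₚ_ R (_*ₚ_ R [ u , [] ] (monomial R C)) [ u , C ]
            scaled = lin⇒≈ₚ (_*ₚ_ R [ u , [] ] (monomial R C)) [ u , C ] λ _ →
              +-congʳ (*-congʳ (*-identityʳ u))
          crossing∈ : CrossingMonomials R (k ℕ.+ 1) ⊆ InitialIdeal ℝ R v (PfaffianIdeal R k)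
          crossing∈ {f} (C , (len , cC) , f≈) = resp (λ m → trans (unscaled m) (sym (f≈ m)))
              (mult [ u , [] ] (gen {f = top X}
                (pfaffian R (support C) , gen (pfaffian-∈ X) ,
                  component-initial (pfaffian R (support C)) (crossing-leading X))))
            where
            X : Crossing
            X = C , ≡.trans len (ℕ.+-comm k 1) , cC
            u = unit (proj₁ (crossing-coeff X))
            unscaled : _≈ₚ_ R (_*ₚ_ R [ u , [] ] (top X)) (monomial R C)
            unscaled m = trans (*ₚ-cong [ u , [] ] (top X) [ u , C ] (top≈ X) m)
              (lin⇒≈ₚ (_*ₚ_ R [ u , [] ] [ u , C ]) (monomial R C)
                (λ _ → +-congʳ (*-congʳ (unit-square (proj₁ (crossing-coeff X))))) m)

open import Data.Nat using (_+_; _*_; _≤_)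

theorem2p8 :
  (∀ {ℓ} → ExcludedMiddle ℓ) →
  ∀ {r ℓ₁ ℓ₂ ℓ₃ c ℓ₄ ℓ₅}
  (ℝ : RealNumbers r ℓ₁ ℓ₂ ℓ₃) (𝕂 : HeytingField c ℓ₄ ℓ₅)
  (k n : ℕ) → 1 ≤ k → 2 * k + 2 ≤ n →
  let R = fieldRing 𝕂
      I = PfaffianIdeal R {n} k
  in
  (∀ v → FPPositive ℝ v → IsGröbnerBasis ℝ R v (Pfaffians R (k + 1)) I)
  ×
  ForSufficientlyGeneric ℝ (FPPositive ℝ)
    (λ v → InitialIdeal ℝ R v I ≐ Ideal⟨_⟩ R (CrossingMonomials R (k + 1)))
theorem2p8 em ℝ 𝕂 k n _ _ =
  gröbner ,
  hyperplanes , hyperplanes-nonzero ,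
  λ v positive avoid → crossing-initial v positive (generic⇒strict v avoid)
  where
  open InitialIdeals em ℝ 𝕂 k n
  open Generic em ℝ {n}
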